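{- Let $M=\{3,d_1,d_2,\dots,d_k\}$ be a finite set of natural numbers with $3<d_1<d_2<\dots<d_k$ (where $k\ge 0$). Then $M$ is uhc-realizable if and only if $M$ contains an even number. In that case $M$ is also strongly uhc-realizable.
   Context: Graphs are finite, simple and undirected. A graph is uniquely hamiltonian if it has exactly one hamiltonian cycle. For a graph $G$ with vertex set $V$, its degree set is $M_{deg}(G)=\{\deg(v)\mid v\in V\}$. For a finite set $M=\{d_0,d_1,\dots,d_k\}$ of natural numbers with $d_0<d_1<\dots<d_k$, a graph $G$ realizes $M$ if $G$ is uniquely hamiltonian, $M_{deg}(G)=M$, and $G$ is $2$-connected if $2\in M$, resp. $3$-connected if $2\notin M$. $M$ is uhc-realizable if some graph realizes $M$. For $k>0$, $M$ is strongly uhc-realizable if for each partition $D_1,D_2$ of $\{d_1,\dots,d_k\}$ (one of $D_1,D_2$ possibly empty) there are constants $c_1\in\mathbb{N}$, $c_2\in\mathbb{R}$ with $c_2>0$, and an infinite sequence of graphs $G_i=(V_i,E_i)$ realizing $M$, such that for every $d\in D_1$ each $G_i$ has at most $c_1$ vertices of degree $d$, and for every $d'\in D_2$ each $G_i$ has at least $c_2|V_i|$ vertices of degree $d'$. -}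

module Defs where

open import Data.Nat using (ℕ; zero; suc; _+_; _*_; _<_; _≤_; _≡ᵇ_)
open import Data.Nat.DivMod using (_%_; m%n<n)
open import Data.Nat.Divisibility using (_∣_)
open import Data.Bool using (Bool; true; false)
open import Data.Fin using (Fin; toℕ; fromℕ<) renaming (_<_ to _<ᶠ_)
open import Data.Fin.Subset using (Subset; ∣_∣; _∉_)
open import Data.Vec using (tabulate)
open import Data.Product using (Σ; ∃; _×_; _,_)
open import Data.Sum using (_⊎_)
open import Relation.Nullary using (¬_)
open import Relation.Binary.PropositionalEquality using (_≡_)
open import Function.Definitions using (Injective; Surjective)

record Graph : Set where
  field
    n      : ℕ
    adj    : Fin n → Fin n → Bool
    adj-sym : ∀ u v → adj u v ≡ adj v u
    adj-irr : ∀ v → adj v v ≡ false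

open Graph public

deg : (G : Graph) → Fin (n G) → ℕ
deg G v = ∣ tabulate (adj G v) ∣

numDeg : (G : Graph) → ℕ → ℕ
numDeg G d = ∣ tabulate (λ v → deg G v ≡ᵇ d) ∣

next : ∀ {m} → Fin m → Fin m
next {suc m} i = fromℕ< (m%n<n (suc (toℕ i)) (suc m))

record HamCycle (G : Graph) : Set where
  field
    three≤n : 3 ≤ n G
    σ       : Fin (n G) → Fin (n G)
    σ-inj   : Injective _≡_ _≡_ σ
    σ-surj  : Surjective _≡_ _≡_ σ
    σ-adj   : ∀ i → adj G (σ i) (σ (next i)) ≡ true

CycEdge : {G : Graph} → HamCycle G → Fin (n G) → Fin (n G) → Set
CycEdge {G} H u v = ∃ λ i →
  (HamCycle.σ H i ≡ u × HamCycle.σ H (next i) ≡ v)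
  ⊎ (HamCycle.σ H i ≡ v × HamCycle.σ H (next i) ≡ u)

-- exactly one hamiltonian cycle (cycles identified as subgraphs, i.e. by edge set)
UniquelyHamiltonian : Graph → Set
UniquelyHamiltonian G = Σ (HamCycle G) λ H → (H′ : HamCycle G) →
  ∀ u v → (CycEdge H u v → CycEdge H′ u v) × (CycEdge H′ u v → CycEdge H u v)

data Reach (G : Graph) (S : Subset (n G)) : Fin (n G) → Fin (n G) → Set where
  here : ∀ {u} → Reach G S u u
  step : ∀ {u w v} → adj G u w ≡ true → w ∉ S → Reach G S w v → Reach G S u v

KConnected : ℕ → Graph → Set
KConnected k G = k < n G × ((S : Subset (n G)) → ∣ S ∣ < k →
  ∀ u v → u ∉ S → v ∉ S → Reach G S u v)

DegSetIs : Graph → (ℕ → Set) → Set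
DegSetIs G M = (∀ v → M (deg G v)) × (∀ m → M m → ∃ λ v → deg G v ≡ m)

Realizes : (ℕ → Set) → Graph → Set
Realizes M G = UniquelyHamiltonian G × DegSetIs G M
  × (M 2 → KConnected 2 G) × (¬ M 2 → KConnected 3 G)

UhcRealizable : (ℕ → Set) → Set
UhcRealizable M = Σ Graph (Realizes M)

SetM : (k : ℕ) → (Fin k → ℕ) → ℕ → Set
SetM k d m = m ≡ 3 ⊎ ∃ λ i → d i ≡ m

ContainsEven : (ℕ → Set) → Set
ContainsEven M = ∃ λ m → M m × 2 ∣ m

-- strongly uhc-realizable for M = {d₀ = 3, d 0, …, d (k-1)} (d strictly increasing).
-- A partition D₁, D₂ of {d 0, …, d (k-1)} is a map p : Fin k → Bool
-- (true ↦ D₁, false ↦ D₂). The positive constant c₂ is a positive rational a / b.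
-- The infinite sequence of graphs has strictly increasing orders.
StronglyUhcRealizable : (k : ℕ) → (Fin k → ℕ) → Set
StronglyUhcRealizable k d = (p : Fin k → Bool) →
  Σ ℕ λ c₁ → Σ ℕ λ a → Σ ℕ λ b → 0 < a × 0 < b ×
  Σ (ℕ → Graph) λ G →
    (∀ i → n (G i) < n (G (suc i)))
    × (∀ i → Realizes (SetM k d) (G i))
    × (∀ i j → p j ≡ true → numDeg (G i) (d j) ≤ c₁)
    × (∀ i j → p j ≡ false → a * n (G i) ≤ b * numDeg (G i) (d j))

{-# OPTIONS --safe #-}

-- Necessity is Thomason's lollipop argument.  Among the hamiltonian paths that start with a fixed edge
-- x₀x₁, join two paths when one arises from the other by re-hanging its end.  If all degrees are odd,
-- the paths of odd degree are exactly those that close to a hamiltonian cycle, so their number is even.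
--
-- Sufficiency replaces fragments of a graph by larger ones.  A hamiltonian cycle leaves on a fragment a
-- trace: runs that enter and leave through "port" vertices.  If every trace on the new fragment has the
-- same ports as some trace on the old one, and the trace of the unique cycle can be lifted in one way
-- only, then the new graph is again uniquely hamiltonian.  Traces are enumerated by a verified search.
--   * A triangle becomes two triangles joined by a vertex, and a path of cubic vertices adjacent to a
--     common hub becomes longer; together they add a vertex of any degree d ≥ 3 to a graph.
--   * A hub v of even degree grows by two when two blocks are inserted in a ladder attached to v; three
--     blocks closed to a ring form, with v, the Petersen graph.  A path along a ladder may visit every
--     block or every second one, and this is why blocks are inserted in pairs.
-- The start is a graph on 24 vertices made of two Petersen graphs, with two hubs of degree 4.  Both hubs
-- are enlarged to an even element of M, and then vertices of the other degrees are added.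
module Submission where

open import Defs
open import Data.Nat using (ℕ; zero; suc; _≤_; s≤s; _+_; _*_; _≡ᵇ_)
open import Data.Nat.Properties using (+-identityʳ; +-assoc; *-zeroʳ)
open import Data.Bool using (true; Bool; false; if_then_else_; _∧_; _∨_; not)
open import Data.Fin using (Fin; zero; suc; _↑ˡ_; _↑ʳ_; #_)
open import Data.Fin.Properties using (_≟_; any?; all?)
open import Data.Product using (Σ; ∃; _×_; _,_; proj₁; proj₂; ∃₂)
open import Data.Sum using (_⊎_; inj₁; inj₂)
open import Data.Empty using (⊥)
open import Data.List using (List; []; _∷_; _++_; map; length; allFin)
open import Data.List.Properties using (++-assoc)
open import Data.List.Relation.Unary.All as All using (All)
open import Data.List.Relation.Unary.Any as Any using (here; there)
open import Data.List.Relation.Unary.Unique.Propositional using (Unique)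
open import Data.List.Membership.Propositional using (_∈_; _∉_)
open import Data.List.Membership.Propositional.Properties using (∈-∃++; ∈-map⁺; ∈-allFin; ∈-map⁻; ∈-++⁺ˡ; ∈-++⁺ʳ; ∈-++⁻)
open import Data.List.Relation.Binary.Permutation.Propositional.Properties using (∈-resp-↭)
open import Relation.Nullary using (contradiction; yes; no; ¬_; Dec)
open import Relation.Binary.PropositionalEquality using (_≡_; _≢_; refl; sym; cong; subst; subst₂; cong₂; module ≡-Reasoning) renaming (trans to ≡-trans)
open import Function using (_∘_; id; case_of_)
open import Data.Unit using (tt)
open import Data.Vec using (Vec; _[_]≔_; replicate)
open import Data.Vec.Properties using (lookup∘update′; lookup-replicate)
open import Data.Sum.Properties using (inj₁-injective)
open import Relation.Nullary.Decidable using (from-yes; ¬?; _→-dec_)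
open import Data.Bool.Properties using () renaming (_≟_ to _≟ᵇ_)
open import Data.Nat.Solver using (module +-*-Solver)
import Data.Sum as Sum
import Data.List.Relation.Unary.Unique.Propositional.Properties as Unique
import Data.List.Relation.Unary.All.Properties as All

-- Uniqueness is carried in a one-sided form: every hamiltonian list with a fixed root uses only
-- edges of the distinguished cycle. This form survives a replacement. A cycle of the new graph
-- becomes one of the old graph when its trace is exchanged for a matching one; old uniqueness
-- forces the matching trace onto the run of the distinguished cycle, and the simulation test then
-- forces the original trace onto the new run. So traces are matched from new to old only, and the
-- matching may be many-to-one. Nothing in this controls 3-connectivity. It is transported by a
-- second finite test, which answers every deletion of at most two vertices in the new graph by a
-- deletion in the old one. The tests see only the two gadgets and never the surrounding graph, so
-- each replacement is checked once, by evaluation, and may be iterated without bound. For this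
-- every enlarged gadget has to contain, along its new run, a gadget that can be replaced again. The
-- ladder needs two replacements for that reason: at first its two ends share a port vertex, after
-- one insertion the remaining piece has separate ends.

-- Hamiltonian cycles as lists with a root, and their translation to and from `HamCycle`.

module Cycles where
  open import Data.Nat using (_<_)
  open import Data.Nat.Properties using (≤-antisym)
  open import Data.Nat.DivMod using (m<n⇒m%n≡m; n%n≡0)
  open import Data.Fin using (toℕ; fromℕ; inject₁)
  open import Data.Fin.Properties using (toℕ-injective; toℕ-fromℕ<; toℕ-fromℕ; toℕ-inject₁; toℕ<n; injective⇒≤)
  open import Data.Fin.Relation.Unary.Top using (view; ‵fromℕ; ‵inject₁)
  open import Data.List using (tabulate; lookup)
  open import Data.List.Properties using (tabulate-lookup)
  open import Data.List.Relation.Unary.All using ([]; _∷_)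
  open import Data.List.Relation.Unary.Any.Properties using (lookup-index)
  open import Data.List.Relation.Unary.AllPairs using ([]; _∷_)
  open import Data.List.Membership.Propositional.Properties using (∈-tabulate⁺; ∈-lookup)
  open import Data.List.Relation.Binary.Permutation.Propositional using (_↭_; refl; prep; trans)
  import Data.List.Relation.Binary.Permutation.Propositional as Perm
  open import Data.List.Relation.Binary.Permutation.Propositional.Properties using (All-resp-↭; ++-comm)
  open import Function.Definitions using (Injective; Surjective)

  private variable
    A B : Set

  -- Both ends stand outside the list. A closed walk is then the case `z` = `x`, and cutting or
  -- rotating a cycle is list concatenation.
  Links : (A → A → Set) → A → List A → A → Set
  Links R x []       z = R x z
  Links R x (y ∷ ys) z = R x y × Links R y ys z

  Step : A → List A → A → A → A → Set
  Step x []       z u v = x ≡ u × z ≡ v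
  Step x (y ∷ ys) z u v = (x ≡ u × y ≡ v) ⊎ Step y ys z u v

  SymStep : A → List A → A → A → A → Set
  SymStep x ys z u v = Step x ys z u v ⊎ Step x ys z v u

  module _ {R Q : A → A → Set} where

    links-map : (∀ {u v} → R u v → Q u v) → ∀ {x} ys {z} → Links R x ys z → Links Q x ys z
    links-map f []       r       = f r
    links-map f (y ∷ ys) (r , l) = f r , links-map f ys l

  module _ {R : A → A → Set} where

    links-lookup : ∀ {x} ys {z u v} → Links R x ys z → Step x ys z u v → R u v
    links-lookup []       r       (refl , refl)        = r
    links-lookup (y ∷ ys) (r , l) (inj₁ (refl , refl)) = r
    links-lookup (y ∷ ys) (r , l) (inj₂ s)             = links-lookup ys l s

    links-++⁺ : ∀ {a} as {x bs z} → Links R a as x → Links R x bs z → Links R a (as ++ x ∷ bs) z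
    links-++⁺ []       r       l′ = r , l′
    links-++⁺ (_ ∷ as) (r , l) l′ = r , links-++⁺ as l l′

    links-++⁻ : ∀ {a} as {x bs z} → Links R a (as ++ x ∷ bs) z → Links R a as x × Links R x bs z
    links-++⁻ []       (r , l) = r , l
    links-++⁻ (_ ∷ as) (r , l) = (r , proj₁ (links-++⁻ as l)) , proj₂ (links-++⁻ as l)

    links-rotate : ∀ {a} as {x} bs → Links R a (as ++ x ∷ bs) a → Links R x (bs ++ a ∷ as) x
    links-rotate as bs l = links-++⁺ bs (proj₂ (links-++⁻ as l)) (proj₁ (links-++⁻ as l))

  -- `Step x ys z` is the least relation that links the walk. Together with `links-lookup` this lets
  -- an inclusion between the edges of two walks be written as `Links (Step …)` of one along the
  -- other.
  links-self : (x : A) (ys : List A) (z : A) → Links (Step x ys z) x ys z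
  links-self x []       z = refl , refl
  links-self x (y ∷ ys) z = inj₁ (refl , refl) , links-map inj₂ ys (links-self y ys z)

  module _ {R : B → B → Set} (f : A → B) where

    links-map⁺ : ∀ {x} ys {z} → Links (λ u v → R (f u) (f v)) x ys z → Links R (f x) (map f ys) (f z)
    links-map⁺ []       r       = r
    links-map⁺ (_ ∷ ys) (r , l) = r , links-map⁺ ys l

  step-map : (f : A → B) → ∀ {x} ys {z u v} → Step x ys z u v → Step (f x) (map f ys) (f z) (f u) (f v)
  step-map f []       (refl , refl)        = refl , refl
  step-map f (y ∷ ys) (inj₁ (refl , refl)) = inj₁ (refl , refl)
  step-map f (y ∷ ys) (inj₂ s)             = inj₂ (step-map f ys s)

  symStep-map : (f : A → B) (x : A) (ys : List A) (z u v : A) → SymStep x ys z u v → SymStep (f x) (map f ys) (f z) (f u) (f v)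
  symStep-map f x ys z u v = Sum.map (step-map f ys) (step-map f ys)

  -- Stated for any vertex type, because the same cycle is viewed on `Fin n` and on the sum of
  -- outside vertices and gadget cells.
  record IsHam (R : A → A → Set) (x : A) (xs : List A) : Set where
    constructor isHam
    field
      unique   : Unique (x ∷ xs)
      complete : ∀ a → a ∈ x ∷ xs
      links    : Links R x xs x

  unique-resp-↭ : {xs ys : List A} → xs ↭ ys → Unique xs → Unique ys
  unique-resp-↭ refl            u                    = u
  unique-resp-↭ (prep x p)      (a ∷ u)              = All-resp-↭ p a ∷ unique-resp-↭ p u
  unique-resp-↭ (Perm.swap x y p) ((x≢y ∷ a) ∷ b ∷ u) =
    ((λ e → x≢y (sym e)) ∷ All-resp-↭ p b) ∷ All-resp-↭ p a ∷ unique-resp-↭ p u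
  unique-resp-↭ (trans p q)     u                    = unique-resp-↭ q (unique-resp-↭ p u)

  unique-head : {x : A} {xs : List A} → Unique (x ∷ xs) → x ∉ xs
  unique-head = Unique.Unique[x∷xs]⇒x∉xs

  unique-tail : {x : A} {xs : List A} → Unique (x ∷ xs) → Unique xs
  unique-tail (_ ∷ u) = u

  isHam-map : {R : A → A → Set} {Q : B → B → Set} (f : A → B) (g : B → A) →
    (∀ b → f (g b) ≡ b) → (∀ a → g (f a) ≡ a) → (∀ {u v} → R u v → Q (f u) (f v)) →
    ∀ {x xs} → IsHam R x xs → IsHam Q (f x) (map f xs)
  isHam-map f g fg gf r {x} {xs} (isHam u c l) = isHam
    (Unique.map⁺ (λ {a} {b} e → ≡-trans (sym (gf a)) (≡-trans (cong g e) (gf b))) u)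
    (λ b → subst (_∈ map f (x ∷ xs)) (fg b) (∈-map⁺ f (c (g b))))
    (links-map⁺ f xs (links-map r xs l))

  module _ {m : ℕ} where

    next-inject₁ : (j : Fin m) → next (inject₁ j) ≡ suc j
    next-inject₁ j = toℕ-injective (≡-trans (toℕ-fromℕ< _)
      (≡-trans (m<n⇒m%n≡m (s≤s (subst (_< m) (sym (toℕ-inject₁ j)) (toℕ<n j)))) (cong suc (toℕ-inject₁ j))))

    next-fromℕ : next (fromℕ m) ≡ zero
    next-fromℕ = toℕ-injective (≡-trans (toℕ-fromℕ< _)
      (≡-trans (cong (λ k → suc k Data.Nat.DivMod.% suc m) (toℕ-fromℕ m)) (n%n≡0 (suc m))))

    prev : (i : Fin (suc m)) → ∃ λ j → next j ≡ i
    prev zero    = fromℕ m , next-fromℕ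
    prev (suc i) = inject₁ i , next-inject₁ i

  links-tabulate⁺ : ∀ {R : A → A → Set} {m} (f : Fin (suc m) → A) {z} →
    (∀ j → R (f (inject₁ j)) (f (suc j))) → R (f (fromℕ m)) z → Links R (f zero) (tabulate (f ∘ suc)) z
  links-tabulate⁺ {m = zero}  f r e = e
  links-tabulate⁺ {m = suc m} f r e = r zero , links-tabulate⁺ (f ∘ suc) (r ∘ suc) e

  links-tabulate⁻ : ∀ {R : A → A → Set} {m} (f : Fin (suc m) → A) {z} →
    Links R (f zero) (tabulate (f ∘ suc)) z → (∀ j → R (f (inject₁ j)) (f (suc j))) × R (f (fromℕ m)) z
  links-tabulate⁻ {m = zero}  f e = (λ ()) , e
  links-tabulate⁻ {m = suc m} f (r , l) with links-tabulate⁻ (f ∘ suc) l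
  ... | rs , e = (λ { zero → r ; (suc j) → rs j }) , e

  module _ {R : A → A → Set} {m : ℕ} (f : Fin (suc m) → A) where

    cyclic⇒links : (∀ i → R (f i) (f (next i))) → Links R (f zero) (tabulate (f ∘ suc)) (f zero)
    cyclic⇒links r = links-tabulate⁺ f
      (λ j → subst (λ k → R (f (inject₁ j)) (f k)) (next-inject₁ j) (r (inject₁ j)))
      (subst (λ k → R (f (fromℕ m)) (f k)) next-fromℕ (r (fromℕ m)))

    links⇒cyclic : Links R (f zero) (tabulate (f ∘ suc)) (f zero) → ∀ i → R (f i) (f (next i))
    links⇒cyclic l i with links-tabulate⁻ f l | view i
    ... | rs , e | ‵fromℕ     = subst (λ k → R (f (fromℕ m)) (f k)) (sym next-fromℕ) e
    ... | rs , e | ‵inject₁ j = subst (λ k → R (f (inject₁ j)) (f k)) (sym (next-inject₁ j)) (rs j)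

  CycStep : ∀ {N} → (Fin N → A) → A → A → Set
  CycStep f u v = ∃ λ i → f i ≡ u × f (next i) ≡ v

  record Listing {N} (f : Fin N → A) (x : A) : Set where
    field
      rest     : List A
      unique   : Unique (x ∷ rest)
      complete : ∀ a → a ∈ x ∷ rest
      to       : ∀ {u v} → CycStep f u v → Step x rest x u v
      from     : ∀ {u v} → Step x rest x u v → CycStep f u v

  -- A cyclic enumeration can be cut open at any prescribed vertex: tabulate it, locate `x`, and
  -- rotate. This gives an arbitrary hamiltonian cycle the common root.
  listing : ∀ {N} (f : Fin N → A) → Injective _≡_ _≡_ f → Surjective _≡_ _≡_ f → (x : A) → Listing f x
  listing {N = zero} f inj sur x with proj₁ (sur x)
  ... | ()
  listing {A = A} {N = suc m} f inj sur x = go (f zero) l (Unique.tabulate⁺ {f = f} inj) (all∈ x) all∈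
    (λ { (i , refl , refl) → links⇒cyclic {R = Step (f zero) l (f zero)} f (links-self (f zero) l (f zero)) i })
    (λ s → links-lookup {R = CycStep f} l (cyclic⇒links f (λ i → i , refl , refl)) s)
    where
    l = tabulate (f ∘ suc)
    all∈ : ∀ a → a ∈ tabulate f
    all∈ a with sur a
    ... | i , e = subst (_∈ tabulate f) (e refl) (∈-tabulate⁺ {f = f} i)
    go : ∀ a as → Unique (a ∷ as) → x ∈ a ∷ as → (∀ b → b ∈ a ∷ as) →
      (∀ {u v} → CycStep f u v → Step a as a u v) → (∀ {u v} → Step a as a u v → CycStep f u v) → Listing f x
    go a as u (here refl) c t s = record { rest = as ; unique = u ; complete = c ; to = t ; from = s }
    go a as u (there x∈) c t s with ∈-∃++ x∈
    ... | ys , zs , refl = record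
      { rest = zs ++ a ∷ ys
      ; unique = unique-resp-↭ rot u
      ; complete = λ b → ∈-resp-↭ rot (c b)
      ; to = λ p → links-lookup (ys ++ x ∷ zs) (links-rotate zs ys (links-self x (zs ++ a ∷ ys) x)) (t p)
      ; from = λ p → s (links-lookup (zs ++ a ∷ ys) (links-rotate ys zs (links-self a (ys ++ x ∷ zs) a)) p)
      }
      where
      rot : a ∷ ys ++ x ∷ zs ↭ x ∷ zs ++ a ∷ ys
      rot = ++-comm (a ∷ ys) (x ∷ zs)

  lookup-injective : (xs : List A) → Unique xs → ∀ i j → lookup xs i ≡ lookup xs j → i ≡ j
  lookup-injective (x ∷ xs) u       zero    zero    e = refl
  lookup-injective (x ∷ xs) u       zero    (suc j) e = contradiction (subst (_∈ xs) (sym e) (∈-lookup j)) (unique-head u)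
  lookup-injective (x ∷ xs) u       (suc i) zero    e = contradiction (subst (_∈ xs) e (∈-lookup i)) (unique-head u)
  lookup-injective (x ∷ xs) (_ ∷ u) (suc i) (suc j) e = cong suc (lookup-injective xs u i j e)

  enumeration-length : ∀ {n} (xs : List (Fin n)) → Unique xs → (∀ a → a ∈ xs) → n ≡ length xs
  enumeration-length xs u c = ≤-antisym
    (injective⇒≤ {f = λ a → Any.index (c a)}
      (λ {a} {b} e → ≡-trans (lookup-index (c a)) (≡-trans (cong (lookup xs) e) (sym (lookup-index (c b))))))
    (injective⇒≤ {f = lookup xs} (λ {i} {j} → lookup-injective xs u i j))

  fromList : ∀ {N} (x : A) (xs : List A) → Unique (x ∷ xs) → (∀ a → a ∈ x ∷ xs) → N ≡ length (x ∷ xs) →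
    Σ (Fin N → A) λ f → Injective _≡_ _≡_ f × Surjective _≡_ _≡_ f × (∀ i → Step x xs x (f i) (f (next i))) ×
      (∀ {u v} → Step x xs x u v → CycStep f u v)
  fromList x xs u c refl = f , (λ {i} {j} → lookup-injective (x ∷ xs) u i j) ,
    (λ a → Any.index (c a) , λ { refl → sym (lookup-index (c a)) }) ,
    links⇒cyclic f (subst (λ l → Links (Step x xs x) x l x) (sym (tabulate-lookup xs)) (links-self x xs x)) ,
    λ s → links-lookup xs (subst (λ l → Links (CycStep f) x l x) (tabulate-lookup xs) (cyclic⇒links f (λ i → i , refl , refl))) s
    where
    f = lookup (x ∷ xs)

  Adj : (G : Graph) → Fin (n G) → Fin (n G) → Set
  Adj G u v = adj G u v ≡ true

  hamCycle : (G : Graph) → 3 ≤ n G → ∀ {x xs} → IsHam (Adj G) x xs →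
    Σ (HamCycle G) λ H → ∀ {u v} → SymStep x xs x u v → CycEdge H u v
  hamCycle G 3≤n {x} {xs} (isHam u c l) with fromList x xs u c (enumeration-length _ u c)
  ... | f , inj , sur , st , ts = record
    { three≤n = 3≤n ; σ = f ; σ-inj = inj ; σ-surj = sur ; σ-adj = λ i → links-lookup xs l (st i) } ,
    λ { (inj₁ s) → let i , p = ts s in i , inj₁ p ; (inj₂ s) → let i , p = ts s in i , inj₂ p }

  -- Length at least 3 enters here: predecessor and successor of a vertex on the cycle are
  -- different.
  next-next : ∀ {m} → 3 ≤ suc m → (k : Fin (suc m)) → next (next k) ≢ k
  next-next {m} 3≤n k e with view k
  next-next {zero} (s≤s ()) .(fromℕ _) e | ‵fromℕ
  next-next {suc zero} (s≤s (s≤s ())) .(fromℕ _) e | ‵fromℕ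
  next-next {suc (suc m)} 3≤n .(fromℕ _) e | ‵fromℕ = case (≡-trans (sym (next-inject₁ zero)) (≡-trans (cong next (sym next-fromℕ)) e))
    where
    case : suc zero ≡ fromℕ (suc (suc m)) → ⊥
    case ()
  next-next {m} 3≤n .(inject₁ j) e | ‵inject₁ j = go m 3≤n j (≡-trans (sym (cong next (next-inject₁ j))) e)
    where
    go : ∀ m → 3 ≤ suc m → (j : Fin m) → next (suc j) ≡ inject₁ j → ⊥
    go (suc m) 3≤n j e with view j
    go (suc zero) (s≤s (s≤s ())) .(fromℕ _) e | ‵fromℕ
    go (suc (suc m)) 3≤n .(fromℕ _) e | ‵fromℕ with ≡-trans (sym next-fromℕ) e
    ... | ()
    go (suc m) 3≤n .(inject₁ i) e | ‵inject₁ i = bad (≡-trans (cong toℕ (≡-trans (sym (next-inject₁ (suc i))) e))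
        (≡-trans (toℕ-inject₁ (inject₁ i)) (toℕ-inject₁ i)))
      where
      bad : ∀ {k} → suc (suc k) ≡ k → ⊥
      bad ()

  next-injective : ∀ {m} {a b : Fin (suc m)} → next a ≡ next b → a ≡ b
  next-injective {a = a} {b} eq with view a | view b
  ... | ‵fromℕ | ‵fromℕ = refl
  ... | ‵fromℕ | ‵inject₁ b′ with () ← ≡-trans (sym next-fromℕ) (≡-trans eq (next-inject₁ b′))
  ... | ‵inject₁ a′ | ‵fromℕ with () ← ≡-trans (sym (next-inject₁ a′)) (≡-trans eq next-fromℕ)
  ... | ‵inject₁ a′ | ‵inject₁ b′ with ≡-trans (sym (next-inject₁ a′)) (≡-trans eq (next-inject₁ b′))
  ... | refl = refl

  -- Both cycles are 2-regular, so at every vertex the two edges of τ exhaust those of σ.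
  cycles-⊇ : ∀ {N} → 3 ≤ N → {σ τ : Fin N → A} → Injective _≡_ _≡_ σ →
    Injective _≡_ _≡_ τ → Surjective _≡_ _≡_ τ →
    (∀ {u v} → CycStep τ u v → CycStep σ u v ⊎ CycStep σ v u) →
    ∀ {u v} → CycStep σ u v → CycStep τ u v ⊎ CycStep τ v u
  cycles-⊇ {N = suc m} 3≤n {σ} {τ} σ-inj τ-inj τ-surj τ⊆σ (i , refl , refl) with τ-surj (σ i)
  ... | j , τj with prev j | prev i | τj refl
  ... | j⁻ , refl | i⁻ , refl | e = go (nbr fwd) (nbr bwd)
    where
    fwd : CycStep σ (σ i) (τ (next (next j⁻))) ⊎ CycStep σ (τ (next (next j⁻))) (σ i)
    fwd = τ⊆σ (next j⁻ , e , refl)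
    bwd : CycStep σ (σ i) (τ j⁻) ⊎ CycStep σ (τ j⁻) (σ i)
    bwd = Sum.swap (τ⊆σ (j⁻ , refl , e))
    nbr : ∀ {w} → CycStep σ (σ i) w ⊎ CycStep σ w (σ i) → w ≡ σ (next i) ⊎ w ≡ σ i⁻
    nbr (inj₁ (k , p , q)) = inj₁ (≡-trans (sym q) (cong (λ k → σ (next k)) (σ-inj p)))
    nbr (inj₂ (k , p , q)) = inj₂ (≡-trans (sym p) (cong σ (next-injective (σ-inj q))))
    go : τ (next (next j⁻)) ≡ σ (next i) ⊎ τ (next (next j⁻)) ≡ σ i⁻ → τ j⁻ ≡ σ (next i) ⊎ τ j⁻ ≡ σ i⁻ →
      CycStep τ (σ i) (σ (next i)) ⊎ CycStep τ (σ (next i)) (σ i)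
    go (inj₁ p) _        = inj₁ (next j⁻ , e , p)
    go (inj₂ _) (inj₁ q) = inj₂ (j⁻ , q , e)
    go (inj₂ p) (inj₂ q) = contradiction (τ-inj (≡-trans p (sym q))) (next-next 3≤n j⁻)

  -- Containment in one direction is enough, since `cycles-⊇` turns it into equality of edge sets;
  -- `listing` brings a competing cycle to the root `x`.
  uniquelyHamiltonian : (G : Graph) → 3 ≤ n G → ∀ {x xs} → IsHam (Adj G) x xs →
    (∀ ys → IsHam (Adj G) x ys → Links (SymStep x xs x) x ys x) → UniquelyHamiltonian G
  uniquelyHamiltonian G 3≤n {x} {xs} ham uniq with hamCycle G 3≤n ham
  ... | H , toH = H , λ H′ u v → ⊇ H′ , ⊆ H′
    where
    open HamCycle
    toSym : ∀ (H : HamCycle G) {u v} → CycEdge H u v → CycStep (σ H) u v ⊎ CycStep (σ H) v u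
    toSym H (i , inj₁ p) = inj₁ (i , p)
    toSym H (i , inj₂ p) = inj₂ (i , p)
    ofSym : ∀ (H : HamCycle G) {u v} → CycStep (σ H) u v ⊎ CycStep (σ H) v u → CycEdge H u v
    ofSym H (inj₁ (i , p)) = i , inj₁ p
    ofSym H (inj₂ (i , p)) = i , inj₂ p
    module _ (H′ : HamCycle G) where
      L = listing (σ H′) (σ-inj H′) (σ-surj H′) x
      module L = Listing L
      ys-ham : IsHam (Adj G) x L.rest
      ys-ham = isHam L.unique L.complete
        (links-map (λ s → let i , p , q = L.from s in subst₂ (Adj G) p q (σ-adj H′ i)) L.rest (links-self x L.rest x))
      step⊆ : ∀ {u v} → CycStep (σ H′) u v → CycEdge H u v
      step⊆ s = toH (links-lookup L.rest (uniq L.rest ys-ham) (L.to s))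
      flip : ∀ (H : HamCycle G) {u v} → CycEdge H u v → CycEdge H v u
      flip H (i , p) = i , Sum.swap p
      ⊆ : ∀ {u v} → CycEdge H′ u v → CycEdge H u v
      ⊆ c with toSym H′ c
      ... | inj₁ s = step⊆ s
      ... | inj₂ s = flip H (step⊆ s)
      step⊇ : ∀ {u v} → CycStep (σ H) u v → CycEdge H′ u v
      step⊇ s = ofSym H′ (cycles-⊇ 3≤n (σ-inj H) (σ-inj H′) (σ-surj H′) (toSym H ∘ step⊆) s)
      ⊇ : ∀ {u v} → CycEdge H u v → CycEdge H′ u v
      ⊇ c with toSym H c
      ... | inj₁ s = step⊇ s
      ... | inj₂ s = flip H′ (step⊇ s)

-- Gadgets, the traces of cycles on them, and the verified trace search.

module Gadgets where
  open Cycles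
  open import Data.Maybe using (Maybe; just; nothing)
  open import Data.Unit using (⊤)
  open import Data.List.Relation.Unary.All using ([]; _∷_)
  open import Data.List.Relation.Unary.AllPairs using ([]; _∷_)
  open import Data.Vec using (lookup)
  open import Data.Vec.Properties using (lookup∘update)

  private variable
    A B : Set

  ∧-true : ∀ {a b} → a ∧ b ≡ true → a ≡ true × b ≡ true
  ∧-true {true} {true} _ = refl , refl

  ∨-true : ∀ {a b} → a ∨ b ≡ true → a ≡ true ⊎ b ≡ true
  ∨-true {true}  _ = inj₁ refl
  ∨-true {false} e = inj₂ e

  every : (A → Bool) → List A → Bool
  every f []       = true
  every f (x ∷ xs) = if f x then every f xs else false

  every-lookup : (f : A → Bool) {xs : List A} → every f xs ≡ true → ∀ {x} → x ∈ xs → f x ≡ true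
  every-lookup f {x ∷ xs} e (here refl) with f x
  ... | true = refl
  every-lookup f {x ∷ xs} e (there x∈) with f x
  ... | true = every-lookup f e x∈

  infix 7 _==_
  _==_ : ∀ {n} → Fin n → Fin n → Bool
  zero  == zero  = true
  zero  == suc _ = false
  suc _ == zero  = false
  suc i == suc j = i == j

  ==⇒≡ : ∀ {n} (i j : Fin n) → (i == j) ≡ true → i ≡ j
  ==⇒≡ zero    zero    _ = refl
  ==⇒≡ (suc i) (suc j) e = cong suc (==⇒≡ i j e)

  ==-refl : ∀ {n} (i : Fin n) → (i == i) ≡ true
  ==-refl zero    = refl
  ==-refl (suc i) = ==-refl i

  elem : ∀ {n} → Fin n → List (Fin n) → Bool
  elem i []       = false
  elem i (j ∷ js) = if i == j then true else elem i js

  elem⇒∈ : ∀ {n} (i : Fin n) js → elem i js ≡ true → i ∈ js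
  elem⇒∈ i (j ∷ js) e with i == j in eq
  ... | true  = here (==⇒≡ i j eq)
  ... | false = there (elem⇒∈ i js e)

  ∈⇒elem : ∀ {n} (i : Fin n) {js} → i ∈ js → elem i js ≡ true
  ∈⇒elem i {j ∷ js} (here refl) rewrite ==-refl i = refl
  ∈⇒elem i {j ∷ js} (there i∈) with i == j
  ... | true  = refl
  ... | false = ∈⇒elem i i∈

  distinct : ∀ {n} → List (Fin n) → Bool
  distinct []       = true
  distinct (i ∷ is) = not (elem i is) ∧ distinct is

  distinct⇒unique : ∀ {n} (is : List (Fin n)) → distinct is ≡ true → Unique is
  distinct⇒unique []       _ = []
  distinct⇒unique (i ∷ is) e with elem i is in eq
  ... | false = All.tabulate (λ { {j} j∈ refl → case ≡-trans (sym eq) (∈⇒elem i j∈) of λ () }) ∷ distinct⇒unique is e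

  covers : ∀ {n} → List (Fin n) → Bool
  covers {n} is = every (λ i → elem i is) (allFin n)

  covers⇒∈ : ∀ {n} (is : List (Fin n)) → covers is ≡ true → ∀ i → i ∈ is
  covers⇒∈ is e i = elem⇒∈ i is (every-lookup (λ i → elem i is) e (∈-allFin i))

  -- A gadget is a fragment with k inner vertices whose edges to the rest of a graph lead to r port vertices.
  record Gadget (r k : ℕ) : Set where
    field
      kA : Fin k → Fin k → Bool
      pA : Fin k → Fin r → Bool

  open Gadget public

  -- Adjacency lists let the search branch over actual neighbours only; `⟦_⟧` recovers the Boolean
  -- relations.
  record Tables (r k : ℕ) : Set where
    constructor tables
    field
      inner : Vec (List (Fin k)) k
      outer : Vec (List (Fin r)) k

  open Tables public

  ⟦_⟧ : ∀ {r k} → Tables r k → Gadget r k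
  ⟦ t ⟧ = record { kA = λ a b → elem b (lookup (inner t) a) ; pA = λ a p → elem p (lookup (outer t) a) }

  Run : ℕ → Set
  Run k = Fin k × List (Fin k)

  Ports : ℕ → Set
  Ports r = List (Fin r × Fin r)

  -- `All` of a constant predicate serves as a list with exactly one run for each pair of entry and
  -- exit port.
  Runs : ∀ {r} → ℕ → Ports r → Set
  Runs k = All (λ _ → Run k)

  cells : ∀ {r k} {ps : Ports r} → Runs k ps → List (Fin k)
  cells []              = []
  cells ((a , as) ∷ rs) = a ∷ as ++ cells rs

  module _ {r k} (K : Gadget r k) where

    Chain : Fin k → List (Fin k) → Fin r → Set
    Chain a []       q = pA K a q ≡ true
    Chain a (b ∷ bs) q = kA K a b ≡ true × Chain b bs q

    RunsOK : {ps : Ports r} → Runs k ps → Set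
    RunsOK []                                = ⊤
    RunsOK {(p , q) ∷ _} ((a , as) ∷ rs) = pA K a p ≡ true × Chain a as q × RunsOK rs

    chain? : Fin k → List (Fin k) → Fin r → Bool
    chain? a []       q = pA K a q
    chain? a (b ∷ bs) q = kA K a b ∧ chain? b bs q

    chain?⇒ : ∀ a as q → chain? a as q ≡ true → Chain a as q
    chain?⇒ a []       q e = e
    chain?⇒ a (b ∷ bs) q e = let e₁ , e₂ = ∧-true e in e₁ , chain?⇒ b bs q e₂

    chain?⇐ : ∀ a as q → Chain a as q → chain? a as q ≡ true
    chain?⇐ a []       q e = e
    chain?⇐ a (b ∷ bs) q (e₁ , e₂) rewrite e₁ = chain?⇐ b bs q e₂

    runs? : {ps : Ports r} → Runs k ps → Bool
    runs? []                            = true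
    runs? {(p , q) ∷ _} ((a , as) ∷ rs) = pA K a p ∧ (chain? a as q ∧ runs? rs)

    runs?⇒ : {ps : Ports r} (rs : Runs k ps) → runs? rs ≡ true → RunsOK rs
    runs?⇒ []                            e = tt
    runs?⇒ {(p , q) ∷ _} ((a , as) ∷ rs) e =
      let e₁ , e′ = ∧-true e ; e₂ , e₃ = ∧-true e′ in e₁ , chain?⇒ a as q e₂ , runs?⇒ rs e₃

    runs?⇐ : {ps : Ports r} (rs : Runs k ps) → RunsOK rs → runs? rs ≡ true
    runs?⇐ []                            _ = refl
    runs?⇐ {(p , q) ∷ _} ((a , as) ∷ rs) (e₁ , c , ok) rewrite e₁ | chain?⇐ a as q c = runs?⇐ rs ok

  consecutive : ∀ {k} → Fin k → List (Fin k) → Fin k → Fin k → Bool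
  consecutive a []       u v = false
  consecutive a (b ∷ bs) u v = (a == u ∧ b == v) ∨ consecutive b bs u v

  lastOf : A → List A → A
  lastOf a []       = a
  lastOf a (b ∷ bs) = lastOf b bs

  -- `RunsOK` for this gadget says that a trace uses only edges of the given run, in either
  -- direction; uniqueness is expressed through it.
  pathGadget : ∀ {r k} → Fin r → Run k → Fin r → Gadget r k
  pathGadget p (a , as) q = record
    { kA = λ u v → consecutive a as u v ∨ consecutive a as v u
    ; pA = λ u o → (o == p ∧ u == a) ∨ (o == q ∧ u == lastOf a as) }

  -- `U` marks the ports already visited, and `cur` is the port at which the cycle stands directly
  -- after a run. Setting `p` before looking up `q` makes the exit differ from the entry.
  PortsOK : ∀ {r} → Vec Bool r → Maybe (Fin r) → Ports r → Set
  PortsOK U cur []             = ⊤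
  PortsOK U cur ((p , q) ∷ ps) = (lookup U p ≡ false ⊎ cur ≡ just p) × lookup (U [ p ]≔ true) q ≡ false ×
    PortsOK ((U [ p ]≔ true) [ q ]≔ true) (just q) ps

  allTrue : ∀ {n} → Vec Bool n → Bool
  allTrue Vec.[]            = true
  allTrue (false Vec.∷ v) = false
  allTrue (true Vec.∷ v)  = allTrue v

  allTrue⇐ : ∀ {n} (v : Vec Bool n) → (∀ i → lookup v i ≡ true) → allTrue v ≡ true
  allTrue⇐ Vec.[]            h = refl
  allTrue⇐ (false Vec.∷ v) h = h zero
  allTrue⇐ (true Vec.∷ v)  h = allTrue⇐ v (h ∘ suc)

  is : ∀ {r} → Maybe (Fin r) → Fin r → Bool
  is nothing  p = false
  is (just q) p = q == p

  -- Exhaustive search over the traces that a hamiltonian cycle can leave on a gadget: a cycle meets the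
  -- gadget in runs, each entered from one port and left to another.  A port vertex is visited once,
  -- so it serves two runs only if they are consecutive.
  module Search {r k} (t : Tables r k) where
    private K = ⟦ t ⟧

    Cont : Set
    Cont = (ps : Ports r) → Runs k ps → Bool

    RunCont : Set
    RunCont = List (Fin k) → Fin r → Cont

    -- The continuation `κ` accumulates the trace and judges it once all cells are visited.
    -- Exhausted fuel answers `false`, so the soundness proof needs no bound on the depth.
    outside : ℕ → Vec Bool k → Vec Bool r → Maybe (Fin r) → Cont → Bool
    enterBy : ℕ → Vec Bool k → Vec Bool r → Maybe (Fin r) → Cont → Fin r → Bool
    enterAt : ℕ → Vec Bool k → Vec Bool r → Cont → Fin r → Fin k → Bool
    inside  : ℕ → Vec Bool k → Vec Bool r → Fin k → RunCont → Bool
    goOn    : ℕ → Vec Bool k → Vec Bool r → RunCont → Fin k → Bool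
    leave   : ℕ → Vec Bool k → Vec Bool r → RunCont → Fin r → Bool

    outside zero    vis U cur κ = false
    outside (suc f) vis U cur κ =
      if (if allTrue vis then κ [] [] else true) then every (enterBy f vis U cur κ) (allFin r) else false
    enterBy f vis U cur κ p =
      if (if lookup U p then is cur p else true) then every (enterAt f vis U κ p) (allFin k) else true
    enterAt f vis U κ p a =
      if pA K a p
      then (if lookup vis a then true
            else inside f (vis [ a ]≔ true) (U [ p ]≔ true) a (λ as q ps rs → κ ((p , q) ∷ ps) ((a , as) ∷ rs)))
      else true
    inside zero    vis U a κ = false
    inside (suc f) vis U a κ =
      if every (goOn f vis U κ) (lookup (inner t) a) then every (leave f vis U κ) (lookup (outer t) a) else false
    goOn f vis U κ b = if lookup vis b then true else inside f (vis [ b ]≔ true) U b (λ as → κ (b ∷ as))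
    leave f vis U κ q = if lookup U q then true else outside f vis (U [ q ]≔ true) (just q) (κ [] q)

    Fresh : Vec Bool k → List (Fin k) → Set
    Fresh vis l = Unique l × (∀ {b} → b ∈ l → lookup vis b ≡ false) × (∀ b → lookup vis b ≡ true ⊎ b ∈ l)

    fresh-tail : ∀ {vis b l} → Fresh vis (b ∷ l) → Fresh (vis [ b ]≔ true) l
    fresh-tail {vis} {b} {l} (u , out , cov) = unique-tail u ,
      (λ {c} c∈ → ≡-trans (lookup∘update′ (λ { refl → unique-head u c∈ }) vis true) (out (there c∈))) ,
      cov′
      where
      cov′ : ∀ c → lookup (vis [ b ]≔ true) c ≡ true ⊎ c ∈ l
      cov′ c with c ≟ b | cov c
      ... | yes refl | _                = inj₁ (lookup∘update b vis true)
      ... | no c≢b   | inj₁ e           = inj₁ (≡-trans (lookup∘update′ c≢b vis true) e)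
      ... | no c≢b   | inj₂ (here e)    = contradiction e c≢b
      ... | no c≢b   | inj₂ (there c∈)  = inj₂ c∈

    if-true : ∀ {a b} → (if a then b else false) ≡ true → a ≡ true × b ≡ true
    if-true {true} e = refl , e

    guard : ∀ {c x} → (if c then x else true) ≡ true → c ≡ true → x ≡ true
    guard e refl = e

    unless : ∀ {c x} → (if c then true else x) ≡ true → c ≡ false → x ≡ true
    unless e refl = e

    opened : ∀ U {cur : Maybe (Fin r)} p → lookup U p ≡ false ⊎ cur ≡ just p → (if lookup U p then is cur p else true) ≡ true
    opened U p (inj₁ l) rewrite l = refl
    opened U p (inj₂ refl) with lookup U p
    ... | true  = ==-refl p
    ... | false = refl

    -- The recursion follows the given trace through the search tree. At each node `every` is
    -- instantiated at the one branch that the trace takes, and `Fresh` and `PortsOK` show that this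
    -- branch was not pruned.
    outside-sound : ∀ f vis U cur κ → outside f vis U cur κ ≡ true → ∀ ps (rs : Runs k ps) →
      RunsOK K rs → Fresh vis (cells rs) → PortsOK U cur ps → κ ps rs ≡ true
    inside-sound : ∀ f vis U a κ → inside f vis U a κ ≡ true → ∀ as q ps (rs : Runs k ps) →
      Chain K a as q → RunsOK K rs → Fresh vis (as ++ cells rs) → lookup U q ≡ false →
      PortsOK (U [ q ]≔ true) (just q) ps → κ as q ps rs ≡ true

    outside-sound (suc f) vis U cur κ e [] [] _ (_ , _ , cov) _ =
      ≡-trans (cong (λ b → if b then κ [] [] else true) (sym (allTrue⇐ vis (λ i → Sum.[ id , (λ ()) ]′ (cov i)))))
        (proj₁ (if-true e))
    outside-sound (suc f) vis U cur κ e ((p , q) ∷ ps) ((a , as) ∷ rs) (pe , ch , ok) fr (op , uq , po) =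
      inside-sound f (vis [ a ]≔ true) (U [ p ]≔ true) a (λ as q ps rs → κ ((p , q) ∷ ps) ((a , as) ∷ rs))
        (unless (guard (every-lookup (enterAt f vis U κ p)
          (guard (every-lookup (enterBy f vis U cur κ) (proj₂ (if-true e)) (∈-allFin p)) (opened U p op))
          (∈-allFin a)) pe) (proj₁ (proj₂ fr) (here refl)))
        as q ps rs ch ok (fresh-tail {vis} fr) uq po

    inside-sound (suc f) vis U a κ e [] q ps rs pe ok fr uq po =
      outside-sound f vis (U [ q ]≔ true) (just q) (κ [] q)
        (unless (every-lookup (leave f vis U κ) (proj₂ (if-true {every (goOn f vis U κ) (lookup (inner t) a)} e)) (elem⇒∈ q (lookup (outer t) a) pe)) uq) ps rs ok fr po
    inside-sound (suc f) vis U a κ e (b ∷ bs) q ps rs (ab , ch) ok fr uq po =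
      inside-sound f (vis [ b ]≔ true) U b (λ as → κ (b ∷ as))
        (unless (every-lookup (goOn f vis U κ) (proj₁ (if-true e)) (elem⇒∈ b (lookup (inner t) a) ab)) (proj₁ (proj₂ fr) (here refl)))
        bs q ps rs ch ok (fresh-tail {vis} fr) uq po

    -- No correctness proof is needed: the outcome is tested by spanning?.
    findRuns : ℕ → Vec Bool k → (ps : Ports r) → Maybe (Runs k ps)
    extend   : ℕ → Vec Bool k → Fin k → (q : Fin r) (ps : Ports r) → Maybe (List (Fin k) × Runs k ps)
    firstIn  : {B : Set} → (A → Maybe B) → List A → Maybe B

    firstIn g []       = nothing
    firstIn g (x ∷ xs) with g x
    ... | just y  = just y
    ... | nothing = firstIn g xs

    findRuns zero    vis ps = nothing
    findRuns (suc f) vis [] = if allTrue vis then just [] else nothing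
    findRuns (suc f) vis ((p , q) ∷ ps) =
      firstIn (λ a → if pA K a p ∧ not (lookup vis a) then wrap a (extend f (vis [ a ]≔ true) a q ps) else nothing) (allFin k)
      where
      wrap : Fin k → Maybe (List (Fin k) × Runs k ps) → Maybe (Runs k ((p , q) ∷ ps))
      wrap a nothing          = nothing
      wrap a (just (as , rs)) = just ((a , as) ∷ rs)
    extend zero    vis a q ps = nothing
    extend (suc f) vis a q ps with (if pA K a q then findRuns f vis ps else nothing)
    ... | just rs = just ([] , rs)
    ... | nothing = firstIn (λ b → if lookup vis b then nothing else wrap b (extend f (vis [ b ]≔ true) b q ps)) (lookup (inner t) a)
      where
      wrap : Fin k → Maybe (List (Fin k) × Runs k ps) → Maybe (List (Fin k) × Runs k ps)
      wrap b nothing          = nothing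
      wrap b (just (bs , rs)) = just (b ∷ bs , rs)

  spanning? : ∀ {r k} → Gadget r k → {ps : Ports r} → Runs k ps → Bool
  spanning? K rs = runs? K rs ∧ (distinct (cells rs) ∧ covers (cells rs))

  -- Every trace on the gadget t′ is matched by a trace on t with the same ports, and the traces matched
  -- by the run ρ alone are the run ρ′ alone.
  module Simulation {r k k′} (t : Tables r k) (t′ : Tables r k′) (p₀ q₀ : Fin r) (ρ : Run k) (ρ′ : Run k′) where

    E  = pathGadget p₀ ρ q₀
    E′ = pathGadget p₀ ρ′ q₀

    matched : (ps : Ports r) → Runs k′ ps → Maybe (Runs k ps) → Bool
    matched ps rs′ nothing   = false
    matched ps rs′ (just rs) = spanning? ⟦ t ⟧ rs ∧ (if runs? E rs then runs? E′ rs′ else true)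

    -- A trace costs at most two units per cell, one for the cell and one for a change of run, plus
    -- a final unit. Too small a value could only make `simulates` false.
    fuel : ℕ
    fuel = 5 + (k′ + k′) + (k + k)

    simulates : Bool
    simulates = Search.outside t′ fuel (replicate k′ false) (replicate r false) nothing
      (λ ps rs′ → matched ps rs′ (Search.findRuns t fuel (replicate k false) ps))

    Matched : (ps : Ports r) → Runs k′ ps → Set
    Matched ps rs′ = Σ (Runs k ps) λ rs → RunsOK ⟦ t ⟧ rs × Unique (cells rs) × (∀ b → b ∈ cells rs) ×
      (RunsOK E rs → RunsOK E′ rs′)

    matched⇒ : ∀ ps rs′ m → matched ps rs′ m ≡ true → Matched ps rs′
    matched⇒ ps rs′ (just rs) m with ∧-true {spanning? ⟦ t ⟧ rs} m
    ... | m₁ , m₂ with ∧-true {runs? ⟦ t ⟧ rs} m₁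
    ... | m₃ , m₄ with ∧-true {distinct (cells rs)} m₄
    ... | m₅ , m₆ = rs , runs?⇒ ⟦ t ⟧ rs m₃ , distinct⇒unique (cells rs) m₅ , covers⇒∈ (cells rs) m₆ ,
      λ ok → runs?⇒ E′ rs′ (≡-trans (cong (λ b → if b then runs? E′ rs′ else true) (sym (runs?⇐ E rs ok))) m₂)

    simulate : simulates ≡ true → ∀ ps (rs′ : Runs k′ ps) → RunsOK ⟦ t′ ⟧ rs′ → Unique (cells rs′) →
      (∀ b → b ∈ cells rs′) → PortsOK (replicate r false) nothing ps → Matched ps rs′
    simulate e ps rs′ ok u c po = matched⇒ ps rs′ (Search.findRuns t fuel (replicate k false) ps)
      (Search.outside-sound t′ fuel (replicate k′ false) (replicate r false) nothing
        (λ ps rs′ → matched ps rs′ (Search.findRuns t fuel (replicate k false) ps)) e ps rs′ ok (u , (λ {b} _ → lookup-replicate b false) , λ b → inj₂ (c b)) po)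

-- Exchanging the trace of a hamiltonian cycle on a gadget.

module Traces where
  open Cycles
  open Gadgets
  open import Data.Maybe using (just; nothing)
  open import Data.Sum.Properties using (inj₂-injective)
  open import Data.List.Properties using (map-++)
  open import Data.List.Relation.Unary.All using ([]; _∷_)
  open import Data.List.Relation.Unary.AllPairs using ([]; _∷_)
  open import Data.List.Relation.Binary.Permutation.Propositional using (_↭_; refl; prep; ↭-sym; module PermutationReasoning)
  open import Data.List.Relation.Binary.Permutation.Propositional.Properties using (++-comm; shift; ++⁺ˡ; ++⁺ʳ)
  open import Data.Vec using (lookup)

  private variable
    A B : Set

  unique-++⁻ : (xs : List A) {ys : List A} → Unique (xs ++ ys) → Unique xs × Unique ys
  unique-++⁻ []       u       = [] , u
  unique-++⁻ (x ∷ xs) (a ∷ u) = (All.++⁻ˡ xs a ∷ proj₁ (unique-++⁻ xs u)) , proj₂ (unique-++⁻ xs u)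

  unique-map⁻ : (f : A → B) {xs : List A} → Unique (map f xs) → Unique xs
  unique-map⁻ f {[]}     _       = []
  unique-map⁻ f {x ∷ xs} (a ∷ u) = All.map (λ n e → n (cong f e)) (All.map⁻ a) ∷ unique-map⁻ f u

  consecutive⇒step : ∀ {k} (a : Fin k) as {u v} → consecutive a as u v ≡ true →
    {f : Fin k → B} {z : B} → Step (f a) (map f as) z (f u) (f v)
  consecutive⇒step a (b ∷ bs) {u} {v} e {f} with ∨-true e
  ... | inj₁ e₁ = inj₁ (cong f (==⇒≡ a u (proj₁ (∧-true e₁))) , cong f (==⇒≡ b v (proj₂ (∧-true {a == u} e₁))))
  ... | inj₂ e₂ = inj₂ (consecutive⇒step b bs e₂)

  step-last : (f : A → B) (a : A) (as : List A) {z : B} → Step (f a) (map f as) z (f (lastOf a as)) z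
  step-last f a []       = refl , refl
  step-last f a (b ∷ bs) = inj₂ (step-last f b bs)

  step-prefix : {x : A} (as : List A) {y : A} {l : List A} {z u w : A} → Step y l z u w → Step x (as ++ y ∷ l) z u w
  step-prefix []       s = inj₂ s
  step-prefix (_ ∷ as) s = inj₂ (step-prefix as s)

  module Cells {r : ℕ} (O : Set) (port : Fin r → O) (port-injective : ∀ {p q} → port p ≡ port q → p ≡ q) (x₀ : O) where

    Adj◎ : ∀ {k} → (O → O → Set) → Gadget r k → O ⊎ Fin k → O ⊎ Fin k → Set
    Adj◎ oR K (inj₁ u) (inj₁ w) = oR u w
    Adj◎ oR K (inj₁ u) (inj₂ a) = ∃ λ p → u ≡ port p × pA K a p ≡ true
    Adj◎ oR K (inj₂ a) (inj₁ u) = ∃ λ p → u ≡ port p × pA K a p ≡ true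
    Adj◎ oR K (inj₂ a) (inj₂ b) = kA K a b ≡ true

    -- A closed walk with the interiors of its runs erased. It mentions no gadget, so one skeleton
    -- can be filled by `flatten` with runs of the old gadget or of the new one.
    data Skeleton : O → Ports r → Set where
      stop : ∀ {u} → Skeleton u []
      move : ∀ {u ps} w → Skeleton w ps → Skeleton u ps
      run  : ∀ {u ps} p q → u ≡ port p → Skeleton (port q) ps → Skeleton u ((p , q) ∷ ps)

    flatten : ∀ {k u ps} → Skeleton u ps → Runs k ps → List (O ⊎ Fin k)
    flatten stop          []              = []
    flatten (move w s)    rs              = inj₁ w ∷ flatten s rs
    flatten (run p q e s) ((a , as) ∷ rs) = (inj₂ a ∷ map inj₂ as) ++ inj₁ (port q) ∷ flatten s rs

    outs : ∀ {u ps} → Skeleton u ps → List O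
    outs stop          = []
    outs (move w s)    = w ∷ outs s
    outs (run p q e s) = port q ∷ outs s

    Links◎ : (O → O → Set) → ∀ {u ps} → Skeleton u ps → Set
    Links◎ oR {u} stop          = oR u x₀
    Links◎ oR {u} (move w s)    = oR u w × Links◎ oR s
    Links◎ oR {u} (run p q e s) = Links◎ oR s

    module _ {k} {oR : O → O → Set} {K : Gadget r k} where

      chain-links : ∀ {a} as {q} → Chain K a as q → Links (Adj◎ oR K) (inj₂ a) (map inj₂ as) (inj₁ (port q))
      chain-links []       c       = _ , refl , c
      chain-links (b ∷ bs) (e , c) = e , chain-links bs c

      links-chain : ∀ {a} as {q} → Links (Adj◎ oR K) (inj₂ a) (map inj₂ as) (inj₁ (port q)) → Chain K a as q
      links-chain []       (p , e , c) rewrite port-injective e = c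
      links-chain (b ∷ bs) (e , c)     = e , links-chain bs c

      flatten-links : ∀ {u ps} (s : Skeleton u ps) (rs : Runs k ps) → Links◎ oR s → RunsOK K rs →
        Links (Adj◎ oR K) (inj₁ u) (flatten s rs) (inj₁ x₀)
      flatten-links stop          []              l       _            = l
      flatten-links (move w s)    rs              (e , l) ok           = e , flatten-links s rs l ok
      flatten-links (run p q e s) ((a , as) ∷ rs) l       (pe , c , ok) =
        (p , e , pe) , links-++⁺ (map inj₂ as) (chain-links as c) (flatten-links s rs l ok)

      links-flatten : ∀ {u ps} (s : Skeleton u ps) (rs : Runs k ps) →
        Links (Adj◎ oR K) (inj₁ u) (flatten s rs) (inj₁ x₀) → RunsOK K rs
      links-flatten stop             []              l       = tt
      links-flatten (move w s)       rs              (_ , l) = links-flatten s rs l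
      links-flatten (run p q refl s) ((a , as) ∷ rs) ((p′ , e , pe) , l) with links-++⁻ (map inj₂ as) l
      ... | l₁ , l₂ = subst (λ p → pA K a p ≡ true) (sym (port-injective e)) pe , links-chain as l₁ , links-flatten s rs l₂

    links-outs : ∀ {k} {Q : O ⊎ Fin k → O ⊎ Fin k → Set} {u ps} (s : Skeleton u ps) (rs : Runs k ps) →
      Links Q (inj₁ u) (flatten s rs) (inj₁ x₀) → Links◎ (λ u w → Q (inj₁ u) (inj₁ w)) s
    links-outs stop          []              l       = l
    links-outs (move w s)    rs              (e , l) = e , links-outs s rs l
    links-outs (run p q e s) ((a , as) ∷ rs) (_ , l) = links-outs s rs (proj₂ (links-++⁻ (map inj₂ as) l))

    step-outs : ∀ {k k′ u ps} (s : Skeleton u ps) (rs : Runs k ps) (rs′ : Runs k′ ps) {v w} →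
      Step (inj₁ u) (flatten s rs) (inj₁ x₀) (inj₁ v) (inj₁ w) → Step (inj₁ u) (flatten s rs′) (inj₁ x₀) (inj₁ v) (inj₁ w)
    step-outs stop          []              []                (refl , refl)        = refl , refl
    step-outs (move w s)    rs              rs′               (inj₁ (refl , refl)) = inj₁ (refl , refl)
    step-outs (move w s)    rs              rs′               (inj₂ st)            = inj₂ (step-outs s rs rs′ st)
    step-outs (run p q e s) ((a , as) ∷ rs) ((a′ , as′) ∷ rs′) (inj₁ (_ , ()))
    step-outs (run p q e s) ((a , as) ∷ rs) ((a′ , as′) ∷ rs′) (inj₂ st) =
      inj₂ (step-prefix (map inj₂ as′) (step-outs s rs rs′ (skip a as st)))
      where
      skip : ∀ a as {y l z v w} → Step (inj₂ a) (map inj₂ as ++ y ∷ l) z (inj₁ v) (inj₁ w) → Step y l z (inj₁ v) (inj₁ w)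
      skip a []       (inj₂ st)       = st
      skip a (b ∷ bs) (inj₂ st)       = skip b bs st

    run-links : ∀ {k u p q} (s : Skeleton u ((p , q) ∷ [])) ((a , as) : Run k) →
      Links (Step (inj₁ u) (flatten s ((a , as) ∷ [])) (inj₁ x₀)) (inj₁ (port p)) (map inj₂ (a ∷ as)) (inj₁ (port q))
    run-links {u = u} {p} {q} (move w s) (a , as) =
      links-map {R = Step (inj₁ w) (flatten s ((a , as) ∷ [])) (inj₁ x₀)} inj₂ (map inj₂ (a ∷ as)) (run-links s (a , as))
    run-links (run p q refl s) (a , as) =
      proj₁ (links-++⁻ {R = Step (inj₁ (port p)) l (inj₁ x₀)} (map inj₂ (a ∷ as)) (links-self (inj₁ (port p)) l (inj₁ x₀)))
      where l = flatten (run {u = port p} p q refl s) ((a , as) ∷ [])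

    -- Separates the vertex conditions of a hamiltonian cycle into one on the skeleton and one on
    -- the cells. `ham-parts` takes a cycle apart along it, and `parts-ham` reassembles it with
    -- other runs.
    flatten-↭ : ∀ {k u ps} (s : Skeleton u ps) (rs : Runs k ps) → flatten s rs ↭ map inj₁ (outs s) ++ map inj₂ (cells rs)
    flatten-↭ stop          []              = refl
    flatten-↭ (move w s)    rs              = prep _ (flatten-↭ s rs)
    flatten-↭ (run p q e s) ((a , as) ∷ rs) = begin
      as⁺ ++ inj₁ (port q) ∷ flatten s rs                    ↭⟨ shift (inj₁ (port q)) as⁺ _ ⟩
      inj₁ (port q) ∷ as⁺ ++ flatten s rs                    ↭⟨ prep _ (++⁺ˡ as⁺ (flatten-↭ s rs)) ⟩
      inj₁ (port q) ∷ as⁺ ++ (os ++ map inj₂ (cells rs))     ≡⟨ cong (inj₁ (port q) ∷_) (++-assoc as⁺ os _) ⟨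
      inj₁ (port q) ∷ (as⁺ ++ os) ++ map inj₂ (cells rs)     ↭⟨ prep _ (++⁺ʳ _ (++-comm as⁺ os)) ⟩
      inj₁ (port q) ∷ (os ++ as⁺) ++ map inj₂ (cells rs)     ≡⟨ cong (inj₁ (port q) ∷_) (++-assoc os as⁺ _) ⟩
      inj₁ (port q) ∷ os ++ (as⁺ ++ map inj₂ (cells rs))     ≡⟨ cong (λ l → inj₁ (port q) ∷ os ++ l) (map-++ inj₂ (a ∷ as) _) ⟨
      inj₁ (port q) ∷ os ++ map inj₂ (a ∷ as ++ cells rs)    ∎
      where
      open PermutationReasoning
      as⁺ = map inj₂ (a ∷ as)
      os  = map inj₁ (outs s)

    ham-parts : ∀ {k oR} {K : Gadget r k} {ps} (s : Skeleton x₀ ps) (rs : Runs k ps) →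
      IsHam (Adj◎ oR K) (inj₁ x₀) (flatten s rs) →
      (Unique (x₀ ∷ outs s) × (∀ u → u ∈ x₀ ∷ outs s)) × (Unique (cells rs) × (∀ a → a ∈ cells rs))
    ham-parts s rs (isHam u c l) =
      (unique-map⁻ inj₁ (proj₁ us) , λ o → in₁ (∈-++⁻ os (∈-resp-↭ p (c (inj₁ o))))) ,
      (unique-map⁻ inj₂ (proj₂ us) , λ a → in₂ (∈-++⁻ os (∈-resp-↭ p (c (inj₂ a)))))
      where
      os = map inj₁ (x₀ ∷ outs s)
      p : inj₁ x₀ ∷ flatten s rs ↭ os ++ map inj₂ (cells rs)
      p = prep _ (flatten-↭ s rs)
      us = unique-++⁻ os (unique-resp-↭ p u)
      in₁ : ∀ {o} → inj₁ o ∈ os ⊎ inj₁ o ∈ map inj₂ (cells rs) → o ∈ x₀ ∷ outs s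
      in₁ (inj₁ h) with ∈-map⁻ inj₁ h
      ... | _ , o∈ , refl = o∈
      in₁ (inj₂ h) with ∈-map⁻ inj₂ h
      ... | _ , _ , ()
      in₂ : ∀ {a} → inj₂ a ∈ os ⊎ inj₂ a ∈ map inj₂ (cells rs) → a ∈ cells rs
      in₂ (inj₂ h) with ∈-map⁻ inj₂ h
      ... | _ , a∈ , refl = a∈
      in₂ (inj₁ h) with ∈-map⁻ inj₁ h
      ... | _ , _ , ()

    parts-ham : ∀ {k oR} {K : Gadget r k} {ps} (s : Skeleton x₀ ps) (rs : Runs k ps) → Links◎ oR s → RunsOK K rs →
      Unique (x₀ ∷ outs s) → (∀ u → u ∈ x₀ ∷ outs s) → Unique (cells rs) → (∀ a → a ∈ cells rs) →
      IsHam (Adj◎ oR K) (inj₁ x₀) (flatten s rs)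
    parts-ham {k} s rs l ok u c u′ c′ = isHam
      (unique-resp-↭ (↭-sym p) (Unique.++⁺ (Unique.map⁺ inj₁-injective u) (Unique.map⁺ inj₂-injective u′)
        λ { (h₁ , h₂) → disjoint (∈-map⁻ inj₁ h₁) (∈-map⁻ inj₂ h₂) }))
      (λ { (inj₁ o) → ∈-resp-↭ (↭-sym p) (∈-++⁺ˡ (∈-map⁺ inj₁ (c o)))
         ; (inj₂ a) → ∈-resp-↭ (↭-sym p) (∈-++⁺ʳ os (∈-map⁺ inj₂ (c′ a))) })
      (flatten-links s rs l ok)
      where
      os = map inj₁ (x₀ ∷ outs s)
      p : inj₁ x₀ ∷ flatten s rs ↭ os ++ map inj₂ (cells rs)
      p = prep _ (flatten-↭ s rs)
      disjoint : ∀ {v : O ⊎ Fin k} → (∃ λ o → o ∈ x₀ ∷ outs s × v ≡ inj₁ o) → (∃ λ a → a ∈ cells rs × v ≡ inj₂ a) → ⊥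
      disjoint (_ , _ , refl) (_ , _ , ())

    -- Because no vertex is repeated, a marked port cannot occur later on the walk; a marked port
    -- can be left into the gadget only while the walk still stands on it, and then it is `cur`.
    ports-ok : ∀ {u ps} (s : Skeleton u ps) U cur → Unique (u ∷ outs s) →
      (∀ p → lookup U p ≡ true → port p ∉ outs s) → (∀ p → lookup U p ≡ true → u ≡ port p → cur ≡ just p) →
      PortsOK U cur ps
    ports-ok stop          U cur un h₁ h₂ = tt
    ports-ok (move w s)    U cur un h₁ h₂ = ports-ok s U cur (unique-tail un) (λ p l m → h₁ p l (there m))
      (λ { p l refl → contradiction (here refl) (h₁ p l) })
    ports-ok (run {u} p q refl s) U cur un h₁ h₂ = open? , shut ,
      ports-ok s _ (just q) (unique-tail un) seen now
      where
      U₁ = U [ p ]≔ true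
      open? : lookup U p ≡ false ⊎ cur ≡ just p
      open? with lookup U p in eq
      ... | true  = inj₂ (h₂ p eq refl)
      ... | false = inj₁ refl
      q≢p : q ≢ p
      q≢p refl = unique-head un (here refl)
      shut : lookup U₁ q ≡ false
      shut with lookup U q in eq
      ... | false = ≡-trans (lookup∘update′ q≢p U true) eq
      ... | true  = contradiction (here refl) (h₁ q eq)
      seen : ∀ o → lookup (U₁ [ q ]≔ true) o ≡ true → port o ∉ outs s
      seen o l m with o ≟ q | o ≟ p
      ... | yes refl | _        = unique-head (unique-tail un) m
      ... | no _     | yes refl = unique-head un (there m)
      ... | no o≢q   | no o≢p   =
        h₁ o (≡-trans (sym (lookup∘update′ o≢p U true)) (≡-trans (sym (lookup∘update′ o≢q U₁ true)) l)) (there m)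
      now : ∀ o → lookup (U₁ [ q ]≔ true) o ≡ true → port q ≡ port o → just q ≡ just o
      now o _ e = cong just (port-injective e)

    record Parse {k} (u : O) (ys : List (O ⊎ Fin k)) : Set where
      constructor parse
      field
        {ps} : Ports r
        skel : Skeleton u ps
        runs : Runs k ps
        eq   : ys ≡ flatten skel runs

    module _ {k} {oR : O → O → Set} {K : Gadget r k} (x₀-no-port : ∀ p → x₀ ≢ port p) where

      -- `x₀-no-port` makes parsing succeed: the closing step to `x₀` cannot start at a cell, so
      -- every run ends at a port inside the list.
      parse-outside : ∀ u ys → Links (Adj◎ oR K) (inj₁ u) ys (inj₁ x₀) → Parse {k} u ys
      parse-inside  : ∀ a ys → Links (Adj◎ oR K) (inj₂ a) ys (inj₁ x₀) →
        ∃₂ λ as q → Σ (List (O ⊎ Fin k)) λ zs → ys ≡ map inj₂ as ++ inj₁ (port q) ∷ zs × Parse {k} (port q) zs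
      parse-outside u []            l       = parse stop [] refl
      parse-outside u (inj₁ w ∷ ys) (_ , l) with parse-outside w ys l
      ... | parse s rs refl = parse (move w s) rs refl
      parse-outside u (inj₂ a ∷ ys) ((p , e , _) , l) with parse-inside a ys l
      ... | as , q , zs , refl , parse s rs refl = parse (run p q e s) ((a , as) ∷ rs) refl
      parse-inside a []            (p , e , _) = contradiction e (x₀-no-port p)
      parse-inside a (inj₂ b ∷ ys) (_ , l) with parse-inside b ys l
      ... | as , q , zs , refl , pr = b ∷ as , q , zs , refl , pr
      parse-inside a (inj₁ w ∷ ys) ((q , refl , _) , l) = [] , q , ys , refl , parse-outside w ys l

    module Replace {k k′ : ℕ} (t : Tables r k) (t′ : Tables r k′) (p₀ q₀ : Fin r) (ρ : Run k) (ρ′ : Run k′)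
      (x₀-no-port : ∀ p → x₀ ≢ port p) (oR : O → O → Set)
      (sim : Simulation.simulates t t′ p₀ q₀ ρ ρ′ ≡ true)
      (ρ-path : runs? (pathGadget p₀ ρ q₀) {(p₀ , q₀) ∷ []} (ρ ∷ []) ≡ true)
      (ρ′-span : spanning? ⟦ t′ ⟧ {(p₀ , q₀) ∷ []} (ρ′ ∷ []) ≡ true)
      (s : Skeleton x₀ ((p₀ , q₀) ∷ [])) where

      open Simulation t t′ p₀ q₀ ρ ρ′

      c  = flatten s (ρ ∷ [])
      c′ = flatten s (ρ′ ∷ [])

      module _ (ham : IsHam (Adj◎ oR ⟦ t ⟧) (inj₁ x₀) c) where

        ham′ : IsHam (Adj◎ oR ⟦ t′ ⟧) (inj₁ x₀) c′
        ham′ with ∧-true {runs? ⟦ t′ ⟧ {(p₀ , q₀) ∷ []} (ρ′ ∷ [])} ρ′-span | ham-parts s (ρ ∷ []) ham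
        ... | e₁ , e₂ | (u , cov) , _ with ∧-true {distinct (cells {ps = (p₀ , q₀) ∷ []} (ρ′ ∷ []))} e₂
        ... | e₃ , e₄ = parts-ham s (ρ′ ∷ []) (links-outs s (ρ ∷ []) (IsHam.links ham)) (runs?⇒ ⟦ t′ ⟧ (ρ′ ∷ []) e₁) u cov
          (distinct⇒unique _ e₃) (covers⇒∈ _ e₄)

        module _ (uniq : ∀ zs → IsHam (Adj◎ oR ⟦ t ⟧) (inj₁ x₀) zs → Links (SymStep (inj₁ x₀) c (inj₁ x₀)) (inj₁ x₀) zs (inj₁ x₀)) where

          -- Presents the edge set of `c` itself as an outside relation together with the path
          -- gadget `E`. The machinery for graphs with a gadget then applies to it as well.
          oE : O → O → Set
          oE u w = SymStep (inj₁ x₀) c (inj₁ x₀) (inj₁ u) (inj₁ w)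

          Adj◎-sym : ∀ {x y} → Adj◎ oE E x y → Adj◎ oE E y x
          Adj◎-sym {inj₁ u} {inj₁ w} e = Sum.swap e
          Adj◎-sym {inj₁ u} {inj₂ a} e = e
          Adj◎-sym {inj₂ a} {inj₁ u} e = e
          Adj◎-sym {inj₂ a} {inj₂ b} e with consecutive (proj₁ ρ) (proj₂ ρ) a b | consecutive (proj₁ ρ) (proj₂ ρ) b a
          ... | true  | true  = refl
          ... | true  | false = refl
          ... | false | true  = refl

          c-path : Links (Adj◎ oE E) (inj₁ x₀) c (inj₁ x₀)
          c-path = flatten-links s (ρ ∷ []) (links-outs {Q = SymStep (inj₁ x₀) c (inj₁ x₀)} s (ρ ∷ []) (links-map {R = Step (inj₁ x₀) c (inj₁ x₀)} inj₁ c (links-self (inj₁ x₀) c (inj₁ x₀))))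
            (runs?⇒ E {(p₀ , q₀) ∷ []} (ρ ∷ []) ρ-path)

          sym⊆path : ∀ {x y} → SymStep (inj₁ x₀) c (inj₁ x₀) x y → Adj◎ oE E x y
          sym⊆path (inj₁ st) = links-lookup c c-path st
          sym⊆path {x} {y} (inj₂ st) = Adj◎-sym {y} {x} (links-lookup c c-path st)

          c′-step : ∀ {x y} → Step (inj₁ (port p₀)) (map inj₂ (proj₁ ρ′ ∷ proj₂ ρ′)) (inj₁ (port q₀)) x y →
            Step (inj₁ x₀) c′ (inj₁ x₀) x y
          c′-step = links-lookup (map inj₂ (proj₁ ρ′ ∷ proj₂ ρ′)) (run-links s ρ′)

          c′-port : ∀ a p → pA E′ a p ≡ true → SymStep (inj₁ x₀) c′ (inj₁ x₀) (inj₁ (port p)) (inj₂ a)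
          c′-port a p e with ∨-true {p == p₀ ∧ a == proj₁ ρ′} e
          ... | inj₁ h rewrite ==⇒≡ p p₀ (proj₁ (∧-true h)) | ==⇒≡ a (proj₁ ρ′) (proj₂ (∧-true {p == p₀} h)) =
            inj₁ (c′-step (inj₁ (refl , refl)))
          ... | inj₂ h rewrite ==⇒≡ p q₀ (proj₁ (∧-true h)) | ==⇒≡ a (lastOf (proj₁ ρ′) (proj₂ ρ′)) (proj₂ (∧-true {p == q₀} h)) =
            inj₂ (c′-step (inj₂ (step-last inj₂ (proj₁ ρ′) (proj₂ ρ′))))

          path′⊆sym : ∀ {x y} → Adj◎ oE E′ x y → SymStep (inj₁ x₀) c′ (inj₁ x₀) x y
          path′⊆sym {inj₁ u} {inj₁ w} (inj₁ st) = inj₁ (step-outs s (ρ ∷ []) (ρ′ ∷ []) st)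
          path′⊆sym {inj₁ u} {inj₁ w} (inj₂ st) = inj₂ (step-outs s (ρ ∷ []) (ρ′ ∷ []) st)
          path′⊆sym {inj₁ u} {inj₂ a} (p , refl , e) = c′-port a p e
          path′⊆sym {inj₂ a} {inj₁ u} (p , refl , e) = Sum.swap (c′-port a p e)
          path′⊆sym {inj₂ a} {inj₂ b} e with ∨-true {consecutive (proj₁ ρ′) (proj₂ ρ′) a b} e
          ... | inj₁ h = inj₁ (c′-step (inj₂ (consecutive⇒step (proj₁ ρ′) (proj₂ ρ′) h)))
          ... | inj₂ h = inj₂ (c′-step (inj₂ (consecutive⇒step (proj₁ ρ′) (proj₂ ρ′) h)))

          -- Parse the cycle and replace its trace by the matching trace of `t`. The result is a
          -- cycle of the old graph, so by `uniq` it follows `c`. Its runs therefore lie on `E`, the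
          -- simulation puts the original runs on `E′`, and the outside steps are the same in both
          -- cycles.
          uniq′ : ∀ ys → IsHam (Adj◎ oR ⟦ t′ ⟧) (inj₁ x₀) ys → Links (SymStep (inj₁ x₀) c′ (inj₁ x₀)) (inj₁ x₀) ys (inj₁ x₀)
          uniq′ ys h with parse-outside {K = ⟦ t′ ⟧} x₀-no-port x₀ ys (IsHam.links h)
          ... | parse {ps} sk rs′ refl with ham-parts sk rs′ h
          ... | (u , cov) , (u′ , cov′) with simulate sim ps rs′ (links-flatten sk rs′ (IsHam.links h)) u′ cov′
                (ports-ok sk (replicate r false) nothing u
                  (λ p l → case ≡-trans (sym (lookup-replicate p false)) l of λ ())
                  (λ p l → case ≡-trans (sym (lookup-replicate p false)) l of λ ()))
          ... | rs , ok , v , w , imp = links-map {R = Adj◎ oE E′} (λ {x} {y} → path′⊆sym {x} {y}) (flatten sk rs′)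
            (flatten-links sk rs′ (links-outs {Q = Adj◎ oE E} sk rs zs-path) (imp (links-flatten sk rs zs-path)))
            where
            zs-path : Links (Adj◎ oE E) (inj₁ x₀) (flatten sk rs) (inj₁ x₀)
            zs-path = links-map {Q = Adj◎ oE E} (λ {x} {y} → sym⊆path {x} {y}) (flatten sk rs) (uniq (flatten sk rs)
              (parts-ham sk rs (links-outs sk rs′ (IsHam.links h)) ok u cov v w))

-- 3-connectivity and its transport through a replacement.

module Cuts where
  open Cycles
  open Gadgets
  open Traces
  open import Data.Vec using (lookup)
  open import Data.Vec.Properties using (lookup∘update)

  private variable
    A B : Set

  infixr 5 _∷_
  data Path {A : Set} (R : A → A → Set) (x y : A) : A → A → Set where
    []  : ∀ {u} → Path R x y u u
    _∷_ : ∀ {u w v} → R u w × w ≢ x × w ≢ y → Path R x y w v → Path R x y u v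

  -- `x` and `y` may coincide, so the deletion of a single vertex is included.
  Connected₃ : (A → A → Set) → Set
  Connected₃ R = ∀ x y {u v} → u ≢ x → u ≢ y → v ≢ x → v ≢ y → Path R x y u v

  module _ {R : A → A → Set} {x y : A} where

    _⊙_ : ∀ {u v w} → Path R x y u v → Path R x y v w → Path R x y u w
    []       ⊙ q = q
    (e ∷ p)  ⊙ q = e ∷ (p ⊙ q)

    path-sym : (∀ {u v} → R u v → R v u) → ∀ {u v} → u ≢ x → u ≢ y → Path R x y u v → Path R x y v u
    path-sym s ux uy []                  = []
    path-sym s ux uy ((r , wx , wy) ∷ p) = path-sym s wx wy p ⊙ ((s r , ux , uy) ∷ [])

  connected₃-map : {R : A → A → Set} {Q : B → B → Set} (f : A → B) (g : B → A) → (∀ b → f (g b) ≡ b) → (∀ a → g (f a) ≡ a) →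
    (∀ {u v} → R u v → Q (f u) (f v)) → Connected₃ R → Connected₃ Q
  connected₃-map {R = R} {Q} f g fg gf r c x y {u} {v} ux uy vx vy =
    subst₂′ (go (c (g x) (g y) (ux ∘ g-inj) (uy ∘ g-inj) (vx ∘ g-inj) (vy ∘ g-inj)))
    where
    g-inj : ∀ {a b} → g a ≡ g b → a ≡ b
    g-inj {a} {b} e = ≡-trans (sym (fg a)) (≡-trans (cong f e) (fg b))
    go : ∀ {a b} → Path R (g x) (g y) a b → Path Q x y (f a) (f b)
    go []                  = []
    go ((e , wx , wy) ∷ p) = (r e , (λ h → wx (≡-trans (sym (gf _)) (cong g h))) , λ h → wy (≡-trans (sym (gf _)) (cong g h))) ∷ go p
    subst₂′ : Path Q x y (f (g u)) (f (g v)) → Path Q x y u v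
    subst₂′ p rewrite fg u | fg v = p

  flags : ∀ {k} → List (Fin k) → Vec Bool k
  flags []       = replicate _ false
  flags (i ∷ is) = flags is [ i ]≔ true

  flags-elem : ∀ {k} (is : List (Fin k)) i → lookup (flags is) i ≡ false → elem i is ≡ false
  flags-elem []       i e = refl
  flags-elem (j ∷ js) i e with i ≟ j
  ... | yes refl = contradiction (≡-trans (sym (lookup∘update i (flags js) true)) e) λ ()
  ... | no i≢j with i == j in eq
  ... | true  = contradiction (==⇒≡ i j eq) i≢j
  ... | false = flags-elem js i (≡-trans (sym (lookup∘update′ i≢j (flags js) true)) e)

  module _ {k} (nb : Fin k → List (Fin k)) where

    -- Only soundness is proved. Where a set must be complete, the calling test checks closure
    -- itself, so a truncated exploration could only make a test fail.
    explore : ℕ → List (Fin k) → Vec Bool k → List (Fin k) → List (Fin k)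
    explore zero    st       vis acc = acc
    explore (suc f) []       vis acc = acc
    explore (suc f) (i ∷ st) vis acc =
      if lookup vis i then explore f st vis acc else explore f (nb i ++ st) (vis [ i ]≔ true) (i ∷ acc)

    module _ (blocked : Fin k → Set) (P : Fin k → Set) (closed : ∀ {i j} → P i → j ∈ nb i → ¬ blocked j → P j) where

      explore-sound : ∀ f st vis acc → (∀ {i} → i ∈ st → ¬ blocked i → P i) → (∀ i → lookup vis i ≡ false → ¬ blocked i) →
        (∀ {i} → i ∈ acc → P i) → ∀ {i} → i ∈ explore f st vis acc → P i
      explore-sound zero    st       vis acc hs hv ha i∈ = ha i∈
      explore-sound (suc f) []       vis acc hs hv ha i∈ = ha i∈
      explore-sound (suc f) (j ∷ st) vis acc hs hv ha i∈ with lookup vis j in eq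
      ... | true  = explore-sound f st vis acc (hs ∘ there) hv ha i∈
      ... | false = explore-sound f (nb j ++ st) (vis [ j ]≔ true) (j ∷ acc)
        (λ {i} m → Sum.[ closed Pj , hs ∘ there ]′ (∈-++⁻ (nb j) m)) hv′ (λ { (here refl) → Pj ; (there m) → ha m }) i∈
        where
        Pj : P j
        Pj = hs (here refl) (hv j eq)
        hv′ : ∀ i → lookup (vis [ j ]≔ true) i ≡ false → ¬ blocked i
        hv′ i e with i ≟ j
        ... | yes refl = contradiction (≡-trans (sym (lookup∘update j vis true)) e) λ ()
        ... | no i≢j   = hv i (≡-trans (sym (lookup∘update′ i≢j vis true)) e)

  some : (A → Bool) → List A → Bool
  some f []       = false
  some f (x ∷ xs) = if f x then true else some f xs

  some⇒∃ : (f : A → Bool) (xs : List A) → some f xs ≡ true → ∃ λ x → x ∈ xs × f x ≡ true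
  some⇒∃ f (x ∷ xs) e with f x in eq
  ... | true  = x , here refl , eq
  ... | false = let y , m , h = some⇒∃ f xs e in y , there m , h

  pick : ∀ {k} → (Fin k → Bool) → List (Fin k) → List (Fin k)
  pick f []       = []
  pick f (i ∷ is) = if f i then i ∷ pick f is else pick f is

  pick⇒ : ∀ {k} (f : Fin k → Bool) is {i} → i ∈ pick f is → f i ≡ true
  pick⇒ f (j ∷ js) m with f j in eq
  pick⇒ f (j ∷ js) (here refl) | true  = eq
  pick⇒ f (j ∷ js) (there m)   | true  = pick⇒ f js m
  pick⇒ f (j ∷ js) m           | false = pick⇒ f js m

  -- There are at most `k` start cells and, in the gadgets used, at most three pushes per visited
  -- cell, so `5 * k` steps empty the stack.
  region : ∀ {r k} → Tables r k → List (Fin k) → Fin r → List (Fin k)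
  region {k = k} t rm p = explore (lookup (inner t)) (5 * k) (pick (λ i → pA ⟦ t ⟧ i p) (allFin k)) (flags rm) []

  -- Connectivity of the ports through the gadget t after deleting rm is inherited by t′ after deleting rm′.
  module Separation {r k k′} (t : Tables r k) (t′ : Tables r k′) where

    private
      K  = ⟦ t ⟧
      K′ = ⟦ t′ ⟧

    linked : Fin r → List (Fin k′) → Fin r → Bool
    linked p reg′ q = p == q ∨ some (λ i → pA K′ i q) reg′

    -- The first two conditions verify that `reg` is closed in `t` without `rm`, so it contains
    -- every cell that a path entering from `p` can reach. The third asks that each port touched by
    -- `reg` can also be reached from `p` through `t′` without `rm′`.
    inherits : List (Fin k) → List (Fin k′) → Fin r → List (Fin k) → List (Fin k′) → Bool
    inherits rm rm′ p reg reg′ =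
      every (λ i → not (pA K i p) ∨ (elem i rm ∨ elem i reg)) (allFin k) ∧
      (every (λ i → every (λ j → elem j rm ∨ elem j reg) (lookup (inner t) i)) reg ∧
       every (λ i → every (linked p reg′) (lookup (outer t) i)) reg)

    inherits? : List (Fin k) → List (Fin k′) → Bool
    inherits? rm rm′ = every (λ p → inherits rm rm′ p (region t rm p) (region t′ rm′ p)) (allFin r)

    -- `F` holds the ports that are themselves deleted. A surviving cell has to be connected to some
    -- other port, since otherwise it would be cut off from the outside.
    escapes : List (Fin k′) → List (Fin r) → List (Fin r × List (Fin k′)) → Bool
    escapes rm′ F regs = every (λ a → elem a rm′ ∨ some (λ (q , reg) → not (elem q F) ∧ elem a reg) regs) (allFin k′)

    regions : List (Fin k′) → List (Fin r × List (Fin k′))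
    regions rm′ = map (λ q → q , region t′ rm′ q) (allFin r)

    -- The three parts treat zero, one or two deleted vertices lying in the new gadget. Deleted
    -- outside vertices stay the same; deleted cells are answered by `ch₁`, or by any pair from the
    -- candidates `ch₂` that passes.
    preserves : (Fin k′ → Fin k) → (Fin k′ → Fin k′ → List (Fin k × Fin k)) → Bool
    preserves ch₁ ch₂ =
      (inherits? [] [] ∧ every (λ f → every (λ g → escapes [] (f ∷ g ∷ []) (regions [])) (allFin r)) (allFin r)) ∧
      (every (λ a → inherits? (ch₁ a ∷ []) (a ∷ []) ∧ every (λ f → escapes (a ∷ []) (f ∷ []) (regions (a ∷ []))) (allFin r)) (allFin k′) ∧
       every (λ a → every (λ b → some (λ (α , β) → inherits? (α ∷ β ∷ []) (a ∷ b ∷ [])) (ch₂ a b) ∧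
         escapes (a ∷ b ∷ []) [] (regions (a ∷ b ∷ []))) (allFin k′)) (allFin k′))

    module _ (O : Set) (port : Fin r → O) (port-injective : ∀ {p q} → port p ≡ port q → p ≡ q) (x₀ : O)
      (oR : O → O → Set) (oR-sym : ∀ {u w} → oR u w → oR w u)
      (kA′-sym : ∀ a b → kA K′ a b ≡ kA K′ b a) (port? : ∀ o → Dec (∃ λ p → o ≡ port p)) (p₀ : Fin r) where

      open Cells O port port-injective x₀ using (Adj◎)

      Adj◎-symm : ∀ {x y} → Adj◎ oR K′ x y → Adj◎ oR K′ y x
      Adj◎-symm {inj₁ u} {inj₁ w} e = oR-sym e
      Adj◎-symm {inj₁ u} {inj₂ a} e = e
      Adj◎-symm {inj₂ a} {inj₁ u} e = e
      Adj◎-symm {inj₂ a} {inj₂ b} e = ≡-trans (kA′-sym b a) e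

      module _ (x y : O ⊎ Fin k) (x′ y′ : O ⊎ Fin k′) (rm : List (Fin k)) (rm′ : List (Fin k′))
        (rm-ok  : ∀ i → inj₂ i ≢ x → inj₂ i ≢ y → elem i rm ≡ false)
        (rm′-ok : ∀ i → elem i rm′ ≡ false → inj₂ i ≢ x′ × inj₂ i ≢ y′)
        (out-ok : ∀ o → inj₁ o ≢ x → inj₁ o ≢ y → inj₁ o ≢ x′ × inj₁ o ≢ y′) where

        private
          Path′ = Path (Adj◎ oR K′) x′ y′

        blocked : Fin k′ → Set
        blocked i = elem i rm′ ≡ true

        free : ∀ i → ¬ blocked i → elem i rm′ ≡ false
        free i h with elem i rm′
        ... | true  = contradiction refl h
        ... | false = refl

        region-path : ∀ p {i} → i ∈ region t′ rm′ p → Path′ (inj₁ (port p)) (inj₂ i)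
        region-path p {i} m = explore-sound (lookup (inner t′)) blocked (λ i → Path′ (inj₁ (port p)) (inj₂ i))
          (λ {i} {j} q m b → q ⊙ ((∈⇒elem j m , rm′-ok j (free j b)) ∷ []))
          (5 * k′) (pick (λ i → pA K′ i p) (allFin k′)) (flags rm′) []
          (λ {i} m b → ((p , refl , pick⇒ (λ i → pA K′ i p) (allFin k′) m) , rm′-ok i (free i b)) ∷ [])
          (λ i e b → case ≡-trans (sym (flags-elem rm′ i e)) b of λ ()) (λ ()) m

        module _ (inh : inherits? rm rm′ ≡ true) where

          inh-at : ∀ p → inherits rm rm′ p (region t rm p) (region t′ rm′ p) ≡ true
          inh-at p = every-lookup (λ p → inherits rm rm′ p (region t rm p) (region t′ rm′ p)) inh (∈-allFin p)

          start : ∀ p i → pA K i p ≡ true → elem i rm ≡ false → i ∈ region t rm p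
          start p i e f with every-lookup (λ i → not (pA K i p) ∨ (elem i rm ∨ elem i (region t rm p))) (proj₁ (∧-true (inh-at p))) (∈-allFin i)
          ... | h rewrite e | f = elem⇒∈ i _ h

          grow : ∀ p i j → i ∈ region t rm p → kA K i j ≡ true → elem j rm ≡ false → j ∈ region t rm p
          grow p i j m e f with every-lookup (λ j → elem j rm ∨ elem j (region t rm p))
            (every-lookup (λ i → every (λ j → elem j rm ∨ elem j (region t rm p)) (lookup (inner t) i))
              (proj₁ (∧-true (proj₂ (∧-true {every (λ i → not (pA K i p) ∨ (elem i rm ∨ elem i (region t rm p))) (allFin k)} (inh-at p))))) m)
            (elem⇒∈ j (lookup (inner t) i) e)
          ... | h rewrite f = elem⇒∈ j _ h

          arrive : ∀ p q i → i ∈ region t rm p → pA K i q ≡ true → inj₁ (port q) ≢ x′ → inj₁ (port q) ≢ y′ →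
            Path′ (inj₁ (port p)) (inj₁ (port q))
          arrive p q i m e qx qy with ∨-true {p == q} (every-lookup (linked p (region t′ rm′ p))
            (every-lookup (λ i → every (linked p (region t′ rm′ p)) (lookup (outer t) i))
              (proj₂ (∧-true {every (λ i → every (λ j → elem j rm ∨ elem j (region t rm p)) (lookup (inner t) i)) (region t rm p)}
                (proj₂ (∧-true {every (λ i → not (pA K i p) ∨ (elem i rm ∨ elem i (region t rm p))) (allFin k)} (inh-at p))))) m)
            (elem⇒∈ q (lookup (outer t) i) e))
          ... | inj₁ h rewrite ==⇒≡ p q h = []
          ... | inj₂ h = let j , m′ , e′ = some⇒∃ (λ i → pA K′ i q) _ h in
            region-path p m′ ⊙ (((q , refl , e′) , qx , qy) ∷ [])

          -- While the old path wanders inside the gadget, the new one waits at the entry port `p`.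
          -- Only when the old path leaves to a port `q` does `arrive` carry the new one across
          -- `t′`.
          lift-out : ∀ {u v} → Path (Adj◎ oR K) x y (inj₁ u) (inj₁ v) → Path′ (inj₁ u) (inj₁ v)
          lift-in  : ∀ p {i v} → i ∈ region t rm p → Path (Adj◎ oR K) x y (inj₂ i) (inj₁ v) → Path′ (inj₁ (port p)) (inj₁ v)
          lift-out [] = []
          lift-out (_∷_ {w = inj₁ w} (e , wx , wy) π) = (e , out-ok w wx wy) ∷ lift-out π
          lift-out (_∷_ {w = inj₂ i} ((p , refl , e) , ix , iy) π) = lift-in p (start p i e (rm-ok i ix iy)) π
          lift-in p m (_∷_ {u = inj₂ i} {w = inj₂ j} (e , jx , jy) π) = lift-in p (grow p i j m e (rm-ok j jx jy)) π
          lift-in p m (_∷_ {u = inj₂ i} {w = inj₁ w} ((q , refl , e) , wx , wy) π) =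
            arrive p q i m e (proj₁ (out-ok w wx wy)) (proj₂ (out-ok w wx wy)) ⊙ lift-out π

          module _ (F : List (Fin r)) (esc : escapes rm′ F (regions rm′) ≡ true)
            (F-ok : ∀ q → elem q F ≡ false → inj₁ (port q) ≢ x′ × inj₁ (port q) ≢ y′)
            (in-ok : ∀ i → inj₂ i ≢ x′ → inj₂ i ≢ y′ → elem i rm′ ≡ false)
            (back : ∀ o → inj₁ o ≢ x′ → inj₁ o ≢ y′ → inj₁ o ≢ x × inj₁ o ≢ y)
            (conn : Connected₃ (Adj◎ oR K)) where

            gate : ∀ u → u ≢ x′ → u ≢ y′ → ∃ λ o → inj₁ o ≢ x′ × inj₁ o ≢ y′ × Path′ (inj₁ o) u
            gate (inj₁ o) ux uy = o , ux , uy , []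
            gate (inj₂ a) ux uy with every-lookup (λ a → elem a rm′ ∨ some (λ (q , reg) → not (elem q F) ∧ elem a reg) (regions rm′)) esc (∈-allFin a)
            ... | h rewrite in-ok a ux uy with some⇒∃ (λ (q , reg) → not (elem q F) ∧ elem a reg) (regions rm′) h
            ... | (q , reg) , m , e with Data.List.Membership.Propositional.Properties.∈-map⁻ (λ q → q , region t′ rm′ q) m
            ... | .q , _ , refl with elem q F in eq
            ... | false = port q , proj₁ (F-ok q eq) , proj₂ (F-ok q eq) , region-path q (elem⇒∈ a _ e)

            connect : ∀ {u v} → u ≢ x′ → u ≢ y′ → v ≢ x′ → v ≢ y′ → Path′ u v
            connect {u} {v} ux uy vx vy with gate u ux uy | gate v vx vy
            ... | o , ox , oy , π | o′ , ox′ , oy′ , π′ =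
              path-sym (λ {x} {y} → Adj◎-symm {x} {y}) ox oy π ⊙
              (lift-out (conn x y (proj₁ (back o ox oy)) (proj₂ (back o ox oy)) (proj₁ (back o′ ox′ oy′)) (proj₂ (back o′ ox′ oy′))) ⊙ π′)

      module _ (ch₁ : Fin k′ → Fin k) (ch₂ : Fin k′ → Fin k′ → List (Fin k × Fin k)) (pres : preserves ch₁ ch₂ ≡ true)
        (conn : Connected₃ (Adj◎ oR K)) where

        private
          part₀ = ∧-true {inherits? [] []} (proj₁ (∧-true pres))
          C₁ : Fin k′ → Bool
          C₁ a = inherits? (ch₁ a ∷ []) (a ∷ []) ∧ every (λ f → escapes (a ∷ []) (f ∷ []) (regions (a ∷ []))) (allFin r)
          C₂ : Fin k′ → Fin k′ → Bool
          C₂ a b = some (λ (α , β) → inherits? (α ∷ β ∷ []) (a ∷ b ∷ [])) (ch₂ a b) ∧ escapes (a ∷ b ∷ []) [] (regions (a ∷ b ∷ []))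
          part₁₂ = ∧-true {every C₁ (allFin k′)} (proj₂ (∧-true {inherits? [] [] ∧ every (λ f → every (λ g → escapes [] (f ∷ g ∷ []) (regions [])) (allFin r)) (allFin r)} pres))

        -- A deleted outside vertex that is no port is represented by the default `p₀`. This is
        -- harmless: forbidding one more port only strengthens `escapes`.
        portOr : O → Fin r
        portOr o with port? o
        ... | yes (p , _) = p
        ... | no _        = p₀

        portOr-port : ∀ p → portOr (port p) ≡ p
        portOr-port p with port? (port p)
        ... | yes (q , e) = sym (port-injective e)
        ... | no h        = contradiction (p , refl) h

        ∉⇒≢ : ∀ q o F → elem q (portOr o ∷ F) ≡ false → _≢_ {A = O ⊎ Fin k′} (inj₁ (port q)) (inj₁ o)
        ∉⇒≢ q o F e refl rewrite portOr-port q | ==-refl q = case e of λ ()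

        elem-tail : ∀ {m} (q p : Fin m) F → elem q (p ∷ F) ≡ false → elem q F ≡ false
        elem-tail q p F e with q == p
        ... | false = e

        elem₁ : ∀ {m} (i a : Fin m) → i ≢ a → elem i (a ∷ []) ≡ false
        elem₁ i a h with i == a in eq
        ... | true  = contradiction (==⇒≡ i a eq) h
        ... | false = refl

        elem₂ : ∀ {m} (i a b : Fin m) → i ≢ a → i ≢ b → elem i (a ∷ b ∷ []) ≡ false
        elem₂ i a b h h′ with i == a in eq
        ... | true  = contradiction (==⇒≡ i a eq) h
        ... | false = elem₁ i b h′

        elem≢ : ∀ {m} (i a : Fin m) F → elem i (a ∷ F) ≡ false → _≢_ {A = O ⊎ Fin m} (inj₂ i) (inj₂ a)
        elem≢ i a F e refl rewrite ==-refl i = case e of λ ()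

        connected′ : Connected₃ (Adj◎ oR K′)
        connected′ (inj₁ o₁) (inj₁ o₂) = connect (inj₁ o₁) (inj₁ o₂) (inj₁ o₁) (inj₁ o₂) [] []
          (λ _ _ _ → refl) (λ _ _ → (λ ()) , λ ()) (λ o a b → (λ { refl → a refl }) , λ { refl → b refl }) (proj₁ part₀)
          (portOr o₁ ∷ portOr o₂ ∷ [])
          (every-lookup (λ g → escapes [] (portOr o₁ ∷ g ∷ []) (regions []))
            (every-lookup (λ f → every (λ g → escapes [] (f ∷ g ∷ []) (regions [])) (allFin r)) (proj₂ part₀) (∈-allFin (portOr o₁))) (∈-allFin (portOr o₂)))
          (λ q e → ∉⇒≢ q o₁ (portOr o₂ ∷ []) e , ∉⇒≢ q o₂ [] (elem-tail q (portOr o₁) (portOr o₂ ∷ []) e)) (λ _ _ _ → refl)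
          (λ o a b → (λ { refl → a refl }) , λ { refl → b refl }) conn
        connected′ (inj₁ o₁) (inj₂ a) with ∧-true {inherits? (ch₁ a ∷ []) (a ∷ [])} (every-lookup C₁ (proj₁ part₁₂) (∈-allFin a))
        ... | i , e = connect (inj₁ o₁) (inj₂ (ch₁ a)) (inj₁ o₁) (inj₂ a) (ch₁ a ∷ []) (a ∷ [])
          (λ i _ h → elem₁ i (ch₁ a) (λ { refl → h refl })) (λ i h → (λ ()) , elem≢ i a [] h) (λ o a b → (λ { refl → a refl }) , λ ()) i
          (portOr o₁ ∷ []) (every-lookup (λ f → escapes (a ∷ []) (f ∷ []) (regions (a ∷ []))) e (∈-allFin (portOr o₁)))
          (λ q e → ∉⇒≢ q o₁ [] e , λ ()) (λ i _ h → elem₁ i a (λ { refl → h refl })) (λ o a b → (λ { refl → a refl }) , λ ()) conn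
        connected′ (inj₂ a) (inj₁ o₁) with ∧-true {inherits? (ch₁ a ∷ []) (a ∷ [])} (every-lookup C₁ (proj₁ part₁₂) (∈-allFin a))
        ... | i , e = connect (inj₂ (ch₁ a)) (inj₁ o₁) (inj₂ a) (inj₁ o₁) (ch₁ a ∷ []) (a ∷ [])
          (λ i h _ → elem₁ i (ch₁ a) (λ { refl → h refl })) (λ i h → elem≢ i a [] h , (λ ())) (λ o a b → (λ ()) , (λ { refl → b refl })) i
          (portOr o₁ ∷ []) (every-lookup (λ f → escapes (a ∷ []) (f ∷ []) (regions (a ∷ []))) e (∈-allFin (portOr o₁)))
          (λ q e → (λ ()) , ∉⇒≢ q o₁ [] e) (λ i h _ → elem₁ i a (λ { refl → h refl })) (λ o a b → (λ ()) , (λ { refl → b refl })) conn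
        connected′ (inj₂ a) (inj₂ b) with ∧-true {some (λ (α , β) → inherits? (α ∷ β ∷ []) (a ∷ b ∷ [])) (ch₂ a b)}
          (every-lookup (C₂ a) (every-lookup (λ a → every (C₂ a) (allFin k′)) (proj₂ part₁₂) (∈-allFin a)) (∈-allFin b))
        ... | i , e with some⇒∃ (λ (α , β) → inherits? (α ∷ β ∷ []) (a ∷ b ∷ [])) (ch₂ a b) i
        ... | (α , β) , _ , i′ = connect (inj₂ α) (inj₂ β) (inj₂ a) (inj₂ b) (α ∷ β ∷ []) (a ∷ b ∷ [])
          (λ i h h′ → elem₂ i α β (λ { refl → h refl }) (λ { refl → h′ refl }))
          (λ i h → elem≢ i a (b ∷ []) h , elem≢ i b [] (elem-tail i a (b ∷ []) h)) (λ o _ _ → (λ ()) , (λ ())) i′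
          [] e (λ q _ → (λ ()) , λ ()) (λ i h h′ → elem₂ i a b (λ { refl → h refl }) (λ { refl → h′ refl }))
          (λ o _ _ → (λ ()) , (λ ())) conn

-- Graphs with their unique cycle, and the replacement of a gadget inside them.

module Rewriting where
  open Cycles
  open Gadgets
  open Traces
  open Cuts
  open import Data.Fin using (splitAt)
  open import Data.Fin.Properties using (splitAt-↑ˡ; splitAt-↑ʳ; splitAt⁻¹-↑ˡ; splitAt⁻¹-↑ʳ)
  open import Data.Sum using ([_,_]′)
  open import Data.List.Properties using (∷-injective; map-∘; map-id; map-cong)
  open import Data.List.Relation.Unary.All using ([]; _∷_)
  open import Data.List.Relation.Unary.AllPairs using ([]; _∷_)
  open import Data.Vec using (lookup)
  open import Relation.Nullary.Decidable using (False; fromWitnessFalse; toWitnessFalse)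
  open import Data.Bool.Properties using (T-irrelevant)

  private variable
    A B : Set

  step-target : ∀ {x : A} xs {z u v} → v ≢ z → Step x xs z u v → v ∈ xs
  step-target []       h (_ , refl)        = contradiction refl h
  step-target (_ ∷ xs) h (inj₁ (_ , refl)) = here refl
  step-target (_ ∷ xs) h (inj₂ s)          = there (step-target xs h s)

  unique-middle : ∀ (as : List A) {x bs} → Unique (as ++ x ∷ bs) → x ∉ as × x ∉ bs
  unique-middle []       u       = (λ ()) , unique-head u
  unique-middle (a ∷ as) {x} {bs} (h ∷ u) with unique-middle as u
  ... | h₁ , h₂ = (λ { (here refl) → All.lookup h (∈-++⁺ʳ as (here refl)) refl ; (there m) → h₁ m }) , h₂

  step-pred : ∀ {x : A} xs {z u y} pre {rest} → Unique (x ∷ xs) → y ≢ z → Step x xs z u y → x ∷ xs ≡ pre ++ y ∷ rest →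
    ∃ λ pre′ → pre ≡ pre′ ++ u ∷ []
  step-pred []        pre un y≢z (_ , refl) eq = contradiction refl y≢z
  step-pred (x₁ ∷ xs) [] un y≢z (inj₁ (refl , refl)) eq with ∷-injective eq
  ... | refl , _ = contradiction (here refl) (unique-head un)
  step-pred (x₁ ∷ xs) (a ∷ []) un y≢z (inj₁ (refl , refl)) eq with ∷-injective eq
  ... | refl , _ = [] , refl
  step-pred (x₁ ∷ xs) {y = y} (a ∷ b ∷ pre) {rest} un y≢z (inj₁ (refl , refl)) eq with ∷-injective eq
  ... | refl , eq′ with ∷-injective eq′
  ... | refl , refl = contradiction (∈-++⁺ʳ pre (here refl)) (unique-head (unique-tail un))
  step-pred (x₁ ∷ xs) {y = y} [] un y≢z (inj₂ s) eq with ∷-injective eq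
  ... | refl , _ = contradiction (there (step-target xs y≢z s)) (unique-head un)
  step-pred (x₁ ∷ xs) (a ∷ pre) un y≢z (inj₂ s) eq with ∷-injective eq
  ... | refl , eq′ with step-pred xs pre (unique-tail un) y≢z s eq′
  ... | pre′ , refl = a ∷ pre′ , refl

  -- Vertices are distinct, so by `step-pred` the entry before a given one is determined. Steps
  -- chained end to end therefore occupy one contiguous segment of the list.
  steps-split : ∀ {x : A} xs {z} u ys w → Unique (x ∷ xs) → z ∉ ys → w ≢ z → Links (Step x xs z) u ys w →
    ∃₂ λ pre post → x ∷ xs ≡ pre ++ u ∷ ys ++ w ∷ post
  steps-split {x = x} xs {z} u [] w un h w≢z s = go x xs w≢z s
    where
    go : ∀ x xs → w ≢ z → Step x xs z u w → ∃₂ λ pre post → x ∷ xs ≡ pre ++ u ∷ w ∷ post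
    go x []       w≢z (_ , refl)           = contradiction refl w≢z
    go x (y ∷ ys) w≢z (inj₁ (refl , refl)) = [] , ys , refl
    go x (y ∷ ys) w≢z (inj₂ s)             = let pre , post , e = go y ys w≢z s in x ∷ pre , post , cong (x ∷_) e
  steps-split xs u (y ∷ ys) w un h w≢z (s , l) with steps-split xs y ys w un (h ∘ there) w≢z l
  ... | pre , post , e with step-pred xs pre un (λ { refl → h (here refl) }) s e
  ... | pre′ , refl = pre′ , post , ≡-trans e (++-assoc pre′ (u ∷ []) (y ∷ ys ++ w ∷ post))

  record State : Set where
    field
      G    : Graph
      x₀   : Fin (n G)
      c    : List (Fin (n G))
      ham  : IsHam (Adj G) x₀ c
      uniq : ∀ ys → IsHam (Adj G) x₀ ys → Links (SymStep x₀ c x₀) x₀ ys x₀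
      conn : Connected₃ (Adj G)

  record Trail (r k : ℕ) : Set where
    constructor trail
    field
      p₀ q₀ : Fin r
      ρ     : Run k

  -- An occurrence of a gadget in a graph whose hamiltonian cycle traverses the gadget in a single run.
  record Site (S : State) {r k} (t : Tables r k) (τ : Trail r k) : Set where
    open State S
    open Trail τ
    field
      ι      : Fin k → Fin (n G)
      π      : Fin r → Fin (n G)
      ι-inj  : ∀ {i j} → ι i ≡ ι j → i ≡ j
      π-inj  : ∀ {p q} → π p ≡ π q → p ≡ q
      ι≢π    : ∀ i p → ι i ≢ π p
      kk     : ∀ i j → adj G (ι i) (ι j) ≡ kA ⟦ t ⟧ i j
      kp     : ∀ i p → adj G (ι i) (π p) ≡ pA ⟦ t ⟧ i p
      closed : ∀ i u → adj G (ι i) u ≡ true → (∃ λ j → u ≡ ι j) ⊎ (∃ λ p → u ≡ π p)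
      x₀≢ι   : ∀ i → x₀ ≢ ι i
      x₀≢π   : ∀ p → x₀ ≢ π p
      steps  : Links (Step x₀ c x₀) (π p₀) (map ι (proj₁ ρ ∷ proj₂ ρ)) (π q₀)

  -- Everything here is finite data checked by evaluation. Edges among old cells may change, but by
  -- `keep` old cells retain their ports and by `grow` new cells see only `g`; so `g` is the only
  -- outside vertex whose degree can change.
  record Rewrite {r k δ} (t : Tables r k) (τ : Trail r k) (t′ : Tables r (δ + k)) : Set where
    open Trail τ
    field
      ρ′       : Run (δ + k)
      g        : Fin r
      sim      : Simulation.simulates t t′ p₀ q₀ ρ ρ′ ≡ true
      ρ-path   : runs? (pathGadget p₀ ρ q₀) {(p₀ , q₀) ∷ []} (ρ ∷ []) ≡ true
      ρ-covers : covers (proj₁ ρ ∷ proj₂ ρ) ≡ true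
      ρ′-span  : spanning? ⟦ t′ ⟧ {(p₀ , q₀) ∷ []} (ρ′ ∷ []) ≡ true
      kA′-sym  : ∀ a b → kA ⟦ t′ ⟧ a b ≡ kA ⟦ t′ ⟧ b a
      kA′-irr  : ∀ a → kA ⟦ t′ ⟧ a a ≡ false
      keep     : ∀ i p → pA ⟦ t′ ⟧ (δ ↑ʳ i) p ≡ pA ⟦ t ⟧ i p
      grow     : ∀ a p → p ≢ g → pA ⟦ t′ ⟧ (a ↑ˡ k) p ≡ false
      ch₁      : Fin (δ + k) → Fin k
      ch₂      : Fin (δ + k) → Fin (δ + k) → List (Fin k × Fin k)
      pres     : Separation.preserves t t′ ch₁ ch₂ ≡ true

  module Surgery (S : State) {r k} {t : Tables r k} {τ : Trail r k} (site : Site S t τ) where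
    open State S
    open Trail τ
    open Site site

    isIn? : ∀ u → Dec (∃ λ i → u ≡ ι i)
    isIn? u = any? (λ i → u ≟ ι i)

    -- `False` makes the proof of lying outside irrelevant, so outside vertices are equal as soon as
    -- the underlying vertices are.
    O : Set
    O = Σ (Fin (n G)) λ u → False (isIn? u)

    out : ∀ u → (∀ i → u ≢ ι i) → O
    out u h = u , fromWitnessFalse (λ (i , e) → h i e)

    O-≡ : ∀ {u w : O} → proj₁ u ≡ proj₁ w → u ≡ w
    O-≡ {u , f} {.u , g} refl = cong (u ,_) (T-irrelevant f g)

    port : Fin r → O
    port p = out (π p) (λ i e → ι≢π i p (sym e))

    port-injective : ∀ {p q} → port p ≡ port q → p ≡ q
    port-injective e = π-inj (cong proj₁ e)

    port? : ∀ o → Dec (∃ λ p → o ≡ port p)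
    port? o with any? (λ p → proj₁ o ≟ π p)
    ... | yes (p , e) = yes (p , O-≡ e)
    ... | no h        = no λ (p , e) → h (p , cong proj₁ e)

    o₀ : O
    o₀ = out x₀ x₀≢ι

    o₀-no-port : ∀ p → o₀ ≢ port p
    o₀-no-port p e = x₀≢π p (cong proj₁ e)

    oR : O → O → Set
    oR u w = Adj G (proj₁ u) (proj₁ w)

    open Cells O port port-injective o₀

    classifyBy : ∀ u → Dec (∃ λ i → u ≡ ι i) → O ⊎ Fin k
    classifyBy u (yes (i , _)) = inj₂ i
    classifyBy u (no h)        = inj₁ (out u (λ i e → h (i , e)))

    classify : Fin (n G) → O ⊎ Fin k
    classify u = classifyBy u (isIn? u)

    classify-ι : ∀ i → classify (ι i) ≡ inj₂ i
    classify-ι i with isIn? (ι i)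
    ... | yes (j , e) = cong inj₂ (sym (ι-inj e))
    ... | no h        = contradiction (i , refl) h

    classify-out : ∀ o → classify (proj₁ o) ≡ inj₁ o
    classify-out o = help (isIn? (proj₁ o))
      where
      help : ∀ d → classifyBy (proj₁ o) d ≡ inj₁ o
      help (yes e) = contradiction e (toWitnessFalse (proj₂ o))
      help (no h)  = cong inj₁ (O-≡ refl)

    module _ (δ : ℕ) where

      -- One change of coordinates serves both graphs: `δ` = 0 gives `G`, and in general the new
      -- cells are put in front, so that every old vertex, old cells included, keeps its index up to
      -- a shift.
      view : Fin (δ + n G) → O ⊎ Fin (δ + k)
      view x = [ (λ a → inj₂ (a ↑ˡ k)) , (λ u → Sum.map₂ (δ ↑ʳ_) (classify u)) ]′ (splitAt δ x)

      cell : Fin (δ + k) → Fin (δ + n G)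
      cell a = [ _↑ˡ n G , (λ i → δ ↑ʳ ι i) ]′ (splitAt δ a)

      unview : O ⊎ Fin (δ + k) → Fin (δ + n G)
      unview (inj₁ (u , _)) = δ ↑ʳ u
      unview (inj₂ a)       = cell a

      view-out : ∀ o → view (δ ↑ʳ proj₁ o) ≡ inj₁ o
      view-out o rewrite splitAt-↑ʳ δ (n G) (proj₁ o) | classify-out o = refl

      view-cell : ∀ a → view (cell a) ≡ inj₂ a
      view-cell a with splitAt δ a in eq
      ... | inj₁ b rewrite splitAt-↑ˡ δ b (n G) = cong inj₂ (splitAt⁻¹-↑ˡ eq)
      ... | inj₂ i rewrite splitAt-↑ʳ δ (n G) (ι i) | classify-ι i = cong inj₂ (splitAt⁻¹-↑ʳ eq)

      view-unview : ∀ v → view (unview v) ≡ v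
      view-unview (inj₁ o) = view-out o
      view-unview (inj₂ a) = view-cell a

      unview-view : ∀ x → unview (view x) ≡ x
      unview-view x with splitAt δ x in eq
      ... | inj₁ b rewrite splitAt-↑ˡ δ b k = splitAt⁻¹-↑ˡ eq
      ... | inj₂ u with isIn? u
      ... | yes (i , refl) rewrite splitAt-↑ʳ δ k i = splitAt⁻¹-↑ʳ eq
      ... | no h           = splitAt⁻¹-↑ʳ eq

    cell-old : ∀ δ i → cell δ (δ ↑ʳ i) ≡ δ ↑ʳ ι i
    cell-old δ i rewrite splitAt-↑ʳ δ k i = refl

    cell-new : ∀ δ a → cell δ (a ↑ˡ k) ≡ a ↑ˡ n G
    cell-new δ a rewrite splitAt-↑ˡ δ a k = refl

    adjPort : ∀ {m} → Gadget r m → Fin m → O → Bool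
    adjPort K a o with port? o
    ... | yes (p , _) = pA K a p
    ... | no _        = false

    adj◎ : ∀ {m} → Gadget r m → O ⊎ Fin m → O ⊎ Fin m → Bool
    adj◎ K (inj₁ u) (inj₁ w) = adj G (proj₁ u) (proj₁ w)
    adj◎ K (inj₁ u) (inj₂ a) = adjPort K a u
    adj◎ K (inj₂ a) (inj₁ u) = adjPort K a u
    adj◎ K (inj₂ a) (inj₂ b) = kA K a b

    adjPort-port : ∀ {m} (K : Gadget r m) a p → adjPort K a (port p) ≡ pA K a p
    adjPort-port K a p with port? (port p)
    ... | yes (q , e) = cong (pA K a) (sym (port-injective e))
    ... | no h        = contradiction (p , refl) h

    adjPort⇒ : ∀ {m} (K : Gadget r m) a o → adjPort K a o ≡ true → ∃ λ p → o ≡ port p × pA K a p ≡ true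
    adjPort⇒ K a o e with port? o
    ... | yes (p , h) = p , h , e

    adj◎⇒ : ∀ {m} {K : Gadget r m} x y → adj◎ K x y ≡ true → Adj◎ oR K x y
    adj◎⇒ (inj₁ u) (inj₁ w) e = e
    adj◎⇒ (inj₁ u) (inj₂ a) e = adjPort⇒ _ a u e
    adj◎⇒ (inj₂ a) (inj₁ u) e = adjPort⇒ _ a u e
    adj◎⇒ (inj₂ a) (inj₂ b) e = e

    adj◎⇐ : ∀ {m} {K : Gadget r m} x y → Adj◎ oR K x y → adj◎ K x y ≡ true
    adj◎⇐ (inj₁ u) (inj₁ w) e = e
    adj◎⇐ {K = K} (inj₁ u) (inj₂ a) (p , refl , e) = ≡-trans (adjPort-port K a p) e
    adj◎⇐ {K = K} (inj₂ a) (inj₁ u) (p , refl , e) = ≡-trans (adjPort-port K a p) e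
    adj◎⇐ (inj₂ a) (inj₂ b) e = e

    adjPort-ι : ∀ i o → adj G (ι i) (proj₁ o) ≡ adjPort ⟦ t ⟧ i o
    adjPort-ι i o with port? o
    ... | yes (p , refl) = kp i p
    ... | no h with adj G (ι i) (proj₁ o) in eq
    ... | false = refl
    ... | true with closed i (proj₁ o) eq
    ... | inj₁ (j , e) = contradiction (j , e) (toWitnessFalse (proj₂ o))
    ... | inj₂ (p , e) = contradiction (p , O-≡ e) h

    adj-G : ∀ u w → adj G u w ≡ adj◎ ⟦ t ⟧ (view 0 u) (view 0 w)
    adj-G u w with isIn? u | isIn? w
    ... | yes (i , refl) | yes (j , refl) = kk i j
    ... | yes (i , refl) | no h           = adjPort-ι i (w , fromWitnessFalse h)
    ... | no h           | yes (j , refl) = ≡-trans (adj-sym G u (ι j)) (adjPort-ι j (u , fromWitnessFalse h))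
    ... | no _           | no _           = refl

    module Apply {δ} {t′ : Tables r (δ + k)} (rw : Rewrite {δ = δ} t τ t′) where
      open Rewrite rw

      private
        K′ = ⟦ t′ ⟧
        view′ = view δ
        unview′ = unview δ

      adj◎-sym : ∀ x y → adj◎ K′ x y ≡ adj◎ K′ y x
      adj◎-sym (inj₁ u) (inj₁ w) = adj-sym G _ _
      adj◎-sym (inj₁ u) (inj₂ a) = refl
      adj◎-sym (inj₂ a) (inj₁ u) = refl
      adj◎-sym (inj₂ a) (inj₂ b) = kA′-sym a b

      adj◎-irr : ∀ x → adj◎ K′ x x ≡ false
      adj◎-irr (inj₁ u) = adj-irr G _
      adj◎-irr (inj₂ a) = kA′-irr a

      G′ : Graph
      G′ = record
        { n = δ + n G
        ; adj = λ x y → adj◎ K′ (view′ x) (view′ y)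
        ; adj-sym = λ x y → adj◎-sym (view′ x) (view′ y)
        ; adj-irr = λ x → adj◎-irr (view′ x) }

      Adj⇒ : ∀ {u w} → Adj G u w → Adj◎ oR ⟦ t ⟧ (view 0 u) (view 0 w)
      Adj⇒ {u} {w} e = adj◎⇒ (view 0 u) (view 0 w) (≡-trans (sym (adj-G u w)) e)

      Adj⇐ : ∀ {x y} → Adj◎ oR ⟦ t ⟧ x y → Adj G (unview 0 x) (unview 0 y)
      Adj⇐ {x} {y} e = ≡-trans (adj-G (unview 0 x) (unview 0 y))
        (adj◎⇐ (view 0 (unview 0 x)) (view 0 (unview 0 y)) (subst₂ (Adj◎ oR ⟦ t ⟧) (sym (view-unview 0 x)) (sym (view-unview 0 y)) e))

      Adj′⇒ : ∀ {x y} → Adj G′ x y → Adj◎ oR K′ (view′ x) (view′ y)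
      Adj′⇒ {x} {y} e = adj◎⇒ (view′ x) (view′ y) e

      Adj′⇐ : ∀ {x y} → Adj◎ oR K′ x y → Adj G′ (unview′ x) (unview′ y)
      Adj′⇐ {x} {y} e = adj◎⇐ (view′ (unview′ x)) (view′ (unview′ y)) (subst₂ (Adj◎ oR K′) (sym (view-unview δ x)) (sym (view-unview δ y)) e)

      x₀-item : view 0 x₀ ≡ inj₁ o₀
      x₀-item = view-out 0 o₀

      items : List (O ⊎ Fin k)
      items = map (view 0) c

      items-ham : IsHam (Adj◎ oR ⟦ t ⟧) (inj₁ o₀) items
      items-ham = subst (λ x → IsHam (Adj◎ oR ⟦ t ⟧) x items) x₀-item
        (isHam-map (view 0) (unview 0) (view-unview 0) (unview-view 0) Adj⇒ ham)

      ρ-list : List (Fin k)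
      ρ-list = proj₁ ρ ∷ proj₂ ρ

      ρ-items : List (O ⊎ Fin k)
      ρ-items = map inj₂ ρ-list

      items-steps : Links (Step (inj₁ o₀) items (inj₁ o₀)) (inj₁ (port p₀)) (map inj₂ ρ-list) (inj₁ (port q₀))
      items-steps = subst₂ (λ a b → Links (Step (inj₁ o₀) items (inj₁ o₀)) a (map inj₂ ρ-list) b) (view-out 0 (port p₀)) (view-out 0 (port q₀))
        (subst (λ l → Links (Step (inj₁ o₀) items (inj₁ o₀)) (view 0 (π p₀)) l (view 0 (π q₀)))
          (≡-trans (sym (map-∘ ρ-list)) (map-cong (view-cell 0) ρ-list))
          (links-map⁺ (view 0) (map ι ρ-list) (links-map (λ {u} {v} s → subst (λ x → Step x items x (view 0 u) (view 0 v)) x₀-item (step-map (view 0) c s)) (map ι ρ-list) steps)))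

      outs-only : (l : List (O ⊎ Fin k)) → (∀ a → inj₂ a ∉ l) → ∃ λ os → l ≡ map inj₁ os
      outs-only []           h = [] , refl
      outs-only (inj₁ o ∷ l) h = let os , e = outs-only l (λ a m → h a (there m)) in o ∷ os , cong (inj₁ o ∷_) e
      outs-only (inj₂ a ∷ l) h = contradiction (here refl) (h a)

      moves : ∀ {u ps} (os : List O) {w} → Skeleton w ps → Skeleton u ps
      moves []       {w} s = move w s
      moves (o ∷ os) s = move o (moves os s)

      moves-flatten : ∀ {m u ps} (os : List O) {w} (s : Skeleton w ps) (rs : Runs m ps) →
        flatten (moves {u} os s) rs ≡ map inj₁ os ++ inj₁ w ∷ flatten s rs
      moves-flatten []       s rs = refl
      moves-flatten (o ∷ os) s rs = cong (inj₁ o ∷_) (moves-flatten os s rs)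

      ending : ∀ {u} → List O → Skeleton u []
      ending []       = stop
      ending (o ∷ os) = move o (ending os)

      ending-flatten : ∀ {m} {u : O} os → flatten {m} (ending {u} os) [] ≡ map inj₁ os
      ending-flatten []       = refl
      ending-flatten (o ∷ os) = cong (inj₁ o ∷_) (ending-flatten os)

      -- By `ρ-covers` the run uses up all cells. By uniqueness none is left for `pre` or `post`,
      -- and the skeleton has exactly one run.
      decompose : ∀ pre post → items ≡ pre ++ inj₁ (port p₀) ∷ ρ-items ++ inj₁ (port q₀) ∷ post →
        Σ (Skeleton o₀ ((p₀ , q₀) ∷ [])) λ s → items ≡ flatten s (ρ ∷ [])
      decompose pre post e = skel , eq
        where
        tail₁ tail₂ : List (O ⊎ Fin k)
        tail₂ = inj₁ (port q₀) ∷ post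
        tail₁ = inj₁ (port p₀) ∷ ρ-items ++ tail₂
        un : Unique (pre ++ tail₁)
        un = subst Unique e (unique-tail (IsHam.unique items-ham))
        a∈ρ : ∀ a → inj₂ a ∈ ρ-items
        a∈ρ a = ∈-map⁺ inj₂ (covers⇒∈ ρ-list ρ-covers a)
        front : ∃ λ os → pre ≡ map inj₁ os
        front = outs-only pre λ a m → absurd a (∈-∃++ m)
          where
          absurd : ∀ a → (∃₂ λ ys zs → pre ≡ ys ++ inj₂ a ∷ zs) → ⊥
          absurd a (ys , zs , e) = proj₂ (unique-middle ys (subst Unique (≡-trans (cong (_++ tail₁) e) (++-assoc ys (inj₂ a ∷ zs) tail₁)) un))
            (∈-++⁺ʳ zs (there (∈-++⁺ˡ (a∈ρ a))))
        un₂ : Unique (ρ-items ++ tail₂)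
        un₂ = unique-tail (proj₂ (unique-++⁻ pre un))
        back : ∃ λ os → post ≡ map inj₁ os
        back = outs-only post λ a m → absurd a m (∈-∃++ (a∈ρ a))
          where
          absurd : ∀ a → inj₂ a ∈ post → (∃₂ λ ys zs → ρ-items ≡ ys ++ inj₂ a ∷ zs) → ⊥
          absurd a m (ys , zs , e) = proj₂ (unique-middle ys (subst Unique (≡-trans (cong (_++ tail₂) e) (++-assoc ys (inj₂ a ∷ zs) tail₂)) un₂))
            (∈-++⁺ʳ zs (there m))
        skel₁ : Skeleton (port p₀) ((p₀ , q₀) ∷ [])
        skel₁ = run p₀ q₀ refl (ending (proj₁ back))
        skel : Skeleton o₀ ((p₀ , q₀) ∷ [])
        skel = moves (proj₁ front) skel₁
        eq : items ≡ flatten skel (ρ ∷ [])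
        eq = ≡-trans e (≡-trans (cong₂ (λ a b → a ++ inj₁ (port p₀) ∷ ρ-items ++ inj₁ (port q₀) ∷ b) (proj₂ front)
            (≡-trans (proj₂ back) (sym (ending-flatten {k} {port q₀} (proj₁ back)))))
          (sym (moves-flatten {k} {o₀} (proj₁ front) skel₁ (ρ ∷ []))))

      skeleton : Σ (Skeleton o₀ ((p₀ , q₀) ∷ [])) λ s → items ≡ flatten s (ρ ∷ [])
      skeleton = go (steps-split items (inj₁ (port p₀)) ρ-items (inj₁ (port q₀)) (IsHam.unique items-ham)
        (λ m → case ∈-map⁻ inj₂ m of λ { (_ , _ , ()) }) (λ e → o₀-no-port q₀ (sym (inj₁-injective e))) items-steps)
        where
        go : (∃₂ λ pre post → inj₁ o₀ ∷ items ≡ pre ++ inj₁ (port p₀) ∷ ρ-items ++ inj₁ (port q₀) ∷ post) →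
          Σ (Skeleton o₀ ((p₀ , q₀) ∷ [])) λ s → items ≡ flatten s (ρ ∷ [])
        go ([] , post , e)      = contradiction (inj₁-injective (proj₁ (∷-injective e))) (o₀-no-port p₀)
        go (x ∷ pre , post , e) = decompose pre post (proj₂ (∷-injective e))

      skel = proj₁ skeleton

      module R = Replace t t′ p₀ q₀ ρ ρ′ o₀-no-port oR sim ρ-path ρ′-span skel

      hamR : IsHam (Adj◎ oR ⟦ t ⟧) (inj₁ o₀) R.c
      hamR = subst (IsHam (Adj◎ oR ⟦ t ⟧) (inj₁ o₀)) (proj₂ skeleton) items-ham

      uniqR : ∀ zs → IsHam (Adj◎ oR ⟦ t ⟧) (inj₁ o₀) zs → Links (SymStep (inj₁ o₀) R.c (inj₁ o₀)) (inj₁ o₀) zs (inj₁ o₀)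
      uniqR zs h = subst (λ l → Links (SymStep (inj₁ o₀) l (inj₁ o₀)) (inj₁ o₀) zs (inj₁ o₀)) (proj₂ skeleton)
        (subst₂ (λ a l → Links (SymStep a items a) a l a) x₀-item
          (≡-trans (sym (map-∘ zs)) (≡-trans (map-cong (view-unview 0) zs) (map-id zs)))
          (links-map⁺ (view 0) (map (unview 0) zs)
            (links-map (λ {u} {v} → symStep-map (view 0) x₀ c x₀ u v) (map (unview 0) zs)
              (uniq (map (unview 0) zs) (isHam-map (unview 0) (view 0) (unview-view 0) (view-unview 0) (λ {x} {y} → Adj⇐ {x} {y}) h)))))

      c′ : List (Fin (δ + n G))
      c′ = map unview′ R.c′

      S′ : State
      S′ = record
        { G = G′
        ; x₀ = δ ↑ʳ x₀
        ; c = c′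
        ; ham = isHam-map unview′ view′ (unview-view δ) (view-unview δ) (λ {x} {y} → Adj′⇐ {x} {y}) (R.ham′ hamR)
        ; uniq = λ ys h → subst (λ l → Links (SymStep (δ ↑ʳ x₀) c′ (δ ↑ʳ x₀)) (δ ↑ʳ x₀) l (δ ↑ʳ x₀))
            (≡-trans (sym (map-∘ ys)) (≡-trans (map-cong (unview-view δ) ys) (map-id ys)))
            (links-map⁺ unview′ (map view′ ys) (links-map (λ {u} {v} → symStep-map unview′ (inj₁ o₀) R.c′ (inj₁ o₀) u v) (map view′ ys)
              (R.uniq′ hamR uniqR (map view′ ys) (subst (λ x → IsHam (Adj◎ oR K′) x (map view′ ys)) (view-out δ o₀)
                (isHam-map view′ unview′ (view-unview δ) (unview-view δ) (λ {x} {y} → Adj′⇒ {x} {y}) h)))))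
        ; conn = connected₃-map unview′ view′ (unview-view δ) (view-unview δ) (λ {x} {y} → Adj′⇐ {x} {y})
            (Separation.connected′ t t′ O port port-injective o₀ oR (λ e → ≡-trans (adj-sym G _ _) e) kA′-sym port? p₀ ch₁ ch₂ pres
              (connected₃-map (view 0) (unview 0) (view-unview 0) (unview-view 0) Adj⇒ conn)) }

-- What a replacement does to degrees and to other sites.

module Effects where
  open Cycles
  open Gadgets
  open Traces
  open Cuts
  open Rewriting
  open import Data.Nat.Properties using (+-comm; ≡ᵇ⇒≡)
  open import Data.Fin using (splitAt)
  open import Data.Fin.Subset using (∣_∣)
  open import Data.Fin.Properties using (splitAt-↑ʳ; splitAt⁻¹-↑ˡ; splitAt⁻¹-↑ʳ; ↑ʳ-injective)
  open import Data.Sum.Properties using (inj₂-injective)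
  open import Data.List.Properties using (length-++; length-map; map-∘)
  open import Data.List.Relation.Unary.All using ([]; _∷_)
  open import Data.Vec using (lookup; tabulate)

  bit : Bool → ℕ
  bit true  = 1
  bit false = 0

  cnt : ∀ {m} → (Fin m → Bool) → ℕ
  cnt {zero}  f = 0
  cnt {suc m} f = bit (f zero) + cnt (f ∘ suc)

  ∣tabulate∣ : ∀ {m} (f : Fin m → Bool) → ∣ tabulate f ∣ ≡ cnt f
  ∣tabulate∣ {zero}  f = refl
  ∣tabulate∣ {suc m} f with f zero
  ... | true  = cong suc (∣tabulate∣ (f ∘ suc))
  ... | false = ∣tabulate∣ (f ∘ suc)

  cnt-cong : ∀ {m} {f g : Fin m → Bool} → (∀ i → f i ≡ g i) → cnt f ≡ cnt g
  cnt-cong {zero}  h = refl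
  cnt-cong {suc m} h = cong₂ _+_ (cong bit (h zero)) (cnt-cong (h ∘ suc))

  cnt-const : ∀ m b → cnt {m} (λ _ → b) ≡ m * bit b
  cnt-const zero    b = refl
  cnt-const (suc m) b = cong (bit b +_) (cnt-const m b)

  cnt-++ : ∀ δ {m} (f : Fin (δ + m) → Bool) → cnt f ≡ cnt (λ a → f (a ↑ˡ m)) + cnt (λ u → f (δ ↑ʳ u))
  cnt-++ zero    f = refl
  cnt-++ (suc δ) f = ≡-trans (cong (bit (f zero) +_) (cnt-++ δ (f ∘ suc))) (sym (+-assoc (bit (f zero)) _ _))

  -- The additive form avoids subtraction. It compares degree counts that differ at the hub in
  -- `numDeg′`, and removes single neighbours of a path end in `degree-path`.
  cnt-change : ∀ {m} (f g : Fin m → Bool) u → (∀ i → i ≢ u → f i ≡ g i) → cnt f + bit (g u) ≡ cnt g + bit (f u)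
  cnt-change {suc m} f g zero h rewrite cnt-cong {f = f ∘ suc} {g ∘ suc} (λ i → h (suc i) (λ ())) = begin
    (bit (f zero) + cnt (g ∘ suc)) + bit (g zero) ≡⟨ +-comm _ (bit (g zero)) ⟩
    bit (g zero) + (bit (f zero) + cnt (g ∘ suc)) ≡⟨ cong (bit (g zero) +_) (+-comm (bit (f zero)) _) ⟩
    bit (g zero) + (cnt (g ∘ suc) + bit (f zero)) ≡⟨ +-assoc (bit (g zero)) _ _ ⟨
    (bit (g zero) + cnt (g ∘ suc)) + bit (f zero) ∎
    where open ≡-Reasoning
  cnt-change {suc m} f g (suc u) h rewrite h zero (λ ()) = begin
    (bit (g zero) + cnt (f ∘ suc)) + bit (g (suc u)) ≡⟨ +-assoc (bit (g zero)) _ _ ⟩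
    bit (g zero) + (cnt (f ∘ suc) + bit (g (suc u))) ≡⟨ cong (bit (g zero) +_) (cnt-change (f ∘ suc) (g ∘ suc) u (λ i i≢ → h (suc i) (λ { refl → i≢ refl }))) ⟩
    bit (g zero) + (cnt (g ∘ suc) + bit (f (suc u))) ≡⟨ +-assoc (bit (g zero)) _ _ ⟨
    (bit (g zero) + cnt (g ∘ suc)) + bit (f (suc u)) ∎
    where open ≡-Reasoning

  cnt-list : ∀ {m} (f : Fin m → Bool) xs → Unique xs → (∀ {x} → f x ≡ true → x ∈ xs) → (∀ {x} → x ∈ xs → f x ≡ true) →
    cnt f ≡ length xs
  cnt-list {m} f [] u h h′ = ≡-trans (cnt-cong allFalse) (≡-trans (cnt-const m false) (*-zeroʳ m))
    where
    allFalse : ∀ i → f i ≡ false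
    allFalse i with f i in eq
    ... | false = refl
    ... | true with () ← h eq
  cnt-list f (x ∷ xs) u h h′ = begin
    cnt f                ≡⟨ +-identityʳ (cnt f) ⟨
    cnt f + 0            ≡⟨ cong (λ b → cnt f + bit b) gx ⟨
    cnt f + bit (g x)    ≡⟨ cnt-change f g x (λ i i≢x → sym (g-else i i≢x)) ⟩
    cnt g + bit (f x)    ≡⟨ cong (λ b → cnt g + bit b) (h′ (here refl)) ⟩
    cnt g + 1            ≡⟨ +-comm (cnt g) 1 ⟩
    suc (cnt g)          ≡⟨ cong suc (cnt-list g xs (unique-tail u) toxs fromxs) ⟩
    suc (length xs)      ∎
    where
    open ≡-Reasoning
    g : _ → Bool
    g y = f y ∧ not (y == x)
    gx : g x ≡ false
    gx rewrite ==-refl x with f x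
    ... | true  = refl
    ... | false = refl
    g-else : ∀ i → i ≢ x → g i ≡ f i
    g-else i i≢x with i == x in eq
    ... | true  = contradiction (==⇒≡ i x eq) i≢x
    ... | false with f i
    ... | true  = refl
    ... | false = refl
    toxs : ∀ {y} → g y ≡ true → y ∈ xs
    toxs {y} e with h (proj₁ (∧-true e))
    ... | there m   = m
    ... | here refl = case ≡-trans (sym e) gx of λ ()
    fromxs : ∀ {y} → y ∈ xs → g y ≡ true
    fromxs {y} m = ≡-trans (g-else y (λ { refl → unique-head u m })) (h′ (there m))

  cubic? : ∀ {r k} → Tables r k → Bool
  cubic? {k = k} t = every (λ a → distinct (lookup (inner t) a) ∧
    (distinct (lookup (outer t) a) ∧ (length (lookup (inner t) a) + length (lookup (outer t) a) ≡ᵇ 3))) (allFin k)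

  module Degrees (S : State) {r k} {t : Tables r k} {τ : Trail r k} (site : Site S t τ) where
    open State S
    open Site site
    open Surgery S site

    row : ∀ δ (t′ : Tables r (δ + k)) → cubic? t′ ≡ true → ∀ a → cnt (λ y → adj◎ ⟦ t′ ⟧ (inj₂ a) (view δ y)) ≡ 3
    row δ t′ cub a = ≡-trans (cnt-list f nbrs (Unique.++⁺ uₖ uₚ disj) to from)
      (≡-trans (length-++ (map (cell δ) ks)) (≡-trans (cong₂ _+_ (length-map (cell δ) ks) (length-map _ ps)) (≡ᵇ⇒≡ _ 3 (subst Data.Bool.T (sym e₃) _))))
      where
      f = λ y → adj◎ ⟦ t′ ⟧ (inj₂ a) (view δ y)
      ks = lookup (inner t′) a
      ps = lookup (outer t′) a
      hub : Fin r → Fin (δ + n G)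
      hub p = δ ↑ʳ π p
      nbrs = map (cell δ) ks ++ map hub ps
      ok = ∧-true {distinct ks} (every-lookup (λ a → distinct (lookup (inner t′) a) ∧
        (distinct (lookup (outer t′) a) ∧ (length (lookup (inner t′) a) + length (lookup (outer t′) a) ≡ᵇ 3))) cub (∈-allFin a))
      e₂₃ = ∧-true {distinct ps} (proj₂ ok)
      e₃ : (length ks + length ps ≡ᵇ 3) ≡ true
      e₃ = proj₂ e₂₃
      uₖ : Unique (map (cell δ) ks)
      uₖ = Unique.map⁺ (λ {b} {b′} e → inj₂-injective (≡-trans (sym (view-cell δ b)) (≡-trans (cong (view δ) e) (view-cell δ b′)))) (distinct⇒unique ks (proj₁ ok))
      uₚ : Unique (map hub ps)
      uₚ = Unique.map⁺ (λ e → π-inj (↑ʳ-injective δ _ _ e)) (distinct⇒unique ps (proj₁ e₂₃))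
      disj : ∀ {y} → ¬ (y ∈ map (cell δ) ks × y ∈ map hub ps)
      disj (m₁ , m₂) with ∈-map⁻ (cell δ) m₁ | ∈-map⁻ hub m₂
      ... | b , _ , refl | p , _ , e = case ≡-trans (sym (view-cell δ b)) (≡-trans (cong (view δ) e) (view-out δ (port p))) of λ ()
      to : ∀ {y} → f y ≡ true → y ∈ nbrs
      to {y} e with view δ y in eq
      ... | inj₂ b = ∈-++⁺ˡ (subst (_∈ map (cell δ) ks) (≡-trans (cong (unview δ) (sym eq)) (unview-view δ y)) (∈-map⁺ (cell δ) (elem⇒∈ b ks e)))
      ... | inj₁ o with adjPort⇒ ⟦ t′ ⟧ a o e
      ... | p , refl , pe = ∈-++⁺ʳ (map (cell δ) ks) (subst (_∈ map hub ps) (≡-trans (cong (unview δ) (sym eq)) (unview-view δ y)) (∈-map⁺ hub (elem⇒∈ p ps pe)))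
      from : ∀ {y} → y ∈ nbrs → f y ≡ true
      from m with ∈-++⁻ (map (cell δ) ks) m
      from m | inj₁ m₁ with ∈-map⁻ (cell δ) m₁
      ... | b , b∈ , refl rewrite view-cell δ b = ∈⇒elem b b∈
      from m | inj₂ m₂ with ∈-map⁻ hub m₂
      ... | p , p∈ , refl rewrite view-out δ (port p) = ≡-trans (adjPort-port ⟦ t′ ⟧ a p) (∈⇒elem p p∈)

    deg-ι : cubic? t ≡ true → ∀ i → deg G (ι i) ≡ 3
    deg-ι cub i = ≡-trans (∣tabulate∣ (adj G (ι i))) (≡-trans (cnt-cong λ y → ≡-trans (adj-G (ι i) y) (cong (λ v → adj◎ ⟦ t ⟧ v (view 0 y)) (view-cell 0 i))) (row 0 t cub i))

  -- Rewriting site₁, whose hub is the port g, leaves site₂ intact.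
  record Apart {S : State} {r₁ k₁} {t₁ : Tables r₁ k₁} {τ₁ : Trail r₁ k₁} (site₁ : Site S t₁ τ₁) (g : Fin r₁)
    {r₂ k₂} {t₂ : Tables r₂ k₂} {τ₂ : Trail r₂ k₂} (site₂ : Site S t₂ τ₂) : Set where
    private
      module S₁ = Site site₁
      module S₂ = Site site₂
    field
      ι-out : ∀ i j → S₂.ι i ≢ S₁.ι j
      ι-hub : ∀ i → S₂.ι i ≢ S₁.π g
      p-out : ∀ j → S₂.π (Trail.p₀ τ₂) ≢ S₁.ι j
      q-out : ∀ j → S₂.π (Trail.q₀ τ₂) ≢ S₁.ι j

  -- One vertex of degree `a` is traded for one of degree `b`. Degree 3 is exempt because every
  -- replacement also adds cubic vertices, whose number need not be tracked.
  Grown : State → State → ℕ → ℕ → Set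
  Grown S S′ a b = ∀ m → m ≢ 3 → numDeg (State.G S′) m + bit (a ≡ᵇ m) ≡ numDeg (State.G S) m + bit (b ≡ᵇ m)

  module Post (S : State) {r k} {t : Tables r k} {τ : Trail r k} (site : Site S t τ)
    {δ} {t′ : Tables r (δ + k)} (rw : Rewrite {δ = δ} t τ t′) where
    open State S
    open Trail τ
    open Site site
    open Rewrite rw
    open Surgery S site
    open Apply {t′ = t′} rw
    open Cells O port port-injective o₀

    private
      K′ = ⟦ t′ ⟧

    Out : Fin (n G) → Set
    Out u = ∀ i → u ≢ ι i

    lift : Fin (n G) → Fin (δ + n G)
    lift u = δ ↑ʳ u

    new-or-old : ∀ y → (∃ λ a → y ≡ a ↑ˡ n G) ⊎ (∃ λ u → y ≡ lift u)
    new-or-old y with splitAt δ y in eq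
    ... | inj₁ a = inj₁ (a , sym (splitAt⁻¹-↑ˡ eq))
    ... | inj₂ u = inj₂ (u , sym (splitAt⁻¹-↑ʳ eq))

    adjPort-keep : ∀ i o → adjPort K′ (δ ↑ʳ i) o ≡ adjPort ⟦ t ⟧ i o
    adjPort-keep i o with port? o
    ... | yes (p , _) = keep i p
    ... | no _        = refl

    adj-lift : ∀ u w → Out u → adj G′ (lift u) (lift w) ≡ adj G u w
    adj-lift u w h rewrite view-out δ (out u h) with isIn? w
    ... | yes (i , refl) rewrite splitAt-↑ʳ δ (n G) (ι i) | classify-ι i =
      ≡-trans (adjPort-keep i (out u h)) (≡-trans (sym (adjPort-ι i (out u h))) (adj-sym G (ι i) u))
    ... | no h′ = cong (adj◎ K′ (inj₁ (out u h))) (view-out δ (out w (λ i e → h′ (i , e))))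

    adj-lift-new : ∀ u a (h : Out u) → adj G′ (lift u) (a ↑ˡ n G) ≡ adjPort K′ (a ↑ˡ k) (out u h)
    adj-lift-new u a h = cong₂ (adj◎ K′) (view-out δ (out u h))
      (≡-trans (cong (view δ) (sym (cell-new δ a))) (view-cell δ (a ↑ˡ k)))

    adj-no-new : ∀ u a → Out u → u ≢ π g → adj G′ (lift u) (a ↑ˡ n G) ≡ false
    adj-no-new u a h u≢g = ≡-trans (adj-lift-new u a h) go
      where
      go : adjPort K′ (a ↑ˡ k) (out u h) ≡ false
      go with port? (out u h)
      ... | yes (p , e) = grow a p (λ { refl → u≢g (cong proj₁ e) })
      ... | no _        = refl

    adj-cells : ∀ a b → adj G′ (cell δ a) (cell δ b) ≡ kA K′ a b
    adj-cells a b = cong₂ (adj◎ K′) (view-cell δ a) (view-cell δ b)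

    adj-cell-port : ∀ a p → adj G′ (cell δ a) (lift (π p)) ≡ pA K′ a p
    adj-cell-port a p = ≡-trans (cong₂ (adj◎ K′) (view-cell δ a) (view-out δ (port p))) (adjPort-port K′ a p)

    Local : Set
    Local = Fin (δ + k) ⊎ Fin r

    loc : Local → Fin (δ + n G)
    loc (inj₁ a) = cell δ a
    loc (inj₂ p) = lift (π p)

    item : Local → O ⊎ Fin (δ + k)
    item (inj₁ a) = inj₂ a
    item (inj₂ p) = inj₁ (port p)

    view-loc : ∀ l → view δ (loc l) ≡ item l
    view-loc (inj₁ a) = view-cell δ a
    view-loc (inj₂ p) = view-out δ (port p)

    loc-inj : ∀ l m → loc l ≡ loc m → l ≡ m
    loc-inj l m e = item-inj l m (≡-trans (sym (view-loc l)) (≡-trans (cong (view δ) e) (view-loc m)))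
      where
      item-inj : ∀ l m → item l ≡ item m → l ≡ m
      item-inj (inj₁ a) (inj₁ b) e = cong inj₁ (inj₂-injective e)
      item-inj (inj₂ p) (inj₂ q) e = cong inj₂ (port-injective (inj₁-injective e))

    adjLocal : Fin (δ + k) → Local → Bool
    adjLocal a (inj₁ b) = kA K′ a b
    adjLocal a (inj₂ p) = pA K′ a p

    adj-local : ∀ a l → adj G′ (cell δ a) (loc l) ≡ adjLocal a l
    adj-local a (inj₁ b) = adj-cells a b
    adj-local a (inj₂ p) = adj-cell-port a p

    adj-closed : ∀ a y → adj G′ (cell δ a) y ≡ true → ∃ λ l → y ≡ loc l × adjLocal a l ≡ true
    adj-closed a y e with ≡-trans (sym (cong (λ v → adj◎ K′ v (view δ y)) (view-cell δ a))) e | unview-view δ y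
    ... | e′ | u with view δ y
    ... | inj₂ b = inj₁ b , sym u , e′
    ... | inj₁ o with adjPort⇒ K′ a o e′
    ... | p , refl , pe = inj₂ p , sym u , pe

    lift≢cell : ∀ u → Out u → ∀ a → lift u ≢ cell δ a
    lift≢cell u h a e = case ≡-trans (sym (view-out δ (out u h))) (≡-trans (cong (view δ) e) (view-cell δ a)) of λ ()

    run-steps : Links (Step (lift x₀) c′ (lift x₀)) (loc (inj₂ p₀)) (map (loc ∘ inj₁) (proj₁ ρ′ ∷ proj₂ ρ′)) (loc (inj₂ q₀))
    run-steps = subst (λ l → Links (Step (lift x₀) c′ (lift x₀)) (loc (inj₂ p₀)) l (loc (inj₂ q₀))) (sym (map-∘ (proj₁ ρ′ ∷ proj₂ ρ′)))
      (links-map⁺ (unview δ) {x = inj₁ (port p₀)} (map inj₂ (proj₁ ρ′ ∷ proj₂ ρ′)) {z = inj₁ (port q₀)}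
        (links-map (λ {u} {v} s → step-map (unview δ) R.c′ {inj₁ o₀} s) (map inj₂ (proj₁ ρ′ ∷ proj₂ ρ′)) (run-links skel ρ′)))

    step-lift : ∀ {u w} → Out u → Out w → Step x₀ c x₀ u w → Step (lift x₀) c′ (lift x₀) (lift u) (lift w)
    step-lift {u} {w} hu hw s = step-map (unview δ) R.c′ {inj₁ o₀} {inj₁ (out u hu)} {inj₁ (out w hw)}
      (step-outs skel (ρ ∷ []) (ρ′ ∷ []) (subst (λ l → Step (inj₁ o₀) l (inj₁ o₀) (inj₁ (out u hu)) (inj₁ (out w hw))) (proj₂ skeleton)
        (subst₂ (Step (inj₁ o₀) items (inj₁ o₀)) (view-out 0 (out u hu)) (view-out 0 (out w hw))
          (subst (λ x → Step x items x (view 0 u) (view 0 w)) x₀-item (step-map (view 0) c s)))))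

    -- A gadget `t₂` found inside the new gadget. Its cells are cells of `t′`, but its ports may be
    -- cells or ports of `t′`. All conditions are local, so they hold in whatever graph surrounds
    -- it.
    record Subsite {r₂ k₂} (t₂ : Tables r₂ k₂) (τ₂ : Trail r₂ k₂) : Set where
      open Trail τ₂ renaming (p₀ to p₂; q₀ to q₂; ρ to ρ₂)
      field
        e     : Fin k₂ → Fin (δ + k)
        f     : Fin r₂ → Local
        e-inj : ∀ i j → e i ≡ e j → i ≡ j
        f-inj : ∀ p q → f p ≡ f q → p ≡ q
        e≢f   : ∀ i p → inj₁ (e i) ≢ f p
        kk₂   : ∀ i j → kA K′ (e i) (e j) ≡ kA ⟦ t₂ ⟧ i j
        kp₂   : ∀ i p → adjLocal (e i) (f p) ≡ pA ⟦ t₂ ⟧ i p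
        cl-k  : ∀ i b → kA K′ (e i) b ≡ true → (∃ λ j → b ≡ e j) ⊎ (∃ λ p → inj₁ b ≡ f p)
        cl-p  : ∀ i q → pA K′ (e i) q ≡ true → ∃ λ p → inj₂ q ≡ f p
        run₂  : Links (Step (inj₂ p₀) (map inj₁ (proj₁ ρ′ ∷ proj₂ ρ′)) (inj₂ q₀)) (f p₂) (map (inj₁ ∘ e) (proj₁ ρ₂ ∷ proj₂ ρ₂)) (f q₂)

    subsite : ∀ {r₂ k₂} {t₂ : Tables r₂ k₂} {τ₂ : Trail r₂ k₂} → Subsite t₂ τ₂ → Site S′ t₂ τ₂
    subsite {τ₂ = trail p₂ q₂ ρ₂} sub = record
      { ι = cell δ ∘ e
      ; π = loc ∘ f
      ; ι-inj = λ {i} {j} h → e-inj i j (inj₁-injective (loc-inj (inj₁ (e i)) (inj₁ (e j)) h))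
      ; π-inj = λ {p} {q} h → f-inj p q (loc-inj (f p) (f q) h)
      ; ι≢π = λ i p h → e≢f i p (loc-inj (inj₁ (e i)) (f p) h)
      ; kk = λ i j → ≡-trans (adj-cells (e i) (e j)) (kk₂ i j)
      ; kp = λ i p → ≡-trans (adj-local (e i) (f p)) (kp₂ i p)
      ; closed = λ i u h → closed₂ i u (adj-closed (e i) u h)
      ; x₀≢ι = λ i → lift≢cell x₀ x₀≢ι (e i)
      ; x₀≢π = λ p → x₀≢loc (f p)
      ; steps = subst (λ l → Links (Step (lift x₀) c′ (lift x₀)) (loc (f p₂)) l (loc (f q₂))) (sym (map-∘ (proj₁ ρ₂ ∷ proj₂ ρ₂)))
          (links-map⁺ loc {x = f p₂} (map (inj₁ ∘ e) (proj₁ ρ₂ ∷ proj₂ ρ₂)) {z = f q₂} (links-map toStep (map (inj₁ ∘ e) (proj₁ ρ₂ ∷ proj₂ ρ₂)) run₂)) }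
      where
      open Subsite sub
      main = map inj₁ (proj₁ ρ′ ∷ proj₂ ρ′)
      toStep : ∀ {u v} → Step (inj₂ p₀) main (inj₂ q₀) u v → Step (lift x₀) c′ (lift x₀) (loc u) (loc v)
      toStep {u} {v} s = links-lookup (map loc main) {loc (inj₂ q₀)}
        (subst (λ l → Links (Step (lift x₀) c′ (lift x₀)) (loc (inj₂ p₀)) l (loc (inj₂ q₀))) (map-∘ (proj₁ ρ′ ∷ proj₂ ρ′)) run-steps)
        (step-map loc main s)
      closed₂ : ∀ i u → (∃ λ l → u ≡ loc l × adjLocal (e i) l ≡ true) → (∃ λ j → u ≡ cell δ (e j)) ⊎ (∃ λ p → u ≡ loc (f p))
      closed₂ i u (inj₁ b , refl , h) = Sum.map (λ { (j , refl) → j , refl }) (λ (p , h′) → p , cong loc h′) (cl-k i b h)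
      closed₂ i u (inj₂ q , refl , h) = let p , h′ = cl-p i q h in inj₂ (p , cong loc h′)
      x₀≢loc : ∀ l → lift x₀ ≢ loc l
      x₀≢loc (inj₁ a) = lift≢cell x₀ x₀≢ι a
      x₀≢loc (inj₂ p) h = x₀≢π p (↑ʳ-injective δ _ _ h)

    -- The cells of the other site lie outside the rewritten gadget and are not its hub, so no edge
    -- at them changes. Its ports may be old cells, except for the two ends of its run, because the
    -- steps of the cycle there must survive.
    persist : ∀ {r₂ k₂} {t₂ : Tables r₂ k₂} {τ₂ : Trail r₂ k₂} (site₂ : Site S t₂ τ₂) → Apart site g site₂ → Site S′ t₂ τ₂
    persist {τ₂ = trail p₂ q₂ ρ₂} site₂ ap = record
      { ι = lift ∘ S₂.ι
      ; π = lift ∘ S₂.π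
      ; ι-inj = λ h → S₂.ι-inj (↑ʳ-injective δ _ _ h)
      ; π-inj = λ h → S₂.π-inj (↑ʳ-injective δ _ _ h)
      ; ι≢π = λ i p h → S₂.ι≢π i p (↑ʳ-injective δ _ _ h)
      ; kk = λ i j → ≡-trans (adj-lift (S₂.ι i) (S₂.ι j) (ι-out i)) (S₂.kk i j)
      ; kp = λ i p → ≡-trans (adj-lift (S₂.ι i) (S₂.π p) (ι-out i)) (S₂.kp i p)
      ; closed = closed₂
      ; x₀≢ι = λ i h → S₂.x₀≢ι i (↑ʳ-injective δ _ _ h)
      ; x₀≢π = λ p h → S₂.x₀≢π p (↑ʳ-injective δ _ _ h)
      ; steps = subst (λ l → Links (Step (lift x₀) c′ (lift x₀)) (lift (S₂.π p₂)) l (lift (S₂.π q₂))) (sym (map-∘ (proj₁ ρ₂ ∷ proj₂ ρ₂)))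
          (links-map⁺ lift (map S₂.ι (proj₁ ρ₂ ∷ proj₂ ρ₂)) (steps₂ (proj₁ ρ₂) (proj₂ ρ₂) p-out S₂.steps)) }
      where
      open Apart ap
      module S₂ = Site site₂
      closed₂ : ∀ i y → adj G′ (lift (S₂.ι i)) y ≡ true → (∃ λ j → y ≡ lift (S₂.ι j)) ⊎ (∃ λ p → y ≡ lift (S₂.π p))
      closed₂ i y h with new-or-old y
      ... | inj₁ (a , refl) = contradiction (≡-trans (sym (adj-no-new (S₂.ι i) a (ι-out i) (ι-hub i))) h) λ ()
      ... | inj₂ (w , refl) with S₂.closed i w (≡-trans (sym (adj-lift (S₂.ι i) w (ι-out i))) h)
      ... | inj₁ (j , refl) = inj₁ (j , refl)
      ... | inj₂ (p , refl) = inj₂ (p , refl)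
      Lifted : Fin (n G) → Fin (n G) → Set
      Lifted u w = Step (lift x₀) c′ (lift x₀) (lift u) (lift w)
      steps₂ : ∀ a as {u} → Out u → Links (Step x₀ c x₀) u (map S₂.ι (a ∷ as)) (S₂.π q₂) → Links Lifted u (map S₂.ι (a ∷ as)) (S₂.π q₂)
      steps₂ a []       hu (s , s′) = step-lift hu (ι-out a) s , step-lift (ι-out a) q-out s′
      steps₂ a (b ∷ bs) hu (s , l)  = step-lift hu (ι-out a) s , steps₂ b bs (ι-out a) l

    module _ {r₁ k₁} {t₁ : Tables r₁ k₁} {τ₁ : Trail r₁ k₁} (sub : Subsite t₁ τ₁) (g₁ : Fin r₁) where

      apart-sub : Subsite.f sub g₁ ≡ inj₂ g → ∀ {r₂ k₂} {t₂ : Tables r₂ k₂} {τ₂ : Trail r₂ k₂} (site₂ : Site S t₂ τ₂)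
        (ap : Apart site g site₂) → Apart (subsite sub) g₁ (persist site₂ ap)
      apart-sub fg site₂ ap = record
        { ι-out = λ i j → lift≢cell _ (ι-out i) (Subsite.e sub j)
        ; ι-hub = λ i h → ι-hub i (↑ʳ-injective δ _ _ (≡-trans h (cong loc fg)))
        ; p-out = λ j → lift≢cell _ p-out (Subsite.e sub j)
        ; q-out = λ j → lift≢cell _ q-out (Subsite.e sub j) }
        where open Apart ap

      apart-subs : ∀ {r₂ k₂} {t₂ : Tables r₂ k₂} {τ₂ : Trail r₂ k₂} (sub₂ : Subsite t₂ τ₂) →
        (∀ i j → Subsite.e sub₂ i ≢ Subsite.e sub j) → (∀ i → inj₁ (Subsite.e sub₂ i) ≢ Subsite.f sub g₁) →
        (∀ j → Subsite.f sub₂ (Trail.p₀ τ₂) ≢ inj₁ (Subsite.e sub j)) →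
        (∀ j → Subsite.f sub₂ (Trail.q₀ τ₂) ≢ inj₁ (Subsite.e sub j)) → Apart (subsite sub) g₁ (subsite sub₂)
      apart-subs sub₂ h₁ h₂ h₃ h₄ = record
        { ι-out = λ i j h → h₁ i j (inj₁-injective (loc-inj (inj₁ _) (inj₁ _) h))
        ; ι-hub = λ i h → h₂ i (loc-inj (inj₁ _) _ h)
        ; p-out = λ j h → h₃ j (loc-inj _ (inj₁ _) h)
        ; q-out = λ j h → h₄ j (loc-inj _ (inj₁ _) h) }

    apart-lift : ∀ {r₂ k₂ r₃ k₃} {t₂ : Tables r₂ k₂} {τ₂ : Trail r₂ k₂} {t₃ : Tables r₃ k₃} {τ₃ : Trail r₃ k₃} {g₂ : Fin r₂}
      (site₂ : Site S t₂ τ₂) (site₃ : Site S t₃ τ₃) (ap₂ : Apart site g site₂) (ap₃ : Apart site g site₃) →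
      Apart site₂ g₂ site₃ → Apart (persist site₂ ap₂) g₂ (persist site₃ ap₃)
    apart-lift site₂ site₃ ap₂ ap₃ ap = record
      { ι-out = λ i j h → ι-out i j (↑ʳ-injective δ _ _ h)
      ; ι-hub = λ i h → ι-hub i (↑ʳ-injective δ _ _ h)
      ; p-out = λ j h → p-out j (↑ʳ-injective δ _ _ h)
      ; q-out = λ j h → q-out j (↑ʳ-injective δ _ _ h) }
      where open Apart ap

    module Counting (cub : cubic? t ≡ true) (cub′ : cubic? t′ ≡ true) where
      open Degrees S site

      deg-cell : ∀ a → deg G′ (cell δ a) ≡ 3
      deg-cell a = ≡-trans (∣tabulate∣ (adj G′ (cell δ a))) (≡-trans (cnt-cong λ y → cong (λ v → adj◎ K′ v (view δ y)) (view-cell δ a)) (row δ t′ cub′ a))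

      deg-new : ∀ a → deg G′ (a ↑ˡ n G) ≡ 3
      deg-new a = ≡-trans (cong (deg G′) (sym (cell-new δ a))) (deg-cell (a ↑ˡ k))

      deg-out : ∀ u (h : Out u) → deg G′ (lift u) ≡ cnt (λ a → adjPort K′ (a ↑ˡ k) (out u h)) + deg G u
      deg-out u h = ≡-trans (∣tabulate∣ (adj G′ (lift u))) (≡-trans (cnt-++ δ (adj G′ (lift u)))
        (cong₂ _+_ (cnt-cong (λ a → adj-lift-new u a h)) (≡-trans (cnt-cong (λ w → adj-lift u w h)) (sym (∣tabulate∣ (adj G u))))))

      growth : ℕ
      growth = cnt (λ a → pA K′ (a ↑ˡ k) g)

      deg-hub : deg G′ (lift (π g)) ≡ growth + deg G (π g)
      deg-hub = ≡-trans (deg-out (π g) (λ i e → ι≢π i g (sym e))) (cong (_+ deg G (π g)) (cnt-cong (λ a → adjPort-port K′ (a ↑ˡ k) g)))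

      deg-old : ∀ u → u ≢ π g → deg G′ (lift u) ≡ deg G u
      deg-old u u≢g with isIn? u
      ... | yes (i , refl) = ≡-trans (≡-trans (cong (deg G′) (sym (cell-old δ i))) (deg-cell (δ ↑ʳ i))) (sym (deg-ι cub i))
      ... | no h = ≡-trans (deg-out u h′) (cong (_+ deg G u) (≡-trans (cnt-cong (λ a → ≡-trans (sym (adj-lift-new u a h′)) (adj-no-new u a h′ u≢g))) (≡-trans (cnt-const δ false) (*-zeroʳ δ))))
        where
        h′ : Out u
        h′ i e = h (i , e)

      numDeg′ : ∀ m → numDeg G′ m + bit (deg G (π g) ≡ᵇ m) ≡ δ * bit (3 ≡ᵇ m) + (numDeg G m + bit (growth + deg G (π g) ≡ᵇ m))
      numDeg′ m = begin
        numDeg G′ m + b                                  ≡⟨ cong (_+ b) (∣tabulate∣ d′) ⟩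
        cnt d′ + b                                       ≡⟨ cong (_+ b) (cnt-++ δ d′) ⟩
        (cnt (λ a → d′ (a ↑ˡ n G)) + cnt (d′ ∘ lift)) + b ≡⟨ cong (λ z → (z + cnt (d′ ∘ lift)) + b) (≡-trans (cnt-cong (λ a → cong (_≡ᵇ m) (deg-new a))) (cnt-const δ (3 ≡ᵇ m))) ⟩
        (δ * bit (3 ≡ᵇ m) + cnt (d′ ∘ lift)) + b         ≡⟨ +-assoc (δ * bit (3 ≡ᵇ m)) _ b ⟩
        δ * bit (3 ≡ᵇ m) + (cnt (d′ ∘ lift) + b)         ≡⟨ cong (δ * bit (3 ≡ᵇ m) +_) (cnt-change (d′ ∘ lift) d (π g) (λ u u≢ → cong (_≡ᵇ m) (deg-old u u≢))) ⟩
        δ * bit (3 ≡ᵇ m) + (cnt d + bit (d′ (lift (π g)))) ≡⟨ cong₂ (λ x y → δ * bit (3 ≡ᵇ m) + (x + bit (y ≡ᵇ m))) (sym (∣tabulate∣ d)) deg-hub ⟩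
        δ * bit (3 ≡ᵇ m) + (numDeg G m + bit (growth + deg G (π g) ≡ᵇ m)) ∎
        where
        open ≡-Reasoning
        d : Fin (n G) → Bool
        d v = deg G v ≡ᵇ m
        d′ : Fin (δ + n G) → Bool
        d′ v = deg G′ v ≡ᵇ m
        b = bit (deg G (π g) ≡ᵇ m)

      grown : Grown S S′ (deg G (π g)) (growth + deg G (π g))
      grown m m≢3 = ≡-trans (numDeg′ m) (cong (_+ (numDeg G m + bit (growth + deg G (π g) ≡ᵇ m))) (zeroes m m≢3))
        where
        zeroes : ∀ m → m ≢ 3 → δ * bit (3 ≡ᵇ m) ≡ 0
        zeroes 0 _ = *-zeroʳ δ
        zeroes 1 _ = *-zeroʳ δ
        zeroes 2 _ = *-zeroʳ δ
        zeroes 3 h = contradiction refl h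
        zeroes (suc (suc (suc (suc m)))) _ = *-zeroʳ δ

-- The concrete gadgets and their four replacements.

module Fragments where
  open Gadgets
  open Cuts
  open Rewriting
  open import Data.Vec using ([]; _∷_; lookup)

  private variable
    A : Set

  -- A ladder consists of blocks with vertices a = 3i, b = 3i + 1, s = 3i + 2 and edges ab, as, s–hub; the
  -- vertices b, s of a block are joined to a, b of the next one.  The ports of ladder₂ and ladder₄ are
  -- 0 (before the first a and after the last s), 1 (before the first b), 2 (after the last b), 3 (hub);
  -- in ladder₃ and ladder₅ port 0 is split into 0 (after the last s) and 3 (before the first a), and the
  -- hub is port 4.  In an enlarged gadget the new vertices come first: ladder₄ and ladder₅ insert the
  -- blocks 0 and 1 behind the block 2.
  ladder₂ : Tables 4 6
  ladder₂ = tables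
      ((# 1 ∷ # 2 ∷ []) ∷ (# 0 ∷ # 3 ∷ []) ∷ (# 0 ∷ # 4 ∷ []) ∷ (# 1 ∷ # 4 ∷ # 5 ∷ []) ∷ (# 2 ∷ # 3 ∷ []) ∷
       (# 3 ∷ []) ∷ [])
      ((# 0 ∷ []) ∷ (# 1 ∷ []) ∷ (# 3 ∷ []) ∷ [] ∷ (# 2 ∷ []) ∷ (# 0 ∷ # 3 ∷ []) ∷ [])

  ladder₄ : Tables 4 12
  ladder₄ = tables
      ((# 1 ∷ # 2 ∷ # 7 ∷ []) ∷ (# 0 ∷ # 3 ∷ # 8 ∷ []) ∷ (# 0 ∷ # 4 ∷ []) ∷ (# 1 ∷ # 4 ∷ # 5 ∷ []) ∷
       (# 2 ∷ # 3 ∷ # 9 ∷ []) ∷ (# 3 ∷ # 10 ∷ []) ∷ (# 7 ∷ # 8 ∷ []) ∷ (# 0 ∷ # 6 ∷ []) ∷ (# 1 ∷ # 6 ∷ []) ∷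
       (# 4 ∷ # 10 ∷ # 11 ∷ []) ∷ (# 5 ∷ # 9 ∷ []) ∷ (# 9 ∷ []) ∷ [])
      ([] ∷ [] ∷ (# 3 ∷ []) ∷ [] ∷ [] ∷ (# 3 ∷ []) ∷ (# 0 ∷ []) ∷ (# 1 ∷ []) ∷ (# 3 ∷ []) ∷ [] ∷ (# 2 ∷ []) ∷
       (# 0 ∷ # 3 ∷ []) ∷ [])

  ladder₃ : Tables 5 9
  ladder₃ = tables
      ((# 1 ∷ # 2 ∷ []) ∷ (# 0 ∷ # 3 ∷ []) ∷ (# 0 ∷ # 4 ∷ []) ∷ (# 1 ∷ # 4 ∷ # 5 ∷ []) ∷ (# 2 ∷ # 3 ∷ # 6 ∷ []) ∷
       (# 3 ∷ # 7 ∷ []) ∷ (# 4 ∷ # 7 ∷ # 8 ∷ []) ∷ (# 5 ∷ # 6 ∷ []) ∷ (# 6 ∷ []) ∷ [])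
      ((# 3 ∷ []) ∷ (# 1 ∷ []) ∷ (# 4 ∷ []) ∷ [] ∷ [] ∷ (# 4 ∷ []) ∷ [] ∷ (# 2 ∷ []) ∷ (# 0 ∷ # 4 ∷ []) ∷ [])

  ladder₅ : Tables 5 15
  ladder₅ = tables
      ((# 1 ∷ # 2 ∷ # 7 ∷ []) ∷ (# 0 ∷ # 3 ∷ # 8 ∷ []) ∷ (# 0 ∷ # 4 ∷ []) ∷ (# 1 ∷ # 4 ∷ # 5 ∷ []) ∷
       (# 2 ∷ # 3 ∷ # 9 ∷ []) ∷ (# 3 ∷ # 10 ∷ []) ∷ (# 7 ∷ # 8 ∷ []) ∷ (# 0 ∷ # 6 ∷ []) ∷ (# 1 ∷ # 6 ∷ []) ∷
       (# 4 ∷ # 10 ∷ # 11 ∷ []) ∷ (# 5 ∷ # 9 ∷ # 12 ∷ []) ∷ (# 9 ∷ # 13 ∷ []) ∷ (# 10 ∷ # 13 ∷ # 14 ∷ []) ∷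
       (# 11 ∷ # 12 ∷ []) ∷ (# 12 ∷ []) ∷ [])
      ([] ∷ [] ∷ (# 4 ∷ []) ∷ [] ∷ [] ∷ (# 4 ∷ []) ∷ (# 3 ∷ []) ∷ (# 1 ∷ []) ∷ (# 4 ∷ []) ∷ [] ∷ [] ∷
       (# 4 ∷ []) ∷ [] ∷ (# 2 ∷ []) ∷ (# 0 ∷ # 4 ∷ []) ∷ [])

  -- The cycle enters at vertex 0 and leaves at vertex 1, so the edge from 2 to port 2 is unused.
  triangle : Tables 3 3
  triangle = tables
      ((# 1 ∷ # 2 ∷ []) ∷ (# 0 ∷ # 2 ∷ []) ∷ (# 0 ∷ # 1 ∷ []) ∷ [])
      ((# 0 ∷ []) ∷ (# 1 ∷ []) ∷ (# 2 ∷ []) ∷ [])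

  -- The triangles 0 1 4 and 2 3 5 are joined by the edge from 0 to 2 and through the vertex 6.
  -- Vertex 4 is the future hub with the fan 0, 1, while the triangle 2 3 5 is kept for the next
  -- replacement.
  twoTriangles : Tables 3 7
  twoTriangles = tables
      ((# 1 ∷ # 2 ∷ # 4 ∷ []) ∷ (# 0 ∷ # 4 ∷ # 6 ∷ []) ∷ (# 0 ∷ # 3 ∷ # 5 ∷ []) ∷ (# 2 ∷ # 5 ∷ # 6 ∷ []) ∷
       (# 0 ∷ # 1 ∷ []) ∷ (# 2 ∷ # 3 ∷ []) ∷ (# 1 ∷ # 3 ∷ []) ∷ [])
      ([] ∷ [] ∷ [] ∷ [] ∷ (# 0 ∷ []) ∷ (# 1 ∷ []) ∷ (# 2 ∷ []) ∷ [])

  -- Port 2 is the hub.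
  fan₂ : Tables 3 2
  fan₂ = tables
      ((# 1 ∷ []) ∷ (# 0 ∷ []) ∷ [])
      ((# 0 ∷ # 2 ∷ []) ∷ (# 1 ∷ # 2 ∷ []) ∷ [])

  fan₃ : Tables 3 3
  fan₃ = tables
      ((# 1 ∷ # 2 ∷ []) ∷ (# 0 ∷ []) ∷ (# 0 ∷ []) ∷ [])
      ((# 2 ∷ []) ∷ (# 0 ∷ # 2 ∷ []) ∷ (# 1 ∷ # 2 ∷ []) ∷ [])

  -- The cycle descends the ladder from the last block to the first and passes each block in the
  -- order s, a, b. The edges to the hub and those from b to the next a are not on the cycle.
  ladder₂-trail : Trail 4 6
  ladder₂-trail = trail (# 0) (# 1) (# 5 , # 3 ∷ # 4 ∷ # 2 ∷ # 0 ∷ # 1 ∷ [])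

  ladder₃-trail : Trail 5 9
  ladder₃-trail = trail (# 0) (# 1) (# 8 , # 6 ∷ # 7 ∷ # 5 ∷ # 3 ∷ # 4 ∷ # 2 ∷ # 0 ∷ # 1 ∷ [])

  triangle-trail : Trail 3 3
  triangle-trail = trail (# 0) (# 1) (# 0 , # 2 ∷ # 1 ∷ [])

  fan₂-trail : Trail 3 2
  fan₂-trail = trail (# 2) (# 1) (# 0 , # 1 ∷ [])

  ladder₂⇒₄ : Rewrite {δ = 6} ladder₂ ladder₂-trail ladder₄
  ladder₂⇒₄ = record
    { ρ′ = (# 11 , # 9 ∷ # 10 ∷ # 5 ∷ # 3 ∷ # 4 ∷ # 2 ∷ # 0 ∷ # 1 ∷ # 8 ∷ # 6 ∷ # 7 ∷ [])
    ; g = # 3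
    ; sim = refl
    ; ρ-path = refl
    ; ρ-covers = refl
    ; ρ′-span = refl
    ; kA′-sym = from-yes (all? λ a → all? λ b → kA ⟦ ladder₄ ⟧ a b ≟ᵇ kA ⟦ ladder₄ ⟧ b a)
    ; kA′-irr = from-yes (all? λ a → kA ⟦ ladder₄ ⟧ a a ≟ᵇ false)
    ; keep = from-yes (all? λ i → all? λ p → pA ⟦ ladder₄ ⟧ (6 ↑ʳ i) p ≟ᵇ pA ⟦ ladder₂ ⟧ i p)
    ; grow = from-yes (all? λ (a : Fin 6) → all? λ p → ¬? (p ≟ # 3) →-dec (pA ⟦ ladder₄ ⟧ (a ↑ˡ 6) p ≟ᵇ false))
    ; ch₁ = lookup fold
    ; ch₂ = λ a b → (lookup fold a , lookup fold b) ∷ (# 0 , # 1) ∷ []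
    ; pres = refl }
    where
    -- Along the ladder the blocks stand in the order 2, 0, 1, 3. `fold` sends them alternately to
    -- the first and the second old block, and so preserves the parity of the position. The pair
    -- `(# 0 , # 1)` in `ch₂` is a fallback where the folded pair fails.
    fold : Vec (Fin 6) 12
    fold = # 3 ∷ # 4 ∷ # 5 ∷ # 0 ∷ # 1 ∷ # 2 ∷ # 0 ∷ # 1 ∷ # 2 ∷ # 3 ∷ # 4 ∷ # 5 ∷ []

  ladder₃⇒₅ : Rewrite {δ = 6} ladder₃ ladder₃-trail ladder₅
  ladder₃⇒₅ = record
    { ρ′ = (# 14 , # 12 ∷ # 13 ∷ # 11 ∷ # 9 ∷ # 10 ∷ # 5 ∷ # 3 ∷ # 4 ∷ # 2 ∷ # 0 ∷ # 1 ∷ # 8 ∷ # 6 ∷ # 7 ∷ [])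
    ; g = # 4
    ; sim = refl
    ; ρ-path = refl
    ; ρ-covers = refl
    ; ρ′-span = refl
    ; kA′-sym = from-yes (all? λ a → all? λ b → kA ⟦ ladder₅ ⟧ a b ≟ᵇ kA ⟦ ladder₅ ⟧ b a)
    ; kA′-irr = from-yes (all? λ a → kA ⟦ ladder₅ ⟧ a a ≟ᵇ false)
    ; keep = from-yes (all? λ i → all? λ p → pA ⟦ ladder₅ ⟧ (6 ↑ʳ i) p ≟ᵇ pA ⟦ ladder₃ ⟧ i p)
    ; grow = from-yes (all? λ (a : Fin 6) → all? λ p → ¬? (p ≟ # 4) →-dec (pA ⟦ ladder₅ ⟧ (a ↑ˡ 9) p ≟ᵇ false))
    ; ch₁ = lookup fold
    -- Two ways to fold five blocks onto three: in ladder order, `fold` hits the old blocks 0, 1, 0,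
    -- 1, 2 and the second vector 0, 1, 2, 1, 2. For each deleted pair one of them has to work.
    ; ch₂ = λ a b → (lookup fold a , lookup fold b) ∷ (lookup (# 3 ∷ # 4 ∷ # 5 ∷ # 6 ∷ # 7 ∷ # 8 ∷ # 0 ∷ # 1 ∷ # 2 ∷ # 3 ∷ # 4 ∷ # 5 ∷ # 6 ∷ # 7 ∷ # 8 ∷ []) a , lookup (# 3 ∷ # 4 ∷ # 5 ∷ # 6 ∷ # 7 ∷ # 8 ∷ # 0 ∷ # 1 ∷ # 2 ∷ # 3 ∷ # 4 ∷ # 5 ∷ # 6 ∷ # 7 ∷ # 8 ∷ []) b) ∷ []
    ; pres = refl }
    where
    fold : Vec (Fin 9) 15
    fold = # 3 ∷ # 4 ∷ # 5 ∷ # 0 ∷ # 1 ∷ # 2 ∷ # 0 ∷ # 1 ∷ # 2 ∷ # 3 ∷ # 4 ∷ # 5 ∷ # 6 ∷ # 7 ∷ # 8 ∷ []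

  triangle⇒ : Rewrite {δ = 4} triangle triangle-trail twoTriangles
  triangle⇒ = record
    { ρ′ = (# 4 , # 0 ∷ # 1 ∷ # 6 ∷ # 3 ∷ # 2 ∷ # 5 ∷ [])
    ; g = # 2
    ; sim = refl
    ; ρ-path = refl
    ; ρ-covers = refl
    ; ρ′-span = refl
    ; kA′-sym = from-yes (all? λ a → all? λ b → kA ⟦ twoTriangles ⟧ a b ≟ᵇ kA ⟦ twoTriangles ⟧ b a)
    ; kA′-irr = from-yes (all? λ a → kA ⟦ twoTriangles ⟧ a a ≟ᵇ false)
    ; keep = from-yes (all? λ i → all? λ p → pA ⟦ twoTriangles ⟧ (4 ↑ʳ i) p ≟ᵇ pA ⟦ triangle ⟧ i p)
    ; grow = from-yes (all? λ (a : Fin 4) → all? λ p → ¬? (p ≟ # 2) →-dec (pA ⟦ twoTriangles ⟧ (a ↑ˡ 3) p ≟ᵇ false))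
    ; ch₁ = lookup fold
    ; ch₂ = λ a b → (lookup fold a , lookup fold b) ∷ (# 0 , # 1) ∷ []
    ; pres = refl }
    where
    fold : Vec (Fin 3) 7
    fold = # 0 ∷ # 0 ∷ # 0 ∷ # 0 ∷ # 0 ∷ # 1 ∷ # 2 ∷ []

  fan₂⇒₃ : Rewrite {δ = 1} fan₂ fan₂-trail fan₃
  fan₂⇒₃ = record
    { ρ′ = (# 1 , # 0 ∷ # 2 ∷ [])
    ; g = # 2
    ; sim = refl
    ; ρ-path = refl
    ; ρ-covers = refl
    ; ρ′-span = refl
    ; kA′-sym = from-yes (all? λ a → all? λ b → kA ⟦ fan₃ ⟧ a b ≟ᵇ kA ⟦ fan₃ ⟧ b a)
    ; kA′-irr = from-yes (all? λ a → kA ⟦ fan₃ ⟧ a a ≟ᵇ false)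
    ; keep = from-yes (all? λ i → all? λ p → pA ⟦ fan₃ ⟧ (1 ↑ʳ i) p ≟ᵇ pA ⟦ fan₂ ⟧ i p)
    ; grow = from-yes (all? λ (a : Fin 1) → all? λ p → ¬? (p ≟ # 2) →-dec (pA ⟦ fan₃ ⟧ (a ↑ˡ 2) p ≟ᵇ false))
    ; ch₁ = lookup fold
    ; ch₂ = λ a b → (lookup fold a , lookup fold b) ∷ (# 0 , # 1) ∷ []
    ; pres = refl }
    where
    fold : Vec (Fin 2) 3
    fold = # 0 ∷ # 0 ∷ # 1 ∷ []

-- Gadgets found again inside the enlarged gadgets.

module Nesting where
  open Cycles
  open Gadgets
  open Cuts
  open Rewriting
  open Effects
  open Fragments
  open import Data.Sum.Properties using () renaming (≡-dec to ⊎-≡-dec)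
  open import Data.Vec using ([]; _∷_; lookup)
  open import Relation.Nullary.Decidable using (_×-dec_; _⊎-dec_)
  open import Relation.Binary.Definitions using (DecidableEquality)

  private variable
    A : Set

  step? : DecidableEquality A → ∀ (x : A) ys z u v → Dec (Step x ys z u v)
  step? _≟_ x []       z u v = (x ≟ u) ×-dec (z ≟ v)
  step? _≟_ x (y ∷ ys) z u v = ((x ≟ u) ×-dec (y ≟ v)) ⊎-dec step? _≟_ y ys z u v

  runList : ∀ {k} → Run k → List (Fin k)
  runList (a , as) = a ∷ as

  links? : {R : A → A → Set} → (∀ u v → Dec (R u v)) → ∀ x ys z → Dec (Links R x ys z)
  links? R? x []       z = R? x z
  links? R? x (y ∷ ys) z = R? x y ×-dec links? R? y ys z

  module _ {S : State} {site : Site S ladder₂ ladder₂-trail} where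
    private
      module P = Post S site ladder₂⇒₄
      _≟ˡ_ : DecidableEquality P.Local
      _≟ˡ_ = ⊎-≡-dec _≟_ _≟_

    -- The two inserted blocks and the last one. Their upper end still leads to port 0, but the
    -- first a is now preceded by the vertex b of block 2, so the two ends no longer share a port;
    -- hence `ladder₃`.
    ladder₃-in-₄ : P.Subsite ladder₃ ladder₃-trail
    ladder₃-in-₄ = record
      { e = e
      ; f = f
      ; e-inj = from-yes (all? λ i → all? λ j → (e i ≟ e j) →-dec (i ≟ j))
      ; f-inj = from-yes (all? λ p → all? λ q → (f p ≟ˡ f q) →-dec (p ≟ q))
      ; e≢f = from-yes (all? λ i → all? λ p → ¬? (inj₁ (e i) ≟ˡ f p))
      ; kk₂ = from-yes (all? λ i → all? λ j → kA ⟦ ladder₄ ⟧ (e i) (e j) ≟ᵇ kA ⟦ ladder₃ ⟧ i j)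
      ; kp₂ = from-yes (all? λ i → all? λ p → P.adjLocal (e i) (f p) ≟ᵇ pA ⟦ ladder₃ ⟧ i p)
      ; cl-k = from-yes (all? λ i → all? λ b → (kA ⟦ ladder₄ ⟧ (e i) b ≟ᵇ true) →-dec
          (any? (λ j → b ≟ e j) ⊎-dec any? (λ p → inj₁ b ≟ˡ f p)))
      ; cl-p = from-yes (all? λ i → all? λ q → (pA ⟦ ladder₄ ⟧ (e i) q ≟ᵇ true) →-dec any? (λ p → inj₂ q ≟ˡ f p))
      ; run₂ = from-yes (links? (step? _≟ˡ_ (inj₂ (Trail.p₀ ladder₂-trail)) (map inj₁ (runList (Rewrite.ρ′ ladder₂⇒₄))) (inj₂ (Trail.q₀ ladder₂-trail)))
          (f (Trail.p₀ ladder₃-trail)) (map (inj₁ ∘ e) (runList (Trail.ρ ladder₃-trail))) (f (Trail.q₀ ladder₃-trail))) }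
      where
      e = lookup (# 0 ∷ # 1 ∷ # 2 ∷ # 3 ∷ # 4 ∷ # 5 ∷ # 9 ∷ # 10 ∷ # 11 ∷ [])
      f = lookup (inj₂ (# 0) ∷ inj₁ (# 8) ∷ inj₂ (# 2) ∷ inj₁ (# 7) ∷ inj₂ (# 3) ∷ [])

  module _ {S : State} {site : Site S ladder₃ ladder₃-trail} where
    private
      module P = Post S site ladder₃⇒₅
      _≟ˡ_ : DecidableEquality P.Local
      _≟ˡ_ = ⊎-≡-dec _≟_ _≟_

    -- The last three of the five blocks form the gadget that was replaced, with the same hub. This
    -- closes the induction: the hub can grow by 2 any number of times.
    ladder₃-in-₅ : P.Subsite ladder₃ ladder₃-trail
    ladder₃-in-₅ = record
      { e = e
      ; f = f
      ; e-inj = from-yes (all? λ i → all? λ j → (e i ≟ e j) →-dec (i ≟ j))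
      ; f-inj = from-yes (all? λ p → all? λ q → (f p ≟ˡ f q) →-dec (p ≟ q))
      ; e≢f = from-yes (all? λ i → all? λ p → ¬? (inj₁ (e i) ≟ˡ f p))
      ; kk₂ = from-yes (all? λ i → all? λ j → kA ⟦ ladder₅ ⟧ (e i) (e j) ≟ᵇ kA ⟦ ladder₃ ⟧ i j)
      ; kp₂ = from-yes (all? λ i → all? λ p → P.adjLocal (e i) (f p) ≟ᵇ pA ⟦ ladder₃ ⟧ i p)
      ; cl-k = from-yes (all? λ i → all? λ b → (kA ⟦ ladder₅ ⟧ (e i) b ≟ᵇ true) →-dec
          (any? (λ j → b ≟ e j) ⊎-dec any? (λ p → inj₁ b ≟ˡ f p)))
      ; cl-p = from-yes (all? λ i → all? λ q → (pA ⟦ ladder₅ ⟧ (e i) q ≟ᵇ true) →-dec any? (λ p → inj₂ q ≟ˡ f p))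
      ; run₂ = from-yes (links? (step? _≟ˡ_ (inj₂ (Trail.p₀ ladder₃-trail)) (map inj₁ (runList (Rewrite.ρ′ ladder₃⇒₅))) (inj₂ (Trail.q₀ ladder₃-trail)))
          (f (Trail.p₀ ladder₃-trail)) (map (inj₁ ∘ e) (runList (Trail.ρ ladder₃-trail))) (f (Trail.q₀ ladder₃-trail))) }
      where
      e = lookup (# 3 ∷ # 4 ∷ # 5 ∷ # 9 ∷ # 10 ∷ # 11 ∷ # 12 ∷ # 13 ∷ # 14 ∷ [])
      f = lookup (inj₂ (# 0) ∷ inj₁ (# 2) ∷ inj₂ (# 2) ∷ inj₁ (# 1) ∷ inj₂ (# 4) ∷ [])

  module _ {S : State} {site : Site S triangle triangle-trail} where
    private
      module P = Post S site triangle⇒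
      _≟ˡ_ : DecidableEquality P.Local
      _≟ˡ_ = ⊎-≡-dec _≟_ _≟_

    fan₂-in-twoTriangles : P.Subsite fan₂ fan₂-trail
    fan₂-in-twoTriangles = record
      { e = e
      ; f = f
      ; e-inj = from-yes (all? λ i → all? λ j → (e i ≟ e j) →-dec (i ≟ j))
      ; f-inj = from-yes (all? λ p → all? λ q → (f p ≟ˡ f q) →-dec (p ≟ q))
      ; e≢f = from-yes (all? λ i → all? λ p → ¬? (inj₁ (e i) ≟ˡ f p))
      ; kk₂ = from-yes (all? λ i → all? λ j → kA ⟦ twoTriangles ⟧ (e i) (e j) ≟ᵇ kA ⟦ fan₂ ⟧ i j)
      ; kp₂ = from-yes (all? λ i → all? λ p → P.adjLocal (e i) (f p) ≟ᵇ pA ⟦ fan₂ ⟧ i p)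
      ; cl-k = from-yes (all? λ i → all? λ b → (kA ⟦ twoTriangles ⟧ (e i) b ≟ᵇ true) →-dec
          (any? (λ j → b ≟ e j) ⊎-dec any? (λ p → inj₁ b ≟ˡ f p)))
      ; cl-p = from-yes (all? λ i → all? λ q → (pA ⟦ twoTriangles ⟧ (e i) q ≟ᵇ true) →-dec any? (λ p → inj₂ q ≟ˡ f p))
      ; run₂ = from-yes (links? (step? _≟ˡ_ (inj₂ (Trail.p₀ triangle-trail)) (map inj₁ (runList (Rewrite.ρ′ triangle⇒))) (inj₂ (Trail.q₀ triangle-trail)))
          (f (Trail.p₀ fan₂-trail)) (map (inj₁ ∘ e) (runList (Trail.ρ fan₂-trail))) (f (Trail.q₀ fan₂-trail))) }
      where
      e = lookup (# 0 ∷ # 1 ∷ [])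
      f = lookup (inj₁ (# 2) ∷ inj₁ (# 6) ∷ inj₁ (# 4) ∷ [])

  module _ {S : State} {site : Site S triangle triangle-trail} where
    private
      module P = Post S site triangle⇒
      _≟ˡ_ : DecidableEquality P.Local
      _≟ˡ_ = ⊎-≡-dec _≟_ _≟_

    triangle-in-twoTriangles : P.Subsite triangle triangle-trail
    triangle-in-twoTriangles = record
      { e = e
      ; f = f
      ; e-inj = from-yes (all? λ i → all? λ j → (e i ≟ e j) →-dec (i ≟ j))
      ; f-inj = from-yes (all? λ p → all? λ q → (f p ≟ˡ f q) →-dec (p ≟ q))
      ; e≢f = from-yes (all? λ i → all? λ p → ¬? (inj₁ (e i) ≟ˡ f p))
      ; kk₂ = from-yes (all? λ i → all? λ j → kA ⟦ twoTriangles ⟧ (e i) (e j) ≟ᵇ kA ⟦ triangle ⟧ i j)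
      ; kp₂ = from-yes (all? λ i → all? λ p → P.adjLocal (e i) (f p) ≟ᵇ pA ⟦ triangle ⟧ i p)
      ; cl-k = from-yes (all? λ i → all? λ b → (kA ⟦ twoTriangles ⟧ (e i) b ≟ᵇ true) →-dec
          (any? (λ j → b ≟ e j) ⊎-dec any? (λ p → inj₁ b ≟ˡ f p)))
      ; cl-p = from-yes (all? λ i → all? λ q → (pA ⟦ twoTriangles ⟧ (e i) q ≟ᵇ true) →-dec any? (λ p → inj₂ q ≟ˡ f p))
      ; run₂ = from-yes (links? (step? _≟ˡ_ (inj₂ (Trail.p₀ triangle-trail)) (map inj₁ (runList (Rewrite.ρ′ triangle⇒))) (inj₂ (Trail.q₀ triangle-trail)))
          (f (Trail.p₀ triangle-trail)) (map (inj₁ ∘ e) (runList (Trail.ρ triangle-trail))) (f (Trail.q₀ triangle-trail))) }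
      where
      e = lookup (# 3 ∷ # 5 ∷ # 2 ∷ [])
      f = lookup (inj₁ (# 6) ∷ inj₂ (# 1) ∷ inj₁ (# 0) ∷ [])

  module _ {S : State} {site : Site S fan₂ fan₂-trail} where
    private
      module P = Post S site fan₂⇒₃
      _≟ˡ_ : DecidableEquality P.Local
      _≟ˡ_ = ⊎-≡-dec _≟_ _≟_

    fan₂-in-₃ : P.Subsite fan₂ fan₂-trail
    fan₂-in-₃ = record
      { e = e
      ; f = f
      ; e-inj = from-yes (all? λ i → all? λ j → (e i ≟ e j) →-dec (i ≟ j))
      ; f-inj = from-yes (all? λ p → all? λ q → (f p ≟ˡ f q) →-dec (p ≟ q))
      ; e≢f = from-yes (all? λ i → all? λ p → ¬? (inj₁ (e i) ≟ˡ f p))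
      ; kk₂ = from-yes (all? λ i → all? λ j → kA ⟦ fan₃ ⟧ (e i) (e j) ≟ᵇ kA ⟦ fan₂ ⟧ i j)
      ; kp₂ = from-yes (all? λ i → all? λ p → P.adjLocal (e i) (f p) ≟ᵇ pA ⟦ fan₂ ⟧ i p)
      ; cl-k = from-yes (all? λ i → all? λ b → (kA ⟦ fan₃ ⟧ (e i) b ≟ᵇ true) →-dec
          (any? (λ j → b ≟ e j) ⊎-dec any? (λ p → inj₁ b ≟ˡ f p)))
      ; cl-p = from-yes (all? λ i → all? λ q → (pA ⟦ fan₃ ⟧ (e i) q ≟ᵇ true) →-dec any? (λ p → inj₂ q ≟ˡ f p))
      ; run₂ = from-yes (links? (step? _≟ˡ_ (inj₂ (Trail.p₀ fan₂-trail)) (map inj₁ (runList (Rewrite.ρ′ fan₂⇒₃))) (inj₂ (Trail.q₀ fan₂-trail)))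
          (f (Trail.p₀ fan₂-trail)) (map (inj₁ ∘ e) (runList (Trail.ρ fan₂-trail))) (f (Trail.q₀ fan₂-trail))) }
      where
      e = lookup (# 1 ∷ # 0 ∷ [])
      f = lookup (inj₂ (# 0) ∷ inj₁ (# 2) ∷ inj₂ (# 2) ∷ [])

-- The starting graph: its unique cycle, its connectivity and its three sites.

module BaseGraph where
  open Cycles
  open Gadgets
  open Cuts
  open Rewriting
  open Fragments
  open Nesting
  open import Data.Sum using ([_,_]′)
  open import Data.Empty using (⊥-elim)
  open import Data.Vec using ([]; _∷_; lookup)
  open import Relation.Nullary.Decidable using (_⊎-dec_)

  private variable
    A : Set

  -- The hamiltonian cycle is 0, 1, …, 23.  The vertices 7–12 and 16–21 form ladders whose hubs are 14 and
  -- 5, the vertices of degree 4; 2, 3, 4 is a triangle.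
  petersenPair : Tables 0 24
  petersenPair = tables
      ((# 1 ∷ # 22 ∷ # 23 ∷ []) ∷ (# 0 ∷ # 2 ∷ # 9 ∷ []) ∷ (# 1 ∷ # 3 ∷ # 4 ∷ []) ∷ (# 2 ∷ # 4 ∷ # 23 ∷ []) ∷
       (# 2 ∷ # 3 ∷ # 5 ∷ []) ∷ (# 4 ∷ # 6 ∷ # 16 ∷ # 19 ∷ []) ∷ (# 5 ∷ # 7 ∷ # 11 ∷ []) ∷
       (# 6 ∷ # 8 ∷ # 14 ∷ []) ∷ (# 7 ∷ # 9 ∷ # 12 ∷ []) ∷ (# 1 ∷ # 8 ∷ # 10 ∷ []) ∷ (# 9 ∷ # 11 ∷ # 14 ∷ []) ∷
       (# 6 ∷ # 10 ∷ # 12 ∷ []) ∷ (# 8 ∷ # 11 ∷ # 13 ∷ []) ∷ (# 12 ∷ # 14 ∷ # 18 ∷ []) ∷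
       (# 7 ∷ # 10 ∷ # 13 ∷ # 15 ∷ []) ∷ (# 14 ∷ # 16 ∷ # 20 ∷ []) ∷ (# 5 ∷ # 15 ∷ # 17 ∷ []) ∷
       (# 16 ∷ # 18 ∷ # 21 ∷ []) ∷ (# 13 ∷ # 17 ∷ # 19 ∷ []) ∷ (# 5 ∷ # 18 ∷ # 20 ∷ []) ∷
       (# 15 ∷ # 19 ∷ # 21 ∷ []) ∷ (# 17 ∷ # 20 ∷ # 22 ∷ []) ∷ (# 0 ∷ # 21 ∷ # 23 ∷ []) ∷
       (# 0 ∷ # 3 ∷ # 22 ∷ []) ∷ [])
      ([] ∷ [] ∷ [] ∷ [] ∷ [] ∷ [] ∷ [] ∷ [] ∷ [] ∷ [] ∷ [] ∷ [] ∷ [] ∷ [] ∷ [] ∷ [] ∷ [] ∷ [] ∷ [] ∷ [] ∷ [] ∷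
       [] ∷ [] ∷ [] ∷ [])

  base : Graph
  base = record
    { n = 24
    ; adj = kA ⟦ petersenPair ⟧
    ; adj-sym = from-yes (all? λ a → all? λ b → kA ⟦ petersenPair ⟧ a b ≟ᵇ kA ⟦ petersenPair ⟧ b a)
    ; adj-irr = from-yes (all? λ a → kA ⟦ petersenPair ⟧ a a ≟ᵇ false) }

  baseCycle : List (Fin 24)
  baseCycle = Data.List.tabulate suc

  module HamSearch {k} (t : Tables 0 k) where
    open Search t using (Fresh; fresh-tail; if-true; unless)

    dfs : ℕ → Vec Bool k → Fin k → (List (Fin k) → Bool) → Bool
    try : ℕ → Vec Bool k → (List (Fin k) → Bool) → Fin k → Bool
    dfs zero    vis u κ = false
    dfs (suc f) vis u κ = if (if allTrue vis then κ [] else true) then every (try f vis κ) (lookup (inner t) u) else false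
    try f vis κ w = if lookup vis w then true else dfs f (vis [ w ]≔ true) w (λ ys → κ (w ∷ ys))

    dfs-sound : ∀ f vis u κ → dfs f vis u κ ≡ true → ∀ ys {z} → Links (λ a b → kA ⟦ t ⟧ a b ≡ true) u ys z → Fresh vis ys → κ ys ≡ true
    dfs-sound (suc f) vis u κ e []       l (_ , _ , cov) =
      ≡-trans (cong (λ b → if b then κ [] else true) (sym (allTrue⇐ vis (λ i → [ id , (λ ()) ]′ (cov i))))) (proj₁ (if-true e))
    dfs-sound (suc f) vis u κ e (y ∷ ys) (r , l) fr@(_ , out , _) = dfs-sound f (vis [ y ]≔ true) y (λ ys → κ (y ∷ ys))
      (unless (every-lookup (try f vis κ) (proj₂ (if-true {if allTrue vis then κ [] else true} e)) (elem⇒∈ y (lookup (inner t) u) r)) (out (here refl)))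
      ys l (fresh-tail {vis} fr)

  consecutive⇒closed : ∀ {k} (a : Fin k) as z {u v} → consecutive a (as ++ z ∷ []) u v ≡ true → Step a as z u v
  consecutive⇒closed a []       z {u} {v} e with ∨-true {a == u ∧ z == v} e
  ... | inj₁ e₁ = ==⇒≡ a u (proj₁ (∧-true e₁)) , ==⇒≡ z v (proj₂ (∧-true {a == u} e₁))
  consecutive⇒closed a (b ∷ bs) z {u} {v} e with ∨-true {a == u ∧ b == v} e
  ... | inj₁ e₁ = inj₁ (==⇒≡ a u (proj₁ (∧-true e₁)) , ==⇒≡ b v (proj₂ (∧-true {a == u} e₁)))
  ... | inj₂ e₂ = inj₂ (consecutive⇒closed b bs z e₂)

  module _ {k} (x : Fin k) (c : List (Fin k)) where

    onCycle : Fin k → Fin k → Bool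
    onCycle u v = consecutive x (c ++ x ∷ []) u v ∨ consecutive x (c ++ x ∷ []) v u

    onCycle⇒ : ∀ {u v} → onCycle u v ≡ true → SymStep x c x u v
    onCycle⇒ {u} {v} e = Sum.map (consecutive⇒closed x c x) (consecutive⇒closed x c x) (∨-true {consecutive x (c ++ x ∷ []) u v} e)

    followed : Fin k → List (Fin k) → Bool
    followed u []       = onCycle u x
    followed u (y ∷ ys) = onCycle u y ∧ followed y ys

    followed⇒ : ∀ u ys → followed u ys ≡ true → Links (SymStep x c x) u ys x
    followed⇒ u []       e = onCycle⇒ e
    followed⇒ u (y ∷ ys) e = onCycle⇒ (proj₁ (∧-true e)) , followed⇒ y ys (proj₂ (∧-true {onCycle u y} e))

  -- Hamiltonian paths that do not close up pass vacuously; all others must stay on `baseCycle`.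
  closing : List (Fin 24) → Bool
  closing ys = if kA ⟦ petersenPair ⟧ (lastOf zero ys) zero then followed zero baseCycle zero ys else true

  -- Uniqueness in the base graph rests on this evaluation. The fuel 30 exceeds the depth 24 of the
  -- search.
  base-search : HamSearch.dfs petersenPair 30 (replicate 24 false [ zero ]≔ true) zero closing ≡ true
  base-search = refl

  last-link : ∀ {R : A → A → Set} {x} ys {z} → Links R x ys z → R (lastOf x ys) z
  last-link []       r       = r
  last-link (y ∷ ys) (_ , l) = last-link ys l

  base-uniq : ∀ ys → IsHam (Adj base) zero ys → Links (SymStep zero baseCycle zero) zero ys zero
  base-uniq ys (isHam u c l) = followed⇒ zero baseCycle zero ys
    (≡-trans (cong (λ b → if b then followed zero baseCycle zero ys else true) (sym (last-link ys l)))
      (HamSearch.dfs-sound petersenPair 30 (replicate 24 false [ zero ]≔ true) zero closing base-search ys l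
        (Search.fresh-tail petersenPair {replicate 24 false} (u , (λ {b} _ → lookup-replicate b false) , λ b → inj₂ (c b)))))

  module Connectivity {k} (t : Tables 0 k) (root : Fin k → Fin k → Fin k) where

    component : Fin k → Fin k → List (Fin k)
    component x y = explore (lookup (inner t)) (5 * k) (root x y ∷ []) (flags (x ∷ y ∷ [])) []

    hit : Fin k → Fin k → List (Fin k) → Fin k → Bool
    hit x y comp u = elem u (x ∷ y ∷ []) ∨ elem u comp

    joined : Fin k → Fin k → Bool
    joined x y = not (elem (root x y) (x ∷ y ∷ [])) ∧ every (hit x y (component x y)) (allFin k)

    joinedAll : Fin k → Bool
    joinedAll x = every (joined x) (allFin k)

    module _ (kA-sym : ∀ a b → kA ⟦ t ⟧ a b ≡ kA ⟦ t ⟧ b a) (all : every joinedAll (allFin k) ≡ true) where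

      R : Fin k → Fin k → Set
      R a b = kA ⟦ t ⟧ a b ≡ true

      connected : Connected₃ R
      connected x y {u} {v} ux uy vx vy =
        path-sym (λ {a} {b} e → ≡-trans (kA-sym b a) e) (proj₁ root-free) (proj₂ root-free) (reach u ux uy) ⊙ reach v vx vy
        where
        at : not (elem (root x y) (x ∷ y ∷ [])) ≡ true × every (hit x y (component x y)) (allFin k) ≡ true
        at = ∧-true (every-lookup (joined x) (every-lookup joinedAll all (∈-allFin x)) (∈-allFin y))
        free : ∀ i → ¬ (elem i (x ∷ y ∷ []) ≡ true) → i ≢ x × i ≢ y
        free i h = (λ { refl → h (∈⇒elem i {x ∷ y ∷ []} (here refl)) }) , λ { refl → h (∈⇒elem i {x ∷ y ∷ []} (there (here refl))) }
        root-free : root x y ≢ x × root x y ≢ y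
        root-free = free (root x y) λ h → case ≡-trans (sym (cong not h)) (proj₁ at) of λ ()
        reach : ∀ w → w ≢ x → w ≢ y → Path R x y (root x y) w
        reach w wx wy with ∨-true {elem w (x ∷ y ∷ [])} (every-lookup (hit x y (component x y)) (proj₂ at) (∈-allFin w))
        ... | inj₁ h = ⊥-elim (no-hit (elem⇒∈ w (x ∷ y ∷ []) h))
          where
          no-hit : w ∉ x ∷ y ∷ []
          no-hit (here e)         = wx e
          no-hit (there (here e)) = wy e
        ... | inj₂ h = explore-sound (lookup (inner t)) (λ i → elem i (x ∷ y ∷ []) ≡ true) (Path R x y (root x y))
          (λ {i} {j} q m b → q ⊙ ((∈⇒elem j m , free j b) ∷ []))
          (5 * k) (root x y ∷ []) (flags (x ∷ y ∷ [])) [] (λ { (here refl) _ → [] })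
          (λ i e b → case ≡-trans (sym (flags-elem (x ∷ y ∷ []) i e)) b of λ ()) (λ ()) (elem⇒∈ w (component x y) h)

  -- Any surviving vertex will do as the start of the exploration, and one of 0, 1, 2 survives the
  -- deletion of two vertices.
  root : Fin 24 → Fin 24 → Fin 24
  root x y = if elem (# 0) (x ∷ y ∷ []) then (if elem (# 1) (x ∷ y ∷ []) then # 2 else # 1) else # 0

  base-joined : every (Connectivity.joinedAll petersenPair root) (allFin 24) ≡ true
  base-joined = refl

  base-conn : Connected₃ (Adj base)
  base-conn = Connectivity.connected petersenPair root (adj-sym base) base-joined

  baseState : State
  baseState = record
    { G = base
    ; x₀ = zero
    ; c = baseCycle
    ; ham = isHam (distinct⇒unique (zero ∷ baseCycle) refl) (covers⇒∈ (zero ∷ baseCycle) refl)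
        (from-yes (links? (λ u v → adj base u v ≟ᵇ true) zero baseCycle zero))
    ; uniq = base-uniq
    ; conn = base-conn }

  -- A further vertex joined to 6, 9 and 13 would complete the ladder, its ports 6 and 13 and the
  -- hub 14 to a Petersen graph: 6, 13 and that vertex form the third block b, s, a.
  siteA : Site baseState ladder₂ ladder₂-trail
  siteA = record
    { ι = ι
    ; π = π
    ; ι-inj = λ {i} {j} → from-yes (all? λ i → all? λ j → (ι i ≟ ι j) →-dec (i ≟ j)) i j
    ; π-inj = λ {p} {q} → from-yes (all? λ p → all? λ q → (π p ≟ π q) →-dec (p ≟ q)) p q
    ; ι≢π = from-yes (all? λ i → all? λ p → ¬? (ι i ≟ π p))
    ; kk = from-yes (all? λ i → all? λ j → adj base (ι i) (ι j) ≟ᵇ kA ⟦ ladder₂ ⟧ i j)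
    ; kp = from-yes (all? λ i → all? λ p → adj base (ι i) (π p) ≟ᵇ pA ⟦ ladder₂ ⟧ i p)
    ; closed = from-yes (all? λ i → all? λ u → (adj base (ι i) u ≟ᵇ true) →-dec
        (any? (λ j → u ≟ ι j) ⊎-dec any? (λ p → u ≟ π p)))
    ; x₀≢ι = from-yes (all? λ i → ¬? (zero ≟ ι i))
    ; x₀≢π = from-yes (all? λ p → ¬? (zero ≟ π p))
    ; steps = from-yes (links? (step? _≟_ zero baseCycle zero) (π (Trail.p₀ ladder₂-trail)) (map ι (runList (Trail.ρ ladder₂-trail))) (π (Trail.q₀ ladder₂-trail))) }
    where
    ι : Fin 6 → Fin 24
    ι = lookup (# 11 ∷ # 12 ∷ # 10 ∷ # 8 ∷ # 9 ∷ # 7 ∷ [])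
    π : Fin 4 → Fin 24
    π = lookup (# 6 ∷ # 13 ∷ # 1 ∷ # 14 ∷ [])

  -- A site leaves edges between ports free, and the two sites differ there: 13 is adjacent to the
  -- hub 14, whereas 22 is not adjacent to the hub 5.
  siteB : Site baseState ladder₂ ladder₂-trail
  siteB = record
    { ι = ι
    ; π = π
    ; ι-inj = λ {i} {j} → from-yes (all? λ i → all? λ j → (ι i ≟ ι j) →-dec (i ≟ j)) i j
    ; π-inj = λ {p} {q} → from-yes (all? λ p → all? λ q → (π p ≟ π q) →-dec (p ≟ q)) p q
    ; ι≢π = from-yes (all? λ i → all? λ p → ¬? (ι i ≟ π p))
    ; kk = from-yes (all? λ i → all? λ j → adj base (ι i) (ι j) ≟ᵇ kA ⟦ ladder₂ ⟧ i j)
    ; kp = from-yes (all? λ i → all? λ p → adj base (ι i) (π p) ≟ᵇ pA ⟦ ladder₂ ⟧ i p)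
    ; closed = from-yes (all? λ i → all? λ u → (adj base (ι i) u ≟ᵇ true) →-dec
        (any? (λ j → u ≟ ι j) ⊎-dec any? (λ p → u ≟ π p)))
    ; x₀≢ι = from-yes (all? λ i → ¬? (zero ≟ ι i))
    ; x₀≢π = from-yes (all? λ p → ¬? (zero ≟ π p))
    ; steps = from-yes (links? (step? _≟_ zero baseCycle zero) (π (Trail.p₀ ladder₂-trail)) (map ι (runList (Trail.ρ ladder₂-trail))) (π (Trail.q₀ ladder₂-trail))) }
    where
    ι : Fin 6 → Fin 24
    ι = lookup (# 20 ∷ # 21 ∷ # 19 ∷ # 17 ∷ # 18 ∷ # 16 ∷ [])
    π : Fin 4 → Fin 24
    π = lookup (# 15 ∷ # 22 ∷ # 13 ∷ # 5 ∷ [])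

  siteM : Site baseState triangle triangle-trail
  siteM = record
    { ι = ι
    ; π = π
    ; ι-inj = λ {i} {j} → from-yes (all? λ i → all? λ j → (ι i ≟ ι j) →-dec (i ≟ j)) i j
    ; π-inj = λ {p} {q} → from-yes (all? λ p → all? λ q → (π p ≟ π q) →-dec (p ≟ q)) p q
    ; ι≢π = from-yes (all? λ i → all? λ p → ¬? (ι i ≟ π p))
    ; kk = from-yes (all? λ i → all? λ j → adj base (ι i) (ι j) ≟ᵇ kA ⟦ triangle ⟧ i j)
    ; kp = from-yes (all? λ i → all? λ p → adj base (ι i) (π p) ≟ᵇ pA ⟦ triangle ⟧ i p)
    ; closed = from-yes (all? λ i → all? λ u → (adj base (ι i) u ≟ᵇ true) →-dec
        (any? (λ j → u ≟ ι j) ⊎-dec any? (λ p → u ≟ π p)))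
    ; x₀≢ι = from-yes (all? λ i → ¬? (zero ≟ ι i))
    ; x₀≢π = from-yes (all? λ p → ¬? (zero ≟ π p))
    ; steps = from-yes (links? (step? _≟_ zero baseCycle zero) (π (Trail.p₀ triangle-trail)) (map ι (runList (Trail.ρ triangle-trail))) (π (Trail.q₀ triangle-trail))) }
    where
    ι : Fin 3 → Fin 24
    ι = lookup (# 2 ∷ # 4 ∷ # 3 ∷ [])
    π : Fin 3 → Fin 24
    π = lookup (# 1 ∷ # 5 ∷ # 23 ∷ [])

-- Enlarging the two even hubs and adding hubs of arbitrary degree.

module Hubs where
  open Gadgets
  open Rewriting
  open Effects
  open Fragments
  open Nesting
  open BaseGraph
  open import Data.Nat.Properties using (+-suc; +-cancelʳ-≡)
  open import Data.Fin.Properties using (↑ʳ-injective)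
  open import Data.Sum.Properties using () renaming (≡-dec to ⊎-≡-dec)

  open State using (G)

  add-cancel : ∀ {x y z a b c} → x + a ≡ y + b → y + c ≡ z + a → x + c ≡ z + b
  add-cancel {x} {y} {z} {a} {b} {c} h₁ h₂ = +-cancelʳ-≡ a (x + c) (z + b) (begin
    (x + c) + a ≡⟨ solve 3 (λ x c a → (x :+ c) :+ a := (x :+ a) :+ c) refl x c a ⟩
    (x + a) + c ≡⟨ cong (_+ c) h₁ ⟩
    (y + b) + c ≡⟨ solve 3 (λ y b c → (y :+ b) :+ c := (y :+ c) :+ b) refl y b c ⟩
    (y + c) + b ≡⟨ cong (_+ b) h₂ ⟩
    (z + a) + b ≡⟨ solve 3 (λ z a b → (z :+ a) :+ b := (z :+ b) :+ a) refl z a b ⟩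
    (z + b) + a ∎)
    where
    open ≡-Reasoning
    open +-*-Solver

  grown-refl : ∀ S a → Grown S S a a
  grown-refl S a m _ = refl

  grown-trans : ∀ S S′ S″ a b c → Grown S S′ a b → Grown S′ S″ b c → Grown S S″ a c
  grown-trans S S′ S″ a b c h h′ m m≢3 =
    add-cancel {numDeg (G S″) m} {numDeg (G S′) m} {numDeg (G S) m} (h′ m m≢3) (h m m≢3)

  -- What is carried along unchanged while the hub of one site is enlarged.
  record Bystanders : Set₁ where
    field
      By   : (S : State) → ∀ {r k} {t : Tables r k} {τ : Trail r k} → Site S t τ → Fin r → Set
      move : ∀ {S r k δ} {t : Tables r k} {τ : Trail r k} (site : Site S t τ) {t′ : Tables r (δ + k)} (rw : Rewrite {δ = δ} t τ t′) →
        cubic? t ≡ true → cubic? t′ ≡ true →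
        ∀ {r₁ k₁} {t₁ : Tables r₁ k₁} {τ₁ : Trail r₁ k₁} (sub : Post.Subsite S site rw t₁ τ₁) g₁ →
        Post.Subsite.f sub g₁ ≡ inj₂ (Rewrite.g rw) →
        By S site (Rewrite.g rw) → By (Surgery.Apply.S′ S site rw) (Post.subsite S site rw sub) g₁

  module Climb (bys : Bystanders) where
    open Bystanders bys

    record Climbed (S : State) (D D′ : ℕ) : Set where
      field
        S′    : State
        {r k} : ℕ
        {t}   : Tables r k
        {τ}   : Trail r k
        site  : Site S′ t τ
        g     : Fin r
        by    : By S′ site g
        grown : Grown S S′ D D′

    climb₃ : ∀ S (site : Site S ladder₃ ladder₃-trail) → By S site (# 4) → ∀ D → deg (G S) (Site.π site (# 4)) ≡ D → ∀ j →
      Climbed S D (j + j + D)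
    climb₃ S site by D dg zero    = record { S′ = S ; site = site ; g = # 4 ; by = by ; grown = grown-refl S D }
    climb₃ S site by D dg (suc j) = record { Climbed up hiding (grown) ; grown =
        subst (Grown S up.S′ D) eq
          (grown-trans S S₁ up.S′ D (2 + D) (j + j + (2 + D)) (subst (λ d → Grown S S₁ d (2 + d)) dg C.grown) up.grown) }
      where
      module P = Post S site ladder₃⇒₅
      module C = P.Counting refl refl
      S₁ = Surgery.Apply.S′ S site ladder₃⇒₅
      up = climb₃ S₁ (P.subsite ladder₃-in-₅) (move site ladder₃⇒₅ refl refl ladder₃-in-₅ (# 4) refl by) (2 + D)
        (≡-trans C.deg-hub (cong (2 +_) dg)) j
      module up = Climbed up
      eq : j + j + (2 + D) ≡ suc j + suc j + D
      eq = solve 2 (λ j D → j :+ j :+ (con 2 :+ D) := (con 1 :+ j) :+ (con 1 :+ j) :+ D) refl j D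
        where open +-*-Solver

    -- The first step makes four blocks out of two; every later step takes place in a `ladder₃` and
    -- is left to `climb₃`.
    climb : ∀ S (site : Site S ladder₂ ladder₂-trail) → By S site (# 3) → ∀ D → deg (G S) (Site.π site (# 3)) ≡ D → ∀ j →
      Climbed S D (j + j + D)
    climb S site by D dg zero    = record { S′ = S ; site = site ; g = # 3 ; by = by ; grown = grown-refl S D }
    climb S site by D dg (suc j) = record { Climbed up hiding (grown) ; grown =
        subst (Grown S up.S′ D) eq
          (grown-trans S S₁ up.S′ D (2 + D) (j + j + (2 + D)) (subst (λ d → Grown S S₁ d (2 + d)) dg C.grown) up.grown) }
      where
      module P = Post S site ladder₂⇒₄
      module C = P.Counting refl refl
      S₁ = Surgery.Apply.S′ S site ladder₂⇒₄
      up = climb₃ S₁ (P.subsite ladder₃-in-₄) (move site ladder₂⇒₄ refl refl ladder₃-in-₄ (# 4) refl by) (2 + D)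
        (≡-trans C.deg-hub (cong (2 +_) dg)) j
      module up = Climbed up
      eq : j + j + (2 + D) ≡ suc j + suc j + D
      eq = solve 2 (λ j D → j :+ j :+ (con 2 :+ D) := (con 1 :+ j) :+ (con 1 :+ j) :+ D) refl j D
        where open +-*-Solver

  record Marked : Set where
    field
      S    : State
      mark : Site S triangle triangle-trail

  record WithLadder (S : State) {r k} {t : Tables r k} {τ : Trail r k} (site : Site S t τ) (g : Fin r) : Set where
    field
      ladder : Site S ladder₂ ladder₂-trail
      mark   : Site S triangle triangle-trail
      ap-l   : Apart site g ladder
      ap-m   : Apart site g mark
      ap-lm  : Apart ladder (# 3) mark
      hub    : deg (G S) (Site.π ladder (# 3)) ≡ 4
      hub≢   : Site.π ladder (# 3) ≢ Site.π site g

  withLadder : Bystanders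
  withLadder = record { By = WithLadder ; move = carry }
    where
    carry : ∀ {S r k δ} {t : Tables r k} {τ : Trail r k} (site : Site S t τ) {t′ : Tables r (δ + k)} (rw : Rewrite {δ = δ} t τ t′) →
      cubic? t ≡ true → cubic? t′ ≡ true →
      ∀ {r₁ k₁} {t₁ : Tables r₁ k₁} {τ₁ : Trail r₁ k₁} (sub : Post.Subsite S site rw t₁ τ₁) g₁ →
      Post.Subsite.f sub g₁ ≡ inj₂ (Rewrite.g rw) →
      WithLadder S site (Rewrite.g rw) → WithLadder (Surgery.Apply.S′ S site rw) (Post.subsite S site rw sub) g₁
    carry {S} site rw cub cub′ sub g₁ fg by = record
      { ladder = P.persist ladder ap-l
      ; mark = P.persist mark ap-m
      ; ap-l = P.apart-sub sub g₁ fg ladder ap-l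
      ; ap-m = P.apart-sub sub g₁ fg mark ap-m
      ; ap-lm = P.apart-lift ladder mark ap-l ap-m ap-lm
      ; hub = ≡-trans (C.deg-old (Site.π ladder (# 3)) hub≢) hub
      ; hub≢ = λ h → hub≢ (↑ʳ-injective _ _ _ (≡-trans h (cong P.loc fg))) }
      where
      open WithLadder by
      module P = Post S site rw
      module C = P.Counting cub cub′

  record WithMark (S : State) {r k} {t : Tables r k} {τ : Trail r k} (site : Site S t τ) (g : Fin r) : Set where
    field
      mark : Site S triangle triangle-trail
      ap   : Apart site g mark

  withMark : Bystanders
  withMark = record { By = WithMark ; move = λ {S} site rw _ _ sub g₁ fg by → record
    { mark = Post.persist S site rw (WithMark.mark by) (WithMark.ap by)
    ; ap = Post.apart-sub S site rw sub g₁ fg (WithMark.mark by) (WithMark.ap by) } }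

  base-by : WithLadder baseState siteA (# 3)
  base-by = record
    { ladder = siteB
    ; mark = siteM
    ; ap-l = record
      { ι-out = from-yes (all? λ i → all? λ j → ¬? (B.ι i ≟ A.ι j))
      ; ι-hub = from-yes (all? λ i → ¬? (B.ι i ≟ A.π (# 3)))
      ; p-out = from-yes (all? λ j → ¬? (B.π (# 0) ≟ A.ι j))
      ; q-out = from-yes (all? λ j → ¬? (B.π (# 1) ≟ A.ι j)) }
    ; ap-m = record
      { ι-out = from-yes (all? λ i → all? λ j → ¬? (M.ι i ≟ A.ι j))
      ; ι-hub = from-yes (all? λ i → ¬? (M.ι i ≟ A.π (# 3)))
      ; p-out = from-yes (all? λ j → ¬? (M.π (# 0) ≟ A.ι j))
      ; q-out = from-yes (all? λ j → ¬? (M.π (# 1) ≟ A.ι j)) }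
    ; ap-lm = record
      { ι-out = from-yes (all? λ i → all? λ j → ¬? (M.ι i ≟ B.ι j))
      ; ι-hub = from-yes (all? λ i → ¬? (M.ι i ≟ B.π (# 3)))
      ; p-out = from-yes (all? λ j → ¬? (M.π (# 0) ≟ B.ι j))
      ; q-out = from-yes (all? λ j → ¬? (M.π (# 1) ≟ B.ι j)) }
    ; hub = refl
    ; hub≢ = from-yes (¬? (B.π (# 3) ≟ A.π (# 3))) }
    where
    module A = Site siteA
    module B = Site siteB
    module M = Site siteM

  numDeg-base : ∀ m → m ≢ 3 → numDeg base m ≡ bit (4 ≡ᵇ m) + bit (4 ≡ᵇ m)
  numDeg-base 0 _ = refl
  numDeg-base 1 _ = refl
  numDeg-base 2 _ = refl
  numDeg-base 3 h = contradiction refl h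
  numDeg-base 4 _ = refl
  numDeg-base (suc (suc (suc (suc (suc m))))) _ = refl

  -- Both hubs have to grow, since 4 need not belong to the degree set. Raising them to the same
  -- value means that a single even element is enough.
  twoHubs : ∀ j → Σ Marked λ M → ∀ m → m ≢ 3 → numDeg (G (Marked.S M)) m ≡ bit (j + j + 4 ≡ᵇ m) + bit (j + j + 4 ≡ᵇ m)
  twoHubs j = record { S = Y.S′ ; mark = WithMark.mark Y.by } , count
    where
    module X = Climb.Climbed (Climb.climb withLadder baseState siteA base-by 4 refl j)
    module L = WithLadder X.by
    by₂ : WithMark X.S′ L.ladder (# 3)
    by₂ = record { mark = L.mark ; ap = L.ap-lm }
    module Y = Climb.Climbed (Climb.climb withMark X.S′ L.ladder by₂ 4 L.hub j)
    count : ∀ m → m ≢ 3 → numDeg (G Y.S′) m ≡ bit (j + j + 4 ≡ᵇ m) + bit (j + j + 4 ≡ᵇ m)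
    count m m≢3 = +-cancelʳ-≡ (a + a) _ _ (begin
      numDeg (G Y.S′) m + (a + a)       ≡⟨ +-assoc _ a a ⟨
      (numDeg (G Y.S′) m + a) + a       ≡⟨ cong (_+ a) (Y.grown m m≢3) ⟩
      (numDeg (G X.S′) m + b) + a       ≡⟨ solve 3 (λ x b a → (x :+ b) :+ a := (x :+ a) :+ b) refl (numDeg (G X.S′) m) b a ⟩
      (numDeg (G X.S′) m + a) + b       ≡⟨ cong (_+ b) (X.grown m m≢3) ⟩
      (numDeg base m + b) + b           ≡⟨ cong (λ z → (z + b) + b) (numDeg-base m m≢3) ⟩
      ((a + a) + b) + b                 ≡⟨ solve 2 (λ a b → ((a :+ a) :+ b) :+ b := (b :+ b) :+ (a :+ a)) refl a b ⟩
      (b + b) + (a + a)                 ∎)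
      where
      open ≡-Reasoning
      open +-*-Solver
      a = bit (4 ≡ᵇ m)
      b = bit (j + j + 4 ≡ᵇ m)

  growFan : ∀ S (fan : Site S fan₂ fan₂-trail) (mark : Site S triangle triangle-trail) → Apart fan (# 2) mark →
    ∀ D → deg (G S) (Site.π fan (# 2)) ≡ D → ∀ j →
    Σ Marked λ M → n (G (Marked.S M)) ≡ j + n (G S) × Grown S (Marked.S M) D (j + D)
  growFan S fan mark ap D dg zero    = record { S = S ; mark = mark } , refl , grown-refl S D
  growFan S fan mark ap D dg (suc j) =
    let M , size , gr = growFan S₁ (P.subsite fan₂-in-₃) (P.persist mark ap) (P.apart-sub fan₂-in-₃ (# 2) refl mark ap)
          (1 + D) (≡-trans C.deg-hub (cong (1 +_) dg)) j
    in M , ≡-trans size (+-suc j (n (G S))) ,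
       subst (Grown S (Marked.S M) D) (+-suc j D)
         (grown-trans S S₁ (Marked.S M) D (1 + D) (j + (1 + D)) (subst (λ d → Grown S S₁ d (1 + d)) dg C.grown) gr)
    where
    module P = Post S fan fan₂⇒₃
    module C = P.Counting refl refl
    S₁ = Surgery.Apply.S′ S fan fan₂⇒₃

  -- Doubling the triangle costs four vertices and creates the cubic hub; each fan step costs one
  -- vertex and raises its degree by one. The second triangle becomes the new mark.
  addHub : (M : Marked) (j : ℕ) → Σ Marked λ M′ → n (G (Marked.S M′)) ≡ j + (4 + n (G (Marked.S M))) ×
    (∀ m → m ≢ 3 → numDeg (G (Marked.S M′)) m ≡ numDeg (G (Marked.S M)) m + bit (j + 3 ≡ᵇ m))
  addHub M j =
    let M′ , size , gr = growFan S₁ (P.subsite fan₂-in-twoTriangles) (P.subsite triangle-in-twoTriangles)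
          (P.apart-subs fan₂-in-twoTriangles (# 2) triangle-in-twoTriangles
            (from-yes (all? λ i → all? λ j → ¬? (T.e i ≟ F.e j)))
            (from-yes (all? λ i → ¬? (⊎-≡-dec _≟_ _≟_ (inj₁ (T.e i)) (F.f (# 2)))))
            (from-yes (all? λ j → ¬? (⊎-≡-dec _≟_ _≟_ (T.f (# 0)) (inj₁ (F.e j)))))
            (from-yes (all? λ j → ¬? (⊎-≡-dec _≟_ _≟_ (T.f (# 1)) (inj₁ (F.e j))))))
          3 (C.deg-cell (# 4)) j
    in M′ , size , λ m m≢3 → count M′ gr m m≢3
    where
    open Marked M
    module P = Post S mark triangle⇒
    module C = P.Counting refl refl
    module F = P.Subsite (fan₂-in-twoTriangles {S} {mark})
    module T = P.Subsite (triangle-in-twoTriangles {S} {mark})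
    S₁ = Surgery.Apply.S′ S mark triangle⇒
    three : ∀ m → m ≢ 3 → bit (3 ≡ᵇ m) ≡ 0
    three 0 _ = refl
    three 1 _ = refl
    three 2 _ = refl
    three 3 h = contradiction refl h
    three (suc (suc (suc (suc m)))) _ = refl
    count : ∀ M′ → Grown S₁ (Marked.S M′) 3 (j + 3) → ∀ m → m ≢ 3 → numDeg (G (Marked.S M′)) m ≡ numDeg (G S) m + bit (j + 3 ≡ᵇ m)
    count M′ gr m m≢3 = begin
      numDeg (G (Marked.S M′)) m                    ≡⟨ +-identityʳ _ ⟨
      numDeg (G (Marked.S M′)) m + 0                ≡⟨ cong (numDeg (G (Marked.S M′)) m +_) (three m m≢3) ⟨
      numDeg (G (Marked.S M′)) m + bit (3 ≡ᵇ m)     ≡⟨ gr m m≢3 ⟩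
      -- No new cell of `twoTriangles` is adjacent to port 2, so the growth there is 0 and the two
      -- equal bits cancel.
      numDeg (G S₁) m + bit (j + 3 ≡ᵇ m)            ≡⟨ cong (_+ bit (j + 3 ≡ᵇ m)) (+-cancelʳ-≡ _ _ _ (C.grown m m≢3)) ⟩
      numDeg (G S) m + bit (j + 3 ≡ᵇ m)             ∎
      where open ≡-Reasoning

-- The families of graphs that show (strong) realizability.

module Families where
  open Cycles
  open Cuts
  open Rewriting
  open Effects
  open Hubs
  open import Data.Nat using (_∸_; _<_; z≤n)
  open import Data.Nat.Properties using (≤-refl; ≤-trans; +-mono-≤; m≤n+m; m≤m+n; *-identityˡ; <-irrefl; <⇒≤; m∸n+n≡m; ≡ᵇ⇒≡; ≡⇒≡ᵇ; *-monoʳ-≤; m≤m*n)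
  open import Data.Nat.Divisibility using (_∣_; divides)
  open import Data.Bool.Properties using (T-≡)
  open import Data.Fin using () renaming (_<_ to _<ᶠ_)
  open import Data.Fin.Properties using (injective⇒≤) renaming (<-cmp to <ᶠ-cmp)
  open import Data.Fin.Subset using (Subset; ∣_∣) renaming (_∈_ to _∈ˢ_; _∉_ to _∉ˢ_)
  open import Data.Vec using ([]; _∷_; here; there)
  open import Data.List.Properties using (length-map)
  open import Relation.Binary.Definitions using (tri<; tri≈; tri>)
  open import Function.Bundles using (Equivalence)

  open State using (G)

  elements : ∀ {m} → Subset m → List (Fin m)
  elements []          = []
  elements (true ∷ S)  = zero ∷ map suc (elements S)
  elements (false ∷ S) = map suc (elements S)

  length-elements : ∀ {m} (S : Subset m) → length (elements S) ≡ ∣ S ∣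
  length-elements []          = refl
  length-elements (true ∷ S)  = cong suc (≡-trans (length-map suc (elements S)) (length-elements S))
  length-elements (false ∷ S) = ≡-trans (length-map suc (elements S)) (length-elements S)

  elements⁺ : ∀ {m} {S : Subset m} {w} → w ∈ˢ S → w ∈ elements S
  elements⁺ {S = true ∷ S}  here      = here refl
  elements⁺ {S = true ∷ S}  (there h) = there (∈-map⁺ suc (elements⁺ h))
  elements⁺ {S = false ∷ S} (there h) = ∈-map⁺ suc (elements⁺ h)

  elements⁻ : ∀ {m} (S : Subset m) {w} → w ∈ elements S → w ∈ˢ S
  elements⁻ (true ∷ S) (here refl) = here
  elements⁻ (true ∷ S) (there h) with ∈-map⁻ suc h
  ... | _ , h′ , refl = there (elements⁻ S h′)
  elements⁻ (false ∷ S) h with ∈-map⁻ suc h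
  ... | _ , h′ , refl = there (elements⁻ S h′)

  other : ∀ {m} → 3 ≤ m → (u v : Fin m) → ∃ λ s → u ≢ s × v ≢ s
  other (s≤s (s≤s (s≤s _))) zero          zero          = suc zero , (λ ()) , (λ ())
  other (s≤s (s≤s (s≤s _))) zero          (suc zero)    = suc (suc zero) , (λ ()) , (λ ())
  other (s≤s (s≤s (s≤s _))) zero          (suc (suc v)) = suc zero , (λ ()) , (λ ())
  other (s≤s (s≤s (s≤s _))) (suc zero)    zero          = suc (suc zero) , (λ ()) , (λ ())
  other (s≤s (s≤s (s≤s _))) (suc (suc u)) zero          = suc zero , (λ ()) , (λ ())
  other (s≤s (s≤s (s≤s _))) (suc u)       (suc v)       = zero , (λ ()) , (λ ())

  -- Smaller separators are padded to a pair: the empty one by a vertex other than `u` and `v`, a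
  -- single vertex by repeating it.
  connected⇒3-connected : (H : Graph) → 3 < n H → Connected₃ (Adj H) → KConnected 3 H
  connected⇒3-connected H 3<n conn = 3<n , λ S S<3 u v u∉ v∉ →
    separate S u v u∉ v∉ (elements S) (subst (_< 3) (sym (length-elements S)) S<3) (elements⁻ S) elements⁺
    where
    reach : ∀ {S x y u v} → (∀ {w} → w ∈ˢ S → w ≡ x ⊎ w ≡ y) → Path (Adj H) x y u v → Reach H S u v
    reach h []                  = here
    reach h ((e , wx , wy) ∷ p) = step e (λ w∈ → case h w∈ of λ { (inj₁ q) → wx q ; (inj₂ q) → wy q }) (reach h p)
    separate : ∀ S u v → u ∉ˢ S → v ∉ˢ S → (l : List (Fin (n H))) → length l < 3 → (∀ {w} → w ∈ l → w ∈ˢ S) → (∀ {w} → w ∈ˢ S → w ∈ l) → Reach H S u v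
    separate S u v u∉ v∉ [] _ from to with other (<⇒≤ 3<n) u v
    ... | s , us , vs = reach (λ w∈ → case to w∈ of λ ()) (conn s s us us vs vs)
    separate S u v u∉ v∉ (a ∷ []) _ from to =
      reach (λ w∈ → case to w∈ of λ { (here e) → inj₁ e }) (conn a a (≢a u∉) (≢a u∉) (≢a v∉) (≢a v∉))
      where
      ≢a : ∀ {w} → w ∉ˢ S → w ≢ a
      ≢a h refl = h (from (here refl))
    separate S u v u∉ v∉ (a ∷ b ∷ []) _ from to =
      reach (λ w∈ → case to w∈ of λ { (here e) → inj₁ e ; (there (here e)) → inj₂ e }) (conn a b (≢a u∉) (≢b u∉) (≢a v∉) (≢b v∉))
      where
      ≢a : ∀ {w} → w ∉ˢ S → w ≢ a
      ≢a h refl = h (from (here refl))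
      ≢b : ∀ {w} → w ∉ˢ S → w ≢ b
      ≢b h refl = h (from (there (here refl)))
    separate S u v u∉ v∉ (_ ∷ _ ∷ _ ∷ _) (s≤s (s≤s (s≤s ()))) from to

  ≡ᵇ-true : ∀ {a b} → (a ≡ᵇ b) ≡ true → a ≡ b
  ≡ᵇ-true {a} {b} e = ≡ᵇ⇒≡ a b (Equivalence.from T-≡ e)

  ≡ᵇ-refl : ∀ a → (a ≡ᵇ a) ≡ true
  ≡ᵇ-refl a = Equivalence.to T-≡ (≡⇒≡ᵇ a a refl)

  cnt-pos : ∀ {m} (f : Fin m → Bool) i → f i ≡ true → 1 ≤ cnt f
  cnt-pos f zero    e rewrite e = s≤s z≤n
  cnt-pos f (suc i) e = ≤-trans (cnt-pos (f ∘ suc) i e) (m≤n+m _ (bit (f zero)))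

  cnt-witness : ∀ {m} (f : Fin m → Bool) → 1 ≤ cnt f → ∃ λ i → f i ≡ true
  cnt-witness {suc m} f h with f zero in eq
  ... | true  = zero , eq
  ... | false = let i , e = cnt-witness (f ∘ suc) h in suc i , e

  numDeg-pos : ∀ H v → 1 ≤ numDeg H (deg H v)
  numDeg-pos H v = subst (1 ≤_) (sym (∣tabulate∣ (λ w → deg H w ≡ᵇ deg H v))) (cnt-pos (λ w → deg H w ≡ᵇ deg H v) v (≡ᵇ-refl (deg H v)))

  numDeg-witness : ∀ H m → 1 ≤ numDeg H m → ∃ λ v → deg H v ≡ m
  numDeg-witness H m h = let v , e = cnt-witness (λ w → deg H w ≡ᵇ m) (subst (1 ≤_) (∣tabulate∣ (λ w → deg H w ≡ᵇ m)) h) in v , ≡ᵇ-true e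

  occ : ℕ → List ℕ → ℕ
  occ m []       = 0
  occ m (j ∷ js) = bit (j + 3 ≡ᵇ m) + occ m js

  occ-pos : ∀ {m j js} → j ∈ js → j + 3 ≡ m → 1 ≤ occ m js
  occ-pos {m} {j} (here refl) refl rewrite ≡ᵇ-refl (j + 3) = s≤s z≤n
  occ-pos {m} {js = i ∷ _} (there h) e = ≤-trans (occ-pos h e) (m≤n+m _ (bit (i + 3 ≡ᵇ m)))

  occ-witness : ∀ m js → 1 ≤ occ m js → ∃ λ j → j ∈ js × j + 3 ≡ m
  occ-witness m (j ∷ js) h with j + 3 ≡ᵇ m in eq
  ... | true  = j , here refl , ≡ᵇ-true eq
  ... | false = let i , i∈ , e = occ-witness m js h in i , there i∈ , e

  occ≤length : ∀ m js → occ m js ≤ length js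
  occ≤length m []       = z≤n
  occ≤length m (j ∷ js) with j + 3 ≡ᵇ m
  ... | true  = s≤s (occ≤length m js)
  ... | false = ≤-trans (occ≤length m js) (m≤n+m _ 1)

  weight : List ℕ → ℕ
  weight []       = 0
  weight (j ∷ js) = j + 4 + weight js

  graph : Marked → Graph
  graph M = G (Marked.S M)

  addHubs : (js : List ℕ) (M : Marked) → Σ Marked λ M′ → n (graph M′) ≡ weight js + n (graph M) ×
    (∀ m → m ≢ 3 → numDeg (graph M′) m ≡ occ m js + numDeg (graph M) m)
  addHubs []       M = M , refl , λ m _ → refl
  addHubs (j ∷ js) M =
    let M₁ , size₁ , cnt₁ = addHubs js M
        M₂ , size₂ , cnt₂ = addHub M₁ j
    in M₂ ,
       ≡-trans size₂ (≡-trans (cong (λ z → j + (4 + z)) size₁) (solve 3 (λ j w z → j :+ (con 4 :+ (w :+ z)) := j :+ con 4 :+ w :+ z) refl j (weight js) (n (graph M)))) ,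
       λ m m≢3 → ≡-trans (cnt₂ m m≢3) (≡-trans (cong (_+ bit (j + 3 ≡ᵇ m)) (cnt₁ m m≢3))
         (solve 3 (λ o z b → (o :+ z) :+ b := (b :+ o) :+ z) refl (occ m js) (numDeg (graph M) m) (bit (j + 3 ≡ᵇ m))))
    where open +-*-Solver

  4≤n : (M : Marked) → 4 ≤ n (graph M)
  4≤n M = injective⇒≤ {f = f} f-inj
    where
    open Site (Marked.mark M)
    f : Fin 4 → Fin (n (graph M))
    f zero    = π zero
    f (suc i) = ι i
    f-inj : ∀ {i j} → f i ≡ f j → i ≡ j
    f-inj {zero}  {zero}  e = refl
    f-inj {zero}  {suc j} e = contradiction (sym e) (ι≢π j zero)
    f-inj {suc i} {zero}  e = contradiction e (ι≢π i zero)
    f-inj {suc i} {suc j} e = cong suc (ι-inj e)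

  marked-UH : (M : Marked) → UniquelyHamiltonian (graph M)
  marked-UH M = uniquelyHamiltonian (graph M) (<⇒≤ (4≤n M)) (State.ham (Marked.S M)) (State.uniq (Marked.S M))

  marked-connected : (M : Marked) → KConnected 3 (graph M)
  marked-connected M = connected⇒3-connected (graph M) (4≤n M) (State.conn (Marked.S M))

  marked-cubic : (M : Marked) → ∃ λ v → deg (graph M) v ≡ 3
  marked-cubic M = Site.ι (Marked.mark M) zero , Degrees.deg-ι (Marked.S M) (Marked.mark M) refl zero

  pick⁺ : ∀ {k} (f : Fin k → Bool) {is i} → i ∈ is → f i ≡ true → i ∈ pick f is
  pick⁺ f {j ∷ js} (here refl) e rewrite e = here refl
  pick⁺ f {j ∷ js} (there h)   e with f j
  ... | true  = there (pick⁺ f h e)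
  ... | false = pick⁺ f h e

  module Construction (k : ℕ) (d : Fin k → ℕ) (3<d : ∀ i → 3 < d i) (incr : ∀ i j → i <ᶠ j → d i < d j) (h : ℕ)
    (even : ∃ λ i → d i ≡ h + h + 4) (p : Fin k → Bool) where

    excess : Fin k → ℕ
    excess j = d j ∸ 3

    excess+3 : ∀ j → excess j + 3 ≡ d j
    excess+3 j = m∸n+n≡m (<⇒≤ (3<d j))

    d-inj : ∀ {i j} → d i ≡ d j → i ≡ j
    d-inj {i} {j} e with <ᶠ-cmp i j
    ... | tri< lt _ _ = contradiction (incr i j lt) (<-irrefl e)
    ... | tri≈ _ eq _ = eq
    ... | tri> _ _ gt = contradiction (incr j i gt) (<-irrefl (sym e))

    d≢3 : ∀ j → d j ≢ 3
    d≢3 j e = <-irrefl (sym e) (3<d j)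

    -- `once` supplies every prescribed degree to the seed. `late` selects the class D₂, whose
    -- degrees are added again at every step of the sequence.
    once late each : List ℕ
    once = map excess (allFin k)
    late = map excess (pick (not ∘ p) (allFin k))
    -- The leading 0 inserts one more triangle, so that the orders strictly increase even if p ≡ true.
    each = 0 ∷ late

    seed : Marked
    seed = proj₁ (addHubs once (proj₁ (twoHubs h)))

    family : ℕ → Marked
    family zero    = seed
    family (suc i) = proj₁ (addHubs each (family i))

    size-suc : ∀ i → n (graph (family (suc i))) ≡ weight each + n (graph (family i))
    size-suc i = proj₁ (proj₂ (addHubs each (family i)))

    size : ∀ i → n (graph (family i)) ≡ i * weight each + n (graph seed)
    size zero    = refl
    size (suc i) = ≡-trans (size-suc i) (≡-trans (cong (weight each +_) (size i)) (sym (+-assoc (weight each) _ _)))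

    hubs : ℕ → ℕ
    hubs m = bit (h + h + 4 ≡ᵇ m) + bit (h + h + 4 ≡ᵇ m)

    count : ∀ i m → m ≢ 3 → numDeg (graph (family i)) m ≡ i * occ m each + (occ m once + hubs m)
    count zero    m m≢3 = ≡-trans (proj₂ (proj₂ (addHubs once (proj₁ (twoHubs h)))) m m≢3) (cong (occ m once +_) (proj₂ (twoHubs h) m m≢3))
    count (suc i) m m≢3 = ≡-trans (proj₂ (proj₂ (addHubs each (family i))) m m≢3)
      (≡-trans (cong (occ m each +_) (count i m m≢3)) (sym (+-assoc (occ m each) _ _)))

    member : ∀ m → m ≢ 3 → ∀ js → 1 ≤ occ m (map excess js) → ∃ λ j → j ∈ js × d j ≡ m
    member m m≢3 js o with occ-witness m (map excess js) o
    ... | x , x∈ , e with ∈-map⁻ excess x∈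
    ... | j , j∈ , refl = j , j∈ , ≡-trans (sym (excess+3 j)) e

    three-off : ∀ m → m ≢ 3 → ∀ js → occ m (0 ∷ js) ≡ occ m js
    three-off m m≢3 js with 3 ≡ᵇ m in eq
    ... | true  = contradiction (sym (≡ᵇ-true eq)) m≢3
    ... | false = refl

    once-pos : ∀ j → 1 ≤ occ (d j) once
    once-pos j = occ-pos {js = once} (∈-map⁺ excess (∈-allFin j)) (excess+3 j)

    degrees : ∀ i → DegSetIs (graph (family i)) (SetM k d)
    degrees i = (λ v → within v (deg H v) refl) , attained
      where
      H = graph (family i)
      sum-pos : ∀ a b c → 1 ≤ a + (b + c) → 1 ≤ a ⊎ 1 ≤ b ⊎ 1 ≤ c
      sum-pos zero    zero    c l = inj₂ (inj₂ l)
      sum-pos zero    (suc b) c l = inj₂ (inj₁ (s≤s z≤n))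
      sum-pos (suc a) b       c l = inj₁ (s≤s z≤n)
      factor : ∀ a b → 1 ≤ a * b → 1 ≤ b
      factor a zero    l = subst (1 ≤_) (*-zeroʳ a) l
      factor a (suc b) l = s≤s z≤n
      hub : ∀ m → 1 ≤ hubs m → h + h + 4 ≡ m
      hub m l with h + h + 4 ≡ᵇ m in eq
      ... | true = ≡ᵇ-true eq
      within : ∀ v m → deg H v ≡ m → SetM k d m
      within v m e with m Data.Nat.≟ 3
      ... | yes refl = inj₁ refl
      ... | no m≢3 with sum-pos (i * occ m each) (occ m once) (hubs m) (subst (1 ≤_) (count i m m≢3) (subst (λ z → 1 ≤ numDeg H z) e (numDeg-pos H v)))
      ... | inj₁ l = let j , _ , e′ = member m m≢3 (pick (not ∘ p) (allFin k)) (subst (1 ≤_) (three-off m m≢3 late) (factor i (occ m each) l)) in inj₂ (j , e′)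
      ... | inj₂ (inj₁ l) = let j , _ , e′ = member m m≢3 (allFin k) l in inj₂ (j , e′)
      ... | inj₂ (inj₂ l) = inj₂ (proj₁ even , ≡-trans (proj₂ even) (hub m l))
      attained : ∀ m → SetM k d m → ∃ λ v → deg H v ≡ m
      attained m (inj₁ refl)       = marked-cubic (family i)
      attained m (inj₂ (j , refl)) = numDeg-witness H (d j) (subst (1 ≤_) (sym (count i (d j) (d≢3 j)))
        (≤-trans (once-pos j) (≤-trans (m≤m+n _ (hubs (d j))) (m≤n+m _ (i * occ (d j) each)))))

    realizes : ∀ i → Realizes (SetM k d) (graph (family i))
    realizes i = marked-UH (family i) , degrees i ,
      (λ { (inj₁ ()) ; (inj₂ (j , e)) → contradiction (subst (3 <_) e (3<d j)) (λ { (s≤s (s≤s ())) }) }) ,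
      λ _ → marked-connected (family i)

    -- Degrees in D₁ arise only in the seed: at most `length once` vertices come from `once`, and at
    -- most 2 are the hubs of even degree.
    bounded : ∀ i j → p j ≡ true → numDeg (graph (family i)) (d j) ≤ length once + 2
    bounded i j pj = subst (_≤ length once + 2) (sym (≡-trans (count i (d j) (d≢3 j)) (≡-trans (cong (λ z → i * z + (occ (d j) once + hubs (d j))) none) (cong (_+ (occ (d j) once + hubs (d j))) (*-zeroʳ i)))))
      (+-mono-≤ (occ≤length (d j) once) (+-mono-≤ (bit≤1 (h + h + 4 ≡ᵇ d j)) (bit≤1 (h + h + 4 ≡ᵇ d j))))
      where
      bit≤1 : ∀ b → bit b ≤ 1
      bit≤1 true  = ≤-refl
      bit≤1 false = z≤n
      none : occ (d j) each ≡ 0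
      none with occ (d j) each in eq
      ... | zero  = refl
      ... | suc _ with member (d j) (d≢3 j) (pick (not ∘ p) (allFin k))
                         (subst (1 ≤_) (≡-trans (sym eq) (three-off (d j) (d≢3 j) late)) (s≤s z≤n))
      ... | i′ , i∈ , e with d-inj e
      ... | refl = contradiction (≡-trans (sym (cong not pj)) (pick⇒ (not ∘ p) (allFin k) i∈)) λ ()

    -- The seed and each of the `i` steps contribute a vertex of degree `d j`, so there are at least
    -- `i + 1`. The order `i * w + s` is at most `(s + w) * (i + 1)`, which gives the constant.
    linear : ∀ i j → p j ≡ false → 1 * n (graph (family i)) ≤ (n (graph seed) + weight each) * numDeg (graph (family i)) (d j)
    linear i j pj = begin
      1 * n (graph (family i))                 ≡⟨ *-identityˡ _ ⟩
      n (graph (family i))                     ≡⟨ size i ⟩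
      i * w + s                                ≤⟨ m≤m+n _ (i * s + w) ⟩
      (i * w + s) + (i * s + w)                ≡⟨ solve 3 (λ i w s → (i :* w :+ s) :+ (i :* s :+ w) := (s :+ w) :* (i :+ con 1)) refl i w s ⟩
      (s + w) * (i + 1)                        ≤⟨ *-monoʳ-≤ (s + w) enough ⟩
      (s + w) * numDeg (graph (family i)) (d j) ∎
      where
      open Data.Nat.Properties.≤-Reasoning
      open +-*-Solver
      w = weight each
      s = n (graph seed)
      each-pos : 1 ≤ occ (d j) each
      each-pos = occ-pos {js = each} (there (∈-map⁺ excess (pick⁺ (not ∘ p) (∈-allFin j) (cong not pj)))) (excess+3 j)
      i≤ : ∀ i a → 1 ≤ a → i ≤ i * a
      i≤ i (suc a) _ = m≤m*n i (suc a)
      enough : i + 1 ≤ numDeg (graph (family i)) (d j)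
      enough = subst (i + 1 ≤_) (sym (count i (d j) (d≢3 j)))
        (+-mono-≤ (i≤ i (occ (d j) each) each-pos) (≤-trans (once-pos j) (m≤m+n _ (hubs (d j)))))

    increasing : ∀ i → n (graph (family i)) < n (graph (family (suc i)))
    increasing i = subst (n (graph (family i)) <_) (sym (size-suc i)) (s≤s (m≤n+m _ (3 + weight late)))

    order-pos : 0 < n (graph seed) + weight each
    order-pos = ≤-trans (s≤s z≤n) (≤-trans (4≤n seed) (m≤m+n _ (weight each)))

  module _ (k : ℕ) (d : Fin k → ℕ) (3<d : ∀ i → 3 < d i) (incr : ∀ i j → i <ᶠ j → d i < d j) where

    -- An even element exceeds 3, hence is at least 4 and is reached from the hubs of degree 4 in
    -- steps of two.
    half : ContainsEven (SetM k d) → ∃ λ h → ∃ λ i → d i ≡ h + h + 4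
    half (m , inj₁ refl , divides zero ())
    half (m , inj₁ refl , divides (suc zero) ())
    half (m , inj₁ refl , divides (suc (suc q)) ())
    half (m , inj₂ (i , refl) , divides q e) = go q e
      where
      go : ∀ q → d i ≡ q * 2 → ∃ λ h → ∃ λ i → d i ≡ h + h + 4
      go zero e          = contradiction (subst (3 <_) e (3<d i)) λ ()
      go (suc zero) e    = contradiction (subst (3 <_) e (3<d i)) λ { (s≤s (s≤s ())) }
      go (suc (suc h)) e = h , i , ≡-trans e (solve 1 (λ h → (con 2 :+ h) :* con 2 := h :+ h :+ con 4) refl h)
        where open +-*-Solver

    realizable : ContainsEven (SetM k d) → UhcRealizable (SetM k d)
    realizable ev = graph (family 0) , realizes 0
      where
      everywhere : Fin k → Bool
      everywhere _ = true
      open Construction k d 3<d incr (proj₁ (half ev)) (proj₂ (half ev)) everywhere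

    stronglyRealizable : ContainsEven (SetM k d) → StronglyUhcRealizable k d
    stronglyRealizable ev p = length once + 2 , 1 , n (graph seed) + weight each , s≤s z≤n , order-pos ,
      (λ i → graph (family i)) , increasing , realizes , bounded , linear
      where
      open Construction k d 3<d incr (proj₁ (half ev)) (proj₂ (half ev)) p

-- Thomason's parity argument.

module Parity where
  open Cycles
  open Gadgets
  open Rewriting
  open Effects
  open import Data.Nat using (z≤n)
  open import Data.Nat.Properties using (+-comm; +-suc; ≤-trans; suc-injective)
  open import Data.Nat.Divisibility using (_∣_; divides)
  open import Data.Fin using (fromℕ<)
  open import Data.Unit using (⊤)
  open import Data.List using (reverse; tabulate; cartesianProductWith)
  open import Data.List.Properties using (≡-dec; unfold-reverse; reverse-++; reverse-involutive; length-reverse; ∷-injective; ∷ʳ-injectiveʳ)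
  open import Data.List.Relation.Unary.All using ([]; _∷_)
  open import Data.List.Relation.Unary.AllPairs using ([]; _∷_)
  open import Data.List.Relation.Unary.Unique.DecPropositional using (unique?)
  open import Data.List.Membership.Propositional.Properties using (∈-cartesianProductWith⁺)
  open import Data.List.Membership.DecPropositional using (_∈?_)
  open import Data.List.Relation.Binary.Permutation.Propositional using (_↭_; prep; ↭-sym)
  open import Data.List.Relation.Binary.Permutation.Propositional.Properties using (++⁺ˡ; ↭-reverse)
  open import Relation.Nullary.Decidable using (⌊_⌋; _×-dec_; map′)
  open import Relation.Binary.Definitions using (DecidableEquality)

  private variable
    A B : Set

  Even Odd : ℕ → Set
  Even x = ∃ λ y → x ≡ y + y
  Odd x  = ∃ λ y → x ≡ suc (y + y)

  even+even : ∀ {x y} → Even x → Even y → Even (x + y)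
  even+even (a , refl) (b , refl) = a + b , solve 2 (λ a b → (a :+ a) :+ (b :+ b) := (a :+ b) :+ (a :+ b)) refl a b
    where open +-*-Solver

  even+odd : ∀ {x y} → Even x → Odd y → Odd (x + y)
  even+odd (a , refl) (b , refl) = a + b , solve 2 (λ a b → (a :+ a) :+ (con 1 :+ (b :+ b)) := con 1 :+ ((a :+ b) :+ (a :+ b))) refl a b
    where open +-*-Solver

  odd+even : ∀ {x y} → Odd x → Even y → Odd (x + y)
  odd+even {x} {y} o e = subst Odd (+-comm y x) (even+odd e o)

  even⊎odd : ∀ x → Even x ⊎ Odd x
  even⊎odd zero = inj₁ (0 , refl)
  even⊎odd (suc x) with even⊎odd x
  ... | inj₁ (y , refl) = inj₂ (y , refl)
  ... | inj₂ (y , refl) = inj₁ (suc y , cong suc (sym (+-suc y y)))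

  even⊥odd : ∀ {x} → Even x → Odd x → ⊥
  even⊥odd (y , e) (z , e′) = go y z (≡-trans (sym e) e′)
    where
    go : ∀ y z → y + y ≢ suc (z + z)
    go (suc y) zero    e = case suc-injective (≡-trans (sym (cong suc (+-suc y y))) e) of λ ()
    go (suc y) (suc z) e = go y z (suc-injective (suc-injective (≡-trans (sym (cong suc (+-suc y y))) (≡-trans e (cong (λ k → suc (suc k)) (+-suc z z))))))

  even⇒2∣ : ∀ {x} → Even x → 2 ∣ x
  even⇒2∣ (y , refl) = divides y (solve 1 (λ y → y :+ y := y :* con 2) refl y)
    where open +-*-Solver

  sumL : List A → (A → ℕ) → ℕ
  sumL []       f = 0
  sumL (x ∷ xs) f = f x + sumL xs f

  sumL-cong : (xs : List A) {f g : A → ℕ} → (∀ x → f x ≡ g x) → sumL xs f ≡ sumL xs g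
  sumL-cong []       h = refl
  sumL-cong (x ∷ xs) h = cong₂ _+_ (h x) (sumL-cong xs h)

  sumL-zero : (xs : List A) → sumL xs (λ _ → 0) ≡ 0
  sumL-zero []       = refl
  sumL-zero (x ∷ xs) = sumL-zero xs

  sumL-+ : (xs : List A) (f g : A → ℕ) → sumL xs (λ x → f x + g x) ≡ sumL xs f + sumL xs g
  sumL-+ []       f g = refl
  sumL-+ (x ∷ xs) f g = ≡-trans (cong ((f x + g x) +_) (sumL-+ xs f g))
    (solve 4 (λ a b c d → (a :+ b) :+ (c :+ d) := (a :+ c) :+ (b :+ d)) refl (f x) (g x) (sumL xs f) (sumL xs g))
    where open +-*-Solver

  sumL-swap : (xs : List A) (ys : List B) (f : A → B → ℕ) → sumL xs (λ x → sumL ys (f x)) ≡ sumL ys (λ y → sumL xs (λ x → f x y))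
  sumL-swap []       ys f = sym (sumL-zero ys)
  sumL-swap (x ∷ xs) ys f = ≡-trans (cong (sumL ys (f x) +_) (sumL-swap xs ys f)) (sym (sumL-+ ys (f x) _))

  -- Each pair of distinct positions is counted twice, and the diagonal contributes nothing.
  handshake : (xs : List A) (r : A → A → ℕ) → (∀ x y → r x y ≡ r y x) → (∀ x → r x x ≡ 0) → Even (sumL xs (λ x → sumL xs (r x)))
  handshake []       r s z = 0 , refl
  handshake (x ∷ xs) r s z = subst Even (sym eq) (even+even (sumL xs (r x) , refl) (handshake xs r s z))
    where
    open ≡-Reasoning
    open +-*-Solver
    a = sumL xs (r x)
    b = sumL xs (λ y → sumL xs (r y))
    eq : sumL (x ∷ xs) (λ y → sumL (x ∷ xs) (r y)) ≡ (a + a) + b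
    eq = begin
      (r x x + a) + sumL xs (λ y → r y x + sumL xs (r y)) ≡⟨ cong₂ (λ u v → (u + a) + v) (z x) (sumL-+ xs (λ y → r y x) (λ y → sumL xs (r y))) ⟩
      a + (sumL xs (λ y → r y x) + b)                     ≡⟨ cong (λ u → a + (u + b)) (sumL-cong xs (λ y → s y x)) ⟩
      a + (a + b)                                         ≡⟨ +-assoc a a b ⟨
      (a + a) + b                                         ∎

  sumL-even : (xs : List A) (f : A → ℕ) → (∀ {x} → x ∈ xs → Even (f x)) → Even (sumL xs f)
  sumL-even []       f h = 0 , refl
  sumL-even (x ∷ xs) f h = even+even (h (here refl)) (sumL-even xs f (h ∘ there))

  one-odd : (xs : List A) (f : A → ℕ) {x₀ : A} → Unique xs → x₀ ∈ xs → Odd (f x₀) → (∀ x → x ≢ x₀ → Even (f x)) → Odd (sumL xs f)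
  one-odd (x ∷ xs) f u (here refl) o e = odd+even o (sumL-even xs f (λ {y} m → e y (λ { refl → unique-head u m })))
  one-odd (x ∷ xs) f u (there m)   o e = even+odd (e x (λ { refl → unique-head u m })) (one-odd xs f (unique-tail u) m o e)

  module _ (_≟ᴬ_ : DecidableEquality A) where

    indicator-0 : (xs : List A) {x₀ : A} → x₀ ∉ xs → sumL xs (λ x → bit ⌊ x₀ ≟ᴬ x ⌋) ≡ 0
    indicator-0 []       h = refl
    indicator-0 (x ∷ xs) {x₀} h with x₀ ≟ᴬ x
    ... | yes refl = contradiction (here refl) h
    ... | no _     = indicator-0 xs (h ∘ there)

    indicator-1 : (xs : List A) {x₀ : A} → Unique xs → x₀ ∈ xs → sumL xs (λ x → bit ⌊ x₀ ≟ᴬ x ⌋) ≡ 1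
    indicator-1 (x ∷ xs) {x₀} u m with x₀ ≟ᴬ x
    ... | yes refl = cong suc (indicator-0 xs (unique-head u))
    indicator-1 (x ∷ xs) u (here e)  | no h = contradiction e h
    indicator-1 (x ∷ xs) u (there m) | no h = indicator-1 xs (unique-tail u) m

  sumL-tabulate : ∀ {m} (g : Fin m → A) (f : A → Bool) → sumL (tabulate g) (bit ∘ f) ≡ cnt (f ∘ g)
  sumL-tabulate {m = zero}  g f = refl
  sumL-tabulate {m = suc m} g f = cong (bit (f (g zero)) +_) (sumL-tabulate (g ∘ suc) f)

  listsOf : ∀ m → ℕ → List (List (Fin m))
  listsOf m zero    = [] ∷ []
  listsOf m (suc ℓ) = cartesianProductWith _∷_ (allFin m) (listsOf m ℓ)

  listsOf-unique : ∀ m ℓ → Unique (listsOf m ℓ)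
  listsOf-unique m zero    = [] ∷ []
  listsOf-unique m (suc ℓ) = Unique.cartesianProductWith⁺ _∷_ ∷-injective (Unique.allFin⁺ m) (listsOf-unique m ℓ)

  listsOf-complete : ∀ m (xs : List (Fin m)) → xs ∈ listsOf m (length xs)
  listsOf-complete m []       = here refl
  listsOf-complete m (x ∷ xs) = ∈-cartesianProductWith⁺ _∷_ (∈-allFin x) (listsOf-complete m xs)

  Open : (A → A → Set) → A → List A → Set
  Open R x []       = ⊤
  Open R x (y ∷ ys) = R x y × Open R y ys

  open? : {R : A → A → Set} → (∀ u v → Dec (R u v)) → ∀ x ys → Dec (Open R x ys)
  open? R? x []       = yes tt
  open? R? x (y ∷ ys) = R? x y ×-dec open? R? y ys

  module _ {R : A → A → Set} where

    open-++⁻ : ∀ {x} as {v bs} → Open R x (as ++ v ∷ bs) → Links R x as v × Open R v bs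
    open-++⁻ []       (r , o) = r , o
    open-++⁻ (a ∷ as) (r , o) = (r , proj₁ (open-++⁻ as o)) , proj₂ (open-++⁻ as o)

    open-++⁺ : ∀ {x} as {v bs} → Links R x as v → Open R v bs → Open R x (as ++ v ∷ bs)
    open-++⁺ []       r       o = r , o
    open-++⁺ (a ∷ as) (r , l) o = r , open-++⁺ as l o

    open-last : ∀ x ys {z} → Open R x ys → R (lastOf x ys) z → Links R x ys z
    open-last x []       o       r = r
    open-last x (y ∷ ys) (e , o) r = e , open-last y ys o r

    links-open : ∀ x ys {z} → Links R x ys z → Open R x ys × R (lastOf x ys) z
    links-open x []       r       = tt , r
    links-open x (y ∷ ys) (e , l) = (e , proj₁ (links-open y ys l)) , proj₂ (links-open y ys l)

    links-reverse : (∀ {u v} → R u v → R v u) → ∀ x ys z → Links R x ys z → Links R z (reverse ys) x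
    links-reverse s x []       z r       = s r
    links-reverse s x (y ∷ ys) z (r , l) =
      subst (λ q → Links R z q x) (sym (unfold-reverse y ys)) (links-++⁺ (reverse ys) (links-reverse s y ys z l) (s r))

  lastOf-++ : ∀ (x : A) as v bs → lastOf x (as ++ v ∷ bs) ≡ lastOf v bs
  lastOf-++ x []       v bs = refl
  lastOf-++ x (a ∷ as) v bs = lastOf-++ a as v bs

  lastOf-∈ : ∀ (x : A) ys → lastOf x ys ∈ x ∷ ys
  lastOf-∈ x []       = here refl
  lastOf-∈ x (y ∷ ys) = there (lastOf-∈ y ys)

  penultimate : A → List A → A
  penultimate x []           = x
  penultimate x (y ∷ [])     = x
  penultimate x (y ∷ z ∷ zs) = penultimate y (z ∷ zs)

  penultimate-∷ʳ : ∀ (x : A) ys z → penultimate x (ys ++ z ∷ []) ≡ lastOf x ys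
  penultimate-∷ʳ x []           z = refl
  penultimate-∷ʳ x (y ∷ [])     z = refl
  penultimate-∷ʳ x (y ∷ y′ ∷ ys) z = penultimate-∷ʳ y (y′ ∷ ys) z

  snoc : ∀ (y : A) ys → ∃₂ λ ms e → y ∷ ys ≡ ms ++ e ∷ []
  snoc y []        = [] , y , refl
  snoc y (y′ ∷ ys) = let ms , e , eq = snoc y′ ys in y ∷ ms , e , cong (y ∷_) eq

  -- The lollipop move: the edge from `v` to its successor is replaced by the edge from `v` to the
  -- end of the path, so the part behind `v` is reversed.
  rotate : ∀ {m} → List (Fin m) → Fin m → List (Fin m)
  rotate []       v = []
  rotate (y ∷ ys) v with y ≟ v
  ... | yes _ = y ∷ reverse ys
  ... | no _  = y ∷ rotate ys v

  rotate-at : ∀ {m} as (v : Fin m) bs → v ∉ as → rotate (as ++ v ∷ bs) v ≡ as ++ v ∷ reverse bs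
  rotate-at []       v bs h with v ≟ v
  ... | yes _ = refl
  ... | no h′ = contradiction refl h′
  rotate-at (a ∷ as) v bs h with a ≟ v
  ... | yes refl = contradiction (here refl) h
  ... | no _     = cong (a ∷_) (rotate-at as v bs (h ∘ there))

  length-rotate : ∀ {m} ys (v : Fin m) → length (rotate ys v) ≡ length ys
  length-rotate []       v = refl
  length-rotate (y ∷ ys) v with y ≟ v
  ... | yes _ = cong suc (length-reverse ys)
  ... | no _  = cong suc (length-rotate ys v)

  headIs : A → List A → Set
  headIs a []      = ⊥
  headIs a (b ∷ _) = b ≡ a

  step-succ : ∀ {x : A} xs {z u q} pre s rest → Unique (x ∷ xs) → x ∷ xs ≡ pre ++ u ∷ s ∷ rest → Step x xs z u q → q ≡ s
  step-succ []       []            s rest un () st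
  step-succ []       (_ ∷ [])      s rest un () st
  step-succ []       (_ ∷ _ ∷ _)   s rest un () st
  step-succ (y ∷ ys) []            s rest un refl (inj₁ (refl , refl)) = refl
  step-succ (y ∷ ys) []            s rest un refl (inj₂ st) = contradiction (source ys st) (unique-head un)
    where
    source : ∀ {x : _} xs {z u q} → Step x xs z u q → u ∈ x ∷ xs
    source []       (refl , _)        = here refl
    source (_ ∷ xs) (inj₁ (refl , _)) = here refl
    source (_ ∷ xs) (inj₂ st)         = there (source xs st)
  step-succ (y ∷ ys) (a ∷ pre)     s rest un e (inj₁ (refl , refl)) with ∷-injective e
  ... | refl , e′ = contradiction (subst (_ ∈_) (sym e′) (∈-++⁺ʳ pre (here refl))) (unique-head un)
  step-succ (y ∷ ys) (a ∷ pre)     s rest un e (inj₂ st) = step-succ ys pre s rest (unique-tail un) (proj₂ (∷-injective e)) st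

  -- A cycle that shares its first edge with x ∷ xs and uses only edges of x ∷ xs cannot turn back.
  same-direction : ∀ {x : A} xs → Unique (x ∷ xs) → ∀ pre p u rest₀ rest → x ∷ xs ≡ pre ++ p ∷ u ∷ rest₀ →
    p ∉ rest → x ∉ rest → Unique (u ∷ rest) → length rest ≡ length rest₀ → Links (SymStep x xs x) u rest x → rest ≡ rest₀
  same-direction xs un pre p u []         []         e p∉ x∉ un′ len l = refl
  same-direction {x = x} xs un pre p u (s ∷ rest₀) (q ∷ rest) e p∉ x∉ un′ len (inj₁ st , l)
    with step-succ xs (pre ++ p ∷ []) s rest₀ un (≡-trans e (sym (++-assoc pre (p ∷ []) (u ∷ s ∷ rest₀)))) st
  ... | refl = cong (q ∷_) (same-direction xs un (pre ++ p ∷ []) u q rest₀ rest (≡-trans e (sym (++-assoc pre (p ∷ []) (u ∷ q ∷ rest₀))))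
      (unique-head un′ ∘ there) (x∉ ∘ there) (unique-tail un′) (suc-injective len) l)
  same-direction {x = x} xs un pre p u (s ∷ rest₀) (q ∷ rest) e p∉ x∉ un′ len (inj₂ st , l)
    with step-pred xs (pre ++ p ∷ []) un (u≢x pre e) st (≡-trans e (sym (++-assoc pre (p ∷ []) (u ∷ s ∷ rest₀))))
    where
    u≢x : ∀ pre → x ∷ xs ≡ pre ++ p ∷ u ∷ s ∷ rest₀ → u ≢ x
    u≢x []        e refl with ∷-injective e
    ... | refl , refl = unique-head un (here refl)
    u≢x (a ∷ pre) e refl with ∷-injective e
    ... | refl , refl = unique-head un (∈-++⁺ʳ pre (there (here refl)))
  ... | pre′ , eq = contradiction (here (∷ʳ-injectiveʳ pre pre′ eq)) p∉

  module Lollipop (G : Graph) (odd : ∀ v → ¬ 2 ∣ deg G v) (x₀ x₁ : Fin (n G)) (ℓ : ℕ) where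

    V = Fin (n G)

    adj-flip : ∀ {u v} → Adj G u v → Adj G v u
    adj-flip {u} {v} e = ≡-trans (adj-sym G v u) e

    record IsPath (ys : List V) : Set where
      constructor isPath
      field
        len      : length ys ≡ ℓ
        unique   : Unique (x₀ ∷ ys)
        complete : ∀ a → a ∈ x₀ ∷ ys
        joined   : Open (Adj G) x₀ ys
        first    : headIs x₁ ys

    isPath? : ∀ ys → Dec (IsPath ys)
    isPath? ys = map′ (λ (a , b , c , d , e) → isPath a b c d e) (λ (isPath a b c d e) → a , b , c , d , e)
      ((length ys Data.Nat.≟ ℓ) ×-dec unique? _≟_ (x₀ ∷ ys) ×-dec all? (λ a → _∈?_ _≟_ a (x₀ ∷ ys)) ×-dec
        open? (λ u v → adj G u v ≟ᵇ true) x₀ ys ×-dec head? ys)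
      where
      head? : ∀ ys → Dec (headIs x₁ ys)
      head? []      = no λ ()
      head? (y ∷ _) = y ≟ x₁

    end : List V → V
    end ys = lastOf x₀ ys

    -- Moving at `x₀` would drop the fixed first edge, and moving at the predecessor of the end
    -- would change nothing.
    Pivot : List V → V → Set
    Pivot ys v = IsPath ys × v ≢ x₀ × Adj G (end ys) v × v ≢ penultimate x₀ ys

    pivot? : ∀ ys v → Dec (Pivot ys v)
    pivot? ys v = isPath? ys ×-dec ¬? (v ≟ x₀) ×-dec (adj G (end ys) v ≟ᵇ true) ×-dec ¬? (v ≟ penultimate x₀ ys)

    record Shape (ys : List V) (v : V) : Set where
      constructor shape
      field
        as ms : List V
        w e   : V
        eq    : ys ≡ as ++ v ∷ w ∷ ms ++ e ∷ []

    -- A pivot is not the end, since there are no loops, and not its predecessor; so at least two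
    -- vertices follow it.
    pivot-shape : ∀ {ys v} → Pivot ys v → Shape ys v
    pivot-shape {ys} {v} (isPath _ un co jo fi , v≢x₀ , ev , v≢p) with co v
    ... | here e = contradiction e v≢x₀
    ... | there v∈ with ∈-∃++ v∈
    ... | as , [] , refl = contradiction (subst (λ e → Adj G e v) (lastOf-++ x₀ as v []) ev) λ h → case ≡-trans (sym h) (adj-irr G v) of λ ()
    ... | as , w ∷ [] , refl = contradiction (sym (≡-trans (cong (penultimate x₀) (sym (++-assoc as (v ∷ []) (w ∷ []))))
        (≡-trans (penultimate-∷ʳ x₀ (as ++ v ∷ []) w) (lastOf-++ x₀ as v [])))) v≢p
    ... | as , w ∷ b ∷ bs , refl with snoc b bs
    ... | ms , e , eq = shape as ms w e (cong (λ l → as ++ v ∷ w ∷ l) eq)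

    flipped : ∀ (w : V) ms e → reverse (w ∷ ms ++ e ∷ []) ≡ e ∷ reverse ms ++ w ∷ []
    flipped w ms e = ≡-trans (unfold-reverse w (ms ++ e ∷ [])) (cong (_++ w ∷ []) (reverse-++ ms (e ∷ [])))

    Rotated : List V → V → List V → Set
    Rotated ys v zs = Pivot ys v × rotate ys v ≡ zs

    end-shape : ∀ (as : List V) v w ms e → end (as ++ v ∷ w ∷ ms ++ e ∷ []) ≡ e
    end-shape as v w ms e = ≡-trans (lastOf-++ x₀ as v (w ∷ ms ++ e ∷ [])) (lastOf-++ w ms e [])

    -- The new end is `w`, the former successor of `v`, so `v` is again a neighbour of the end;
    -- moving at `v` once more reverses the tail back.
    rotated-sym : ∀ {ys v zs} → Rotated ys v zs → Rotated zs v ys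
    rotated-sym {v = v} (pv , refl) with pivot-shape pv
    rotated-sym {v = v} ((isPath len un co jo fi , v≢x₀ , ev , v≢p) , refl) | shape as ms w e refl =
      subst (λ zs → Rotated zs v ys) (sym rot) ((isPath len′ un′ co′ jo′ (first as fi) , v≢x₀ , wv , v≢p′) , back)
      where
      ys = as ++ v ∷ w ∷ ms ++ e ∷ []
      zs = as ++ v ∷ e ∷ reverse ms ++ w ∷ []
      v∉ = unique-middle as (unique-tail un)
      rot : rotate ys v ≡ zs
      rot = ≡-trans (rotate-at as v (w ∷ ms ++ e ∷ []) (proj₁ v∉)) (cong (λ l → as ++ v ∷ l) (flipped w ms e))
      back : rotate zs v ≡ ys
      back = ≡-trans (rotate-at as v (e ∷ reverse ms ++ w ∷ []) (proj₁ v∉))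
        (cong (λ l → as ++ v ∷ l) (≡-trans (flipped e (reverse ms) w) (cong (λ l → w ∷ l ++ e ∷ []) (reverse-involutive ms))))
      perm : x₀ ∷ ys ↭ x₀ ∷ zs
      perm = prep x₀ (++⁺ˡ as (prep v (↭-sym (subst (_↭ w ∷ ms ++ e ∷ []) (flipped w ms e) (↭-reverse (w ∷ ms ++ e ∷ []))))))
      len′ : length zs ≡ ℓ
      len′ = ≡-trans (cong length (sym rot)) (≡-trans (length-rotate ys v) len)
      un′ : Unique (x₀ ∷ zs)
      un′ = unique-resp-↭ perm un
      co′ : ∀ a → a ∈ x₀ ∷ zs
      co′ a = ∈-resp-↭ perm (co a)
      parts : Links (Adj G) x₀ as v × Adj G v w × Open (Adj G) w (ms ++ e ∷ [])
      parts = open-++⁻ as jo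
      middle : Links (Adj G) e (reverse ms) w
      middle = links-reverse adj-flip w ms e (proj₁ (open-++⁻ ms (proj₂ (proj₂ parts))))
      ev′ : Adj G e v
      ev′ = subst (λ z → Adj G z v) (end-shape as v w ms e) ev
      jo′ : Open (Adj G) x₀ zs
      jo′ = open-++⁺ as (proj₁ parts) (adj-flip ev′ , open-++⁺ (reverse ms) middle tt)
      first : ∀ as → headIs x₁ (as ++ v ∷ w ∷ ms ++ e ∷ []) → headIs x₁ (as ++ v ∷ e ∷ reverse ms ++ w ∷ [])
      first []      h = h
      first (_ ∷ _) h = h
      wv : Adj G (end zs) v
      wv = subst (λ z → Adj G z v) (sym (end-shape as v e (reverse ms) w)) (adj-flip (proj₁ (proj₂ parts)))
      pen : penultimate x₀ zs ≡ lastOf e (reverse ms)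
      pen = ≡-trans (cong (penultimate x₀) (sym (++-assoc as (v ∷ e ∷ reverse ms) (w ∷ []))))
        (≡-trans (penultimate-∷ʳ x₀ (as ++ v ∷ e ∷ reverse ms) w) (lastOf-++ x₀ as v (e ∷ reverse ms)))
      v≢p′ : v ≢ penultimate x₀ zs
      v≢p′ h = proj₂ (unique-middle as (unique-tail un′)) (subst (_∈ e ∷ reverse ms ++ w ∷ []) (sym (≡-trans h pen))
        (∈-++⁺ˡ {xs = e ∷ reverse ms} (lastOf-∈ e (reverse ms))))

    -- The end changes from `e` to the different vertex `w`.
    rotated-irr : ∀ {ys v} → ¬ Rotated ys v ys
    rotated-irr {v = v} (pv , eq) with pivot-shape pv
    rotated-irr {v = v} ((isPath len un co jo fi , _) , eq) | shape as ms w e refl =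
      unique-head (unique-tail (unique-++ʳ as (unique-tail un))) (subst (_∈ ms ++ e ∷ []) e≡w (∈-++⁺ʳ ms (here refl)))
      where
      ys = as ++ v ∷ w ∷ ms ++ e ∷ []
      unique-++ʳ : ∀ as {bs} → Unique (as ++ bs) → Unique bs
      unique-++ʳ []       u       = u
      unique-++ʳ (_ ∷ as) (_ ∷ u) = unique-++ʳ as u
      rot : rotate ys v ≡ as ++ v ∷ e ∷ reverse ms ++ w ∷ []
      rot = ≡-trans (rotate-at as v (w ∷ ms ++ e ∷ []) (proj₁ (unique-middle as (unique-tail un)))) (cong (λ l → as ++ v ∷ l) (flipped w ms e))
      e≡w : e ≡ w
      e≡w = ≡-trans (sym (end-shape as v w ms e)) (≡-trans (cong end (≡-trans (sym eq) rot)) (end-shape as v e (reverse ms) w))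

    _≟ᴸ_ : DecidableEquality (List V)
    _≟ᴸ_ = ≡-dec _≟_

    term : List V → List V → V → ℕ
    term ys zs v = bit ⌊ pivot? ys v ⌋ * bit ⌊ rotate ys v ≟ᴸ zs ⌋

    term-yes : ∀ {ys zs v} → Rotated ys v zs → term ys zs v ≡ 1
    term-yes {ys} {zs} {v} (pv , eq) with pivot? ys v | rotate ys v ≟ᴸ zs
    ... | yes _ | yes _ = refl
    ... | yes _ | no h  = contradiction eq h
    ... | no h  | _     = contradiction pv h

    term-no : ∀ {ys zs v} → ¬ Rotated ys v zs → term ys zs v ≡ 0
    term-no {ys} {zs} {v} h with pivot? ys v | rotate ys v ≟ᴸ zs
    ... | yes p | yes q = contradiction (p , q) h
    ... | yes _ | no _  = refl
    ... | no _  | _     = refl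

    rotated? : ∀ ys v zs → Dec (Rotated ys v zs)
    rotated? ys v zs = pivot? ys v ×-dec (rotate ys v ≟ᴸ zs)

    -- A multiplicity, counted over pivots. The degree of a path is then its number of pivots,
    -- without showing that different pivots lead to different paths.
    edges : List V → List V → ℕ
    edges ys zs = sumL (allFin (n G)) (term ys zs)

    edges-sym : ∀ ys zs → edges ys zs ≡ edges zs ys
    edges-sym ys zs = sumL-cong (allFin (n G)) go
      where
      go : ∀ v → term ys zs v ≡ term zs ys v
      go v with rotated? ys v zs
      ... | yes h = ≡-trans (term-yes h) (sym (term-yes (rotated-sym h)))
      ... | no h  = ≡-trans (term-no h) (sym (term-no (h ∘ rotated-sym)))

    edges-irr : ∀ ys → edges ys ys ≡ 0
    edges-irr ys = ≡-trans (sumL-cong (allFin (n G)) (λ v → term-no (rotated-irr {ys} {v}))) (sumL-zero (allFin (n G)))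

    -- All lists of the right length serve as vertices of the auxiliary graph; those that are not
    -- paths have degree 0 and leave every parity unchanged.
    paths : List (List V)
    paths = listsOf (n G) ℓ

    degree : List V → ℕ
    degree ys = cnt (λ v → ⌊ pivot? ys v ⌋)

    -- After the sums are exchanged, a pivot `v` contributes for exactly one list, `rotate ys v`.
    sum-edges : ∀ ys → sumL paths (edges ys) ≡ degree ys
    sum-edges ys = begin
      sumL paths (λ zs → sumL (allFin (n G)) (term ys zs))                      ≡⟨ sumL-swap paths (allFin (n G)) (term ys) ⟩
      sumL (allFin (n G)) (λ v → sumL paths (λ zs → term ys zs v))              ≡⟨ sumL-cong (allFin (n G)) each ⟩
      sumL (allFin (n G)) (λ v → bit ⌊ pivot? ys v ⌋)                           ≡⟨ sumL-tabulate id (λ v → ⌊ pivot? ys v ⌋) ⟩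
      degree ys                                                                 ∎
      where
      open ≡-Reasoning
      each : ∀ v → sumL paths (λ zs → term ys zs v) ≡ bit ⌊ pivot? ys v ⌋
      each v with pivot? ys v
      ... | no _ = sumL-zero paths
      ... | yes (isPath len _ _ _ _ , _) = ≡-trans (sumL-cong paths (λ zs → +-identityʳ _))
        (indicator-1 _≟ᴸ_ paths (listsOf-unique (n G) ℓ)
          (subst (λ k → rotate ys v ∈ listsOf (n G) k) (≡-trans (length-rotate ys v) len) (listsOf-complete (n G) (rotate ys v))))

    even-total : Even (sumL paths degree)
    even-total = subst Even (sumL-cong paths sum-edges) (handshake paths edges edges-sym edges-irr)

    -- Every neighbour of the end is a pivot, except its predecessor and possibly x₀.
    degree-path : ∀ ys → IsPath ys → 2 ≤ ℓ → deg G (end ys) ≡ suc (degree ys + bit (adj G (end ys) x₀))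
    degree-path ys P@(isPath len un co jo fi) 2≤ℓ = begin
      deg G e                                     ≡⟨ ∣tabulate∣ (adj G e) ⟩
      cnt (adj G e)                               ≡⟨ +-identityʳ _ ⟨
      cnt (adj G e) + 0                           ≡⟨ cong (λ b → cnt (adj G e) + bit b) f₁x₀ ⟨
      cnt (adj G e) + bit (f₁ x₀)                 ≡⟨ cnt-change (adj G e) f₁ x₀ (λ i h → sym (f₁-else i h)) ⟩
      cnt f₁ + bit (adj G e x₀)                   ≡⟨ cong (_+ bit (adj G e x₀)) count₁ ⟩
      suc (degree ys) + bit (adj G e x₀)          ∎
      where
      open ≡-Reasoning
      e = end ys
      p = penultimate x₀ ys
      f₁ : V → Bool
      f₁ v = adj G e v ∧ not ⌊ v ≟ x₀ ⌋
      f₁x₀ : f₁ x₀ ≡ false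
      f₁x₀ with x₀ ≟ x₀
      ... | no h  = contradiction refl h
      ... | yes _ with adj G e x₀
      ... | true  = refl
      ... | false = refl
      f₁-else : ∀ i → i ≢ x₀ → f₁ i ≡ adj G e i
      f₁-else i h with i ≟ x₀
      ... | yes e = contradiction e h
      ... | no _ with adj G e i
      ... | true  = refl
      ... | false = refl
      last-edge : ∀ x ys → 2 ≤ length ys → Unique (x ∷ ys) → Open (Adj G) x ys →
        Adj G (lastOf x ys) (penultimate x ys) × penultimate x ys ∈ ys
      last-edge x (y ∷ z ∷ [])      l u (r , r′ , _) = adj-flip r′ , here refl
      last-edge x (y ∷ z ∷ z′ ∷ zs) l u (r , o) =
        let a , m = last-edge y (z ∷ z′ ∷ zs) (s≤s (s≤s z≤n)) (unique-tail u) o in a , there m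
      last-edge x (y ∷ []) (s≤s ()) u o
      le = last-edge x₀ ys (subst (2 ≤_) (sym len) 2≤ℓ) un jo
      p≢x₀ : p ≢ x₀
      p≢x₀ h = unique-head un (subst (_∈ ys) h (proj₂ le))
      pivot-p : ⌊ pivot? ys p ⌋ ≡ false
      pivot-p with pivot? ys p
      ... | yes (_ , _ , _ , h) = contradiction refl h
      ... | no _                = refl
      pivot-else : ∀ v → v ≢ p → f₁ v ≡ ⌊ pivot? ys v ⌋
      pivot-else v v≢p with pivot? ys v
      ... | yes (_ , v≢x₀ , a , _) = ≡-trans (f₁-else v v≢x₀) a
      ... | no h with v ≟ x₀
      ... | yes refl with adj G e v
      ... | true  = refl
      ... | false = refl
      pivot-else v v≢p | no h | no v≢x₀ = absent (adj G e v) refl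
        where
        absent : ∀ b → adj G e v ≡ b → b ∧ true ≡ false
        absent true  eq = contradiction (P , v≢x₀ , eq , v≢p) h
        absent false eq = refl
      count₁ : cnt f₁ ≡ suc (degree ys)
      count₁ = begin
        cnt f₁                                     ≡⟨ +-identityʳ _ ⟨
        cnt f₁ + 0                                 ≡⟨ cong (λ b → cnt f₁ + bit b) pivot-p ⟨
        cnt f₁ + bit ⌊ pivot? ys p ⌋               ≡⟨ cnt-change f₁ (λ v → ⌊ pivot? ys v ⌋) p pivot-else ⟩
        degree ys + bit (f₁ p)                     ≡⟨ cong (λ b → degree ys + bit b) (≡-trans (f₁-else p p≢x₀) (proj₁ le)) ⟩
        degree ys + 1                              ≡⟨ +-comm (degree ys) 1 ⟩
        suc (degree ys)                            ∎

    degree-nonpath : ∀ ys → ¬ IsPath ys → degree ys ≡ 0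
    degree-nonpath ys h = ≡-trans (cnt-cong go) (≡-trans (cnt-const (n G) false) (*-zeroʳ (n G)))
      where
      go : ∀ v → ⌊ pivot? ys v ⌋ ≡ false
      go v with pivot? ys v
      ... | yes (P , _) = contradiction P h
      ... | no _        = refl

    -- The degree of the end in `G` is odd. It exceeds `degree ys` by 2 if the path closes up and by
    -- 1 otherwise, so closing paths are exactly those of odd degree.
    degree-closed : ∀ ys → IsPath ys → 2 ≤ ℓ → Adj G (end ys) x₀ → Odd (degree ys)
    degree-closed ys P l a with even⊎odd (degree ys)
    ... | inj₂ o = o
    ... | inj₁ (y , e) = contradiction (even⇒2∣ (suc y , ≡-trans (degree-path ys P l) (≡-trans (cong (λ b → suc (degree ys + bit b)) a)
        (≡-trans (cong suc (≡-trans (+-comm (degree ys) 1) (cong suc e))) (cong suc (sym (+-suc y y))))))) (odd (end ys))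

    degree-open : ∀ ys → IsPath ys → 2 ≤ ℓ → ¬ Adj G (end ys) x₀ → Even (degree ys)
    degree-open ys P l na with even⊎odd (degree ys)
    ... | inj₁ ev = ev
    ... | inj₂ (y , e) with adj G (end ys) x₀ in eq
    ... | true  = contradiction refl na
    ... | false = contradiction (even⇒2∣ (suc y , ≡-trans (degree-path ys P l) (≡-trans (cong (λ b → suc (degree ys + bit b)) eq)
        (≡-trans (cong suc (≡-trans (+-identityʳ (degree ys)) e)) (cong suc (sym (+-suc y y))))))) (odd (end ys))

    -- A single closing path would be the only odd term in a sum that `handshake` makes even.
    no-unique : 2 ≤ ℓ → ∀ ys₀ → IsPath ys₀ → Adj G (end ys₀) x₀ → (∀ ys → IsPath ys → Adj G (end ys) x₀ → ys ≡ ys₀) → ⊥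
    no-unique l ys₀ P₀ a₀ only = even⊥odd even-total (one-odd paths degree (listsOf-unique (n G) ℓ)
      (subst (λ k → ys₀ ∈ listsOf (n G) k) (IsPath.len P₀) (listsOf-complete (n G) ys₀)) (degree-closed ys₀ P₀ l a₀) others)
      where
      others : ∀ ys → ys ≢ ys₀ → Even (degree ys)
      others ys ne = decide (isPath? ys) (adj G (end ys) x₀ ≟ᵇ true)
        where
        decide : Dec (IsPath ys) → Dec (Adj G (end ys) x₀) → Even (degree ys)
        decide (no h)  _       = 0 , degree-nonpath ys h
        decide (yes P) (yes a) = contradiction (only ys P a) ne
        decide (yes P) (no na) = degree-open ys P l na

  thomason : (G : Graph) → (∀ v → ¬ 2 ∣ deg G v) → ¬ UniquelyHamiltonian G
  thomason G odd (H , uniq) = go L.rest L.unique L.complete L.to L.from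
    where
    open HamCycle H
    x₀ : Fin (n G)
    x₀ = fromℕ< (≤-trans (s≤s z≤n) three≤n)
    L = listing σ σ-inj σ-surj x₀
    module L = Listing L
    go : ∀ rest → Unique (x₀ ∷ rest) → (∀ a → a ∈ x₀ ∷ rest) → (∀ {u v} → CycStep σ u v → Step x₀ rest x₀ u v) →
      (∀ {u v} → Step x₀ rest x₀ u v → CycStep σ u v) → ⊥
    go rest un co to from with subst (3 ≤_) (enumeration-length (x₀ ∷ rest) un co) three≤n
    go (x₁ ∷ rest) un co to from | s≤s 2≤ = no-unique 2≤ (x₁ ∷ rest) (isPath refl un co (proj₁ lo) refl) (proj₂ lo) only
      where
      open Lollipop G odd x₀ x₁ (length (x₁ ∷ rest))
      ls : Links (Adj G) x₀ (x₁ ∷ rest) x₀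
      ls = links-map (λ s → let i , p , q = from s in subst (λ u → Adj G u _) p (subst (Adj G (σ i)) q (σ-adj i))) (x₁ ∷ rest) (links-self x₀ (x₁ ∷ rest) x₀)
      lo = links-open x₀ (x₁ ∷ rest) ls
      -- A closing path is a hamiltonian cycle, so it has the edges of the given one by uniqueness;
      -- the common first edge then fixes the direction.
      only : ∀ ys → IsPath ys → Adj G (end ys) x₀ → ys ≡ x₁ ∷ rest
      only (.x₁ ∷ ys) (isPath len un′ co′ jo refl) a = cong (x₁ ∷_)
        (same-direction (x₁ ∷ rest) un [] x₀ x₁ rest ys refl (unique-head un′ ∘ there) (unique-head un′ ∘ there)
          (unique-tail un′) (suc-injective len) (proj₂ within))
        where
        H′ = hamCycle G three≤n (isHam un′ co′ (open-last x₀ (x₁ ∷ ys) jo a))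
        edge : ∀ {u v} → Step x₀ (x₁ ∷ ys) x₀ u v → SymStep x₀ (x₁ ∷ rest) x₀ u v
        edge {u} {v} s with proj₂ (uniq (proj₁ H′) u v) (proj₂ H′ (inj₁ s))
        ... | i , inj₁ c = inj₁ (to (i , c))
        ... | i , inj₂ c = inj₂ (to (i , c))
        within : Links (SymStep x₀ (x₁ ∷ rest) x₀) x₀ (x₁ ∷ ys) x₀
        within = links-map edge (x₁ ∷ ys) (links-self x₀ (x₁ ∷ ys) x₀)

-- Necessity and sufficiency combined.

open Families using (realizable; stronglyRealizable)
open Parity using (thomason)
open import Data.Nat using (_<_)
open import Data.Nat.Divisibility using (_∣?_)
open import Relation.Nullary.Decidable using (from-no)
open import Data.Fin using () renaming (_<_ to _<ᶠ_)

theorem1 : (k : ℕ) (d : Fin k → ℕ)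
    → (∀ i → 3 < d i)
    → (∀ i j → i <ᶠ j → d i < d j)
    → (UhcRealizable (SetM k d) → ContainsEven (SetM k d))
    × (ContainsEven (SetM k d) → UhcRealizable (SetM k d))
    × (ContainsEven (SetM k d) → StronglyUhcRealizable k d)
theorem1 k d 3<d incr = necessary , realizable k d 3<d incr , stronglyRealizable k d 3<d incr
  where
  -- If every `d i` is odd, then all degrees are odd, 3 included, which `thomason` excludes.
  necessary : UhcRealizable (SetM k d) → ContainsEven (SetM k d)
  necessary (H , uh , (within , _) , _) with any? (λ i → 2 ∣? d i)
  ... | yes (i , 2∣) = d i , inj₂ (i , refl) , 2∣
  ... | no none      = contradiction uh (thomason H odd)
    where
    odd : ∀ v → _
    odd v 2∣ with deg H v | within v
    ... | _ | inj₁ refl       = from-no (2 ∣? 3) 2∣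
    ... | _ | inj₂ (i , refl) = none (i , 2∣)
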